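{- The following problem (EL-k Net Persistence Problem) is decidable: given a place/transition net $\mathrm{S}=(P,T,F,M_0)$ and $\mathrm{k}\in\mathbb{N}$, decide whether $\mathrm{S}$ is e/l-$\mathrm{k}$-persistent.
   Context: A place/transition net (p/t-net) is $\mathrm{S}=(P,T,F,M_0)$ where $P$ (places) and $T$ (transitions) are finite disjoint sets, $F\subseteq P\times T\cup T\times P$ is the flow relation, and $M_0\in\mathbb{N}^P$ is the initial marking. Markings are vectors in $\mathbb{N}^P$, ordered and added componentwise. For $a\in T$, ${}^\bullet a\in\mathbb{N}^P$ is the vector with $1$ at places $p$ with $(p,a)\in F$ and $0$ elsewhere; $a^\bullet$ is the vector with $1$ at places $p$ with $(a,p)\in F$ and $0$ elsewhere. A transition $a$ is enabled in $M$ (written $Ma$) iff ${}^\bullet a\le M$; then firing $a$ yields $M'=(M-{}^\bullet a)+a^\bullet$ (written $MaM'$). This is extended to strings $w\in T^*$: $M\varepsilon M$, and $MvaM''$ iff $MvM'$ and $M'aM''$ for some $M'$; $Mw$ means $MwM'$ for some $M'$. The set $[M_0\rangle$ of reachable markings consists of all $M'$ with $M_0wM'$ for some $w\in T^*$. For $\mathrm{k}\in\mathbb{N}$, a step $Ma$ (with $a$ enabled in $M$) is e/l-$\mathrm{k}$-persistent iff for every $b\in T$, $b\neq a$, $Mb$ implies that there exists $w\in T^*$ with $|w|\le\mathrm{k}$ and $Mawb$. A marking $M$ is e/l-$\mathrm{k}$-persistent iff for every $a\in T$ enabled in $M$ the step $Ma$ is e/l-$\mathrm{k}$-persistent; the net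 is e/l-$\mathrm{k}$-persistent iff every marking in $[M_0\rangle$ is e/l-$\mathrm{k}$-persistent. -}

module Defs where

open import Data.Nat using (ℕ; zero; suc; _+_; _∸_; _≤_)
open import Data.Bool using (Bool; true; false)
open import Data.Fin using (Fin)
open import Data.List using (List; []; _∷_; _++_; [_]; length)
open import Data.Product using (Σ; ∃; _×_; _,_)
open import Relation.Binary.PropositionalEquality using (_≡_)
open import Relation.Nullary using (¬_)

-- A place/transition net S = (P, T, F, M0) with P = Fin nP, T = Fin nT.
-- The flow relation F ⊆ P×T ∪ T×P is given by its characteristic
-- functions on the two (disjoint) parts P×T and T×P.
record Net : Set where
  field
    nP   : ℕ
    nT   : ℕ
    inF  : Fin nP → Fin nT → Bool
    outF : Fin nT → Fin nP → Bool
    M₀   : Fin nP → ℕ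

module _ (S : Net) where
  open Net S

  Place = Fin nP
  Transition = Fin nT
  Marking = Place → ℕ

  χ : Bool → ℕ
  χ true  = 1
  χ false = 0

  pre : Transition → Marking
  pre a p = χ (inF p a)

  post : Transition → Marking
  post a p = χ (outF a p)

  Enabled : Marking → Transition → Set
  Enabled M a = ∀ p → pre a p ≤ M p

  fire : Marking → Transition → Marking
  fire M a p = (M p ∸ pre a p) + post a p

  data Fires : Marking → List Transition → Marking → Set where
    ε-fire : ∀ {M} → Fires M [] M
    step   : ∀ {M M' a w} → Enabled M a → Fires (fire M a) w M' → Fires M (a ∷ w) M'

  Firable : Marking → List Transition → Set
  Firable M w = ∃ λ M' → Fires M w M'

  Reachable : Marking → Set
  Reachable M = ∃ λ w → Fires M₀ w M

  StepPersistent : ℕ → Marking → Transition → Set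
  StepPersistent k M a =
    ∀ b → ¬ (b ≡ a) → Enabled M b →
      ∃ λ (w : List Transition) → length w ≤ k × Firable M (a ∷ w ++ [ b ])

  MarkingPersistent : ℕ → Marking → Set
  MarkingPersistent k M = ∀ a → Enabled M a → StepPersistent k M a

  ELkPersistent : ℕ → Set
  ELkPersistent k = ∀ M → Reachable M → MarkingPersistent k M

-- Whether a marking violates e/l-k-persistence depends only on the marking truncated at k + 2, so it
-- has to be decided whether a marking with one of finitely many truncations is reachable. This is
-- done by the decomposition of Mayr, Kosaraju and Lambert, coordinatewise and over ℕ throughout.
--
-- Runs are cut into chains of components: finite graphs whose edges consume and produce tokens, with
-- a value or ω prescribed for every coordinate of the first and of the last marking. The state
-- equation and Kirchhoff's law give a linear system for a chain. If it has no solution, there is no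
-- run. If every edge count and every ω is unbounded in it, and in every component all finite
-- coordinates can be pumped up by a cycle from the first marking and, backwards, from the last one,
-- then a run exists: add a large multiple of a positive homogeneous solution to a solution, pump up
-- first, realise the flow by an Eulerian walk, and pump down at the end. Otherwise some component
-- splits: an edge used boundedly often is cut out, a bounded ω is replaced by its possible values, or
-- a coordinate that stays bounded (Rackoff's argument) is moved into the states and becomes rigid. The
-- parts are smaller for the lexicographic order on (non-rigid coordinates, edges, ωs), so this ends.

module Submission where

open import Defs
open import Data.Nat renaming (_≟_ to _≟ℕ_)
open import Data.Nat.Properties hiding (_≟_)
open import Data.Nat.Induction using (<-rec; <-wellFounded)
open import Data.Nat.Tactic.RingSolver using (solve-∀)
open import Data.Bool using (Bool; true; false)
open import Data.Maybe using (Maybe; just; nothing)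
open import Data.Maybe.Properties using (just-injective)
open import Data.List as List using (List; []; _∷_; _++_; [_]; length; reverse; filter; upTo; cartesianProduct; cartesianProductWith)
open import Data.List.Properties using (≡-dec; ∷-injective; length-++; unfold-reverse; filter-notAll; length-tabulate)
open import Data.List.Relation.Unary.All using (All; []; _∷_)
open import Data.List.Relation.Unary.Any using (here; there)
open import Data.List.Membership.Propositional using (_∈_; lose)
open import Data.List.Membership.Propositional.Properties
  using (∈-filter⁺; ∈-upTo⁺; ∈-tabulate⁺; ∈-cartesianProduct⁺; ∈-cartesianProductWith⁺)
open import Data.Vec as Vec using (Vec; []; _∷_; lookup; tabulate)
open import Data.Vec.Properties using (lookup∘tabulate)
import Data.Vec.Properties as Vec
open import Data.Fin
  using (Fin; zero; suc; toℕ; fromℕ<; finToFun; funToFin; splitAt; join; combine; remQuot; punchIn; punchOut)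
open import Data.Fin.Properties
  using (_≟_; any?; all?; toℕ<n; toℕ-fromℕ<; finToFun-funToFin; splitAt-join; remQuot-combine; punchIn-punchOut)
open import Data.Product as Product hiding (swap)
import Data.Product.Properties as Product
open import Data.Sum as Sum using (_⊎_; inj₁; inj₂)
open import Data.Empty using (⊥-elim)
open import Data.Unit using (⊤; tt)
open import Function using (_∘_; id; case_of_)
open import Induction.WellFounded using (Acc; acc; WellFounded)
open import Relation.Nullary
open import Relation.Nullary.Decidable using (map′)
open import Relation.Binary.Definitions using (DecidableEquality)
open import Relation.Binary.PropositionalEquality hiding ([_]; J)
open import Algebra.Properties.Semiring.Sum +-*-semiring
  using (sum; sum-cong-≗; ∑-distrib-+; ∑-comm; *-distribˡ-sum; *-distribʳ-sum)

-- A word can be fired iff it can be fired on every coordinate separately, so all token arguments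
-- concern one coordinate and only the word is shared. A rigid coordinate remains a coordinate: the
-- dimension `d` stays fixed and all components of a chain still compose. The obstacle is gluing.
-- Neighbouring components share a marking, so one homogeneous solution and one pair of factors `K`,
-- `N` must serve the whole chain: `K` makes the homogeneous flow cover the pumping cycles and a
-- tour of every component, `N` provides the tokens for executing it. Conversely, bounds on edges
-- and ωs hold only for runs inside the chain, while splitting is local; hence splittings are
-- complete relative to a predicate on runs. Unboundedness is decidable because the solutions of a
-- homogenised system over ℕ form a finitely generated monoid: in a solvable system, a variable is
-- unbounded iff it is positive in a generator without constant part. The truncation at k + 2 comes
-- from the words a w b with w of length at most k: each letter needs at most one token per place.

-- Finite sums and scalar products over ℕ

sum-mono : ∀ {n} {f g : Fin n → ℕ} → (∀ i → f i ≤ g i) → sum f ≤ sum g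
sum-mono {zero}  h = z≤n
sum-mono {suc n} h = +-mono-≤ (h zero) (sum-mono (h ∘ suc))

term≤sum : ∀ {n} (f : Fin n → ℕ) i → f i ≤ sum f
term≤sum f zero    = m≤m+n (f zero) _
term≤sum f (suc i) = ≤-trans (term≤sum (f ∘ suc) i) (m≤n+m _ (f zero))

sum≤const : ∀ {n} {f : Fin n → ℕ} {c} → (∀ i → f i ≤ c) → sum f ≤ n * c
sum≤const {zero}  h = z≤n
sum≤const {suc n} h = +-mono-≤ (h zero) (sum≤const (h ∘ suc))

sum-zero : ∀ {n} {f : Fin n → ℕ} → (∀ i → f i ≡ 0) → sum f ≡ 0
sum-zero {zero}  h = refl
sum-zero {suc n} h = cong₂ _+_ (h zero) (sum-zero (h ∘ suc))

sum-pos : ∀ {n} (f : Fin n → ℕ) → 0 < sum f → ∃ λ i → 0 < f i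
sum-pos {suc n} f h with f zero in eq
... | suc m = zero , subst (0 <_) (sym eq) z<s
... | zero  = map suc id (sum-pos (f ∘ suc) h)

sum-one : ∀ {n} (f : Fin n → ℕ) → sum f ≡ 1 → ∃ λ i → f i ≡ 1
sum-one f h with sum-pos f (subst (0 <_) (sym h) z<s)
... | i , p = i , ≤-antisym (subst (f i ≤_) h (term≤sum f i)) p

δ : ∀ {n} → Fin n → Fin n → ℕ
δ zero    zero    = 1
δ zero    (suc _) = 0
δ (suc _) zero    = 0
δ (suc i) (suc j) = δ i j

δ-refl : ∀ {n} (i : Fin n) → δ i i ≡ 1
δ-refl zero    = refl
δ-refl (suc i) = δ-refl i

δ-≢ : ∀ {n} {i j : Fin n} → i ≢ j → δ i j ≡ 0
δ-≢ {i = zero}  {zero}  h = ⊥-elim (h refl)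
δ-≢ {i = zero}  {suc j} h = refl
δ-≢ {i = suc i} {zero}  h = refl
δ-≢ {i = suc i} {suc j} h = δ-≢ (h ∘ cong suc)

δ≤1 : ∀ {n} (i j : Fin n) → δ i j ≤ 1
δ≤1 zero    zero    = s≤s z≤n
δ≤1 zero    (suc _) = z≤n
δ≤1 (suc _) zero    = z≤n
δ≤1 (suc i) (suc j) = δ≤1 i j

sum-δ : ∀ {n} (i : Fin n) (f : Fin n → ℕ) → sum (λ j → δ i j * f j) ≡ f i
sum-δ zero f =
  trans (cong₂ _+_ (+-identityʳ (f zero)) (sum-zero {f = λ j → 0 * f (suc j)} (λ _ → refl)))
        (+-identityʳ (f zero))
sum-δ (suc i) f = sum-δ i (f ∘ suc)

dot : ∀ {n} → (Fin n → ℕ) → (Fin n → ℕ) → ℕ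
dot c w = sum (λ i → c i * w i)

dot-cong : ∀ {n} {c c′ : Fin n → ℕ} (w : Fin n → ℕ) → (∀ i → c i ≡ c′ i) → dot c w ≡ dot c′ w
dot-cong w h = sum-cong-≗ (λ i → cong (_* w i) (h i))

dot-+ : ∀ {n} (c c′ w : Fin n → ℕ) → dot (λ i → c i + c′ i) w ≡ dot c w + dot c′ w
dot-+ c c′ w =
  trans (sum-cong-≗ (λ i → *-distribʳ-+ (w i) (c i) (c′ i)))
        (∑-distrib-+ (λ i → c i * w i) (λ i → c′ i * w i))

dot-+ʳ : ∀ {n} (c w w′ : Fin n → ℕ) → dot c (λ i → w i + w′ i) ≡ dot c w + dot c w′
dot-+ʳ c w w′ =
  trans (sum-cong-≗ (λ i → *-distribˡ-+ (c i) (w i) (w′ i)))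
        (∑-distrib-+ (λ i → c i * w i) (λ i → c i * w′ i))

dot-* : ∀ {n} a (c w : Fin n → ℕ) → dot (λ i → a * c i) w ≡ a * dot c w
dot-* a c w =
  trans (sum-cong-≗ (λ i → *-assoc a (c i) (w i))) (sym (*-distribˡ-sum a (λ i → c i * w i)))

dot-δ : ∀ {n} (i : Fin n) (w : Fin n → ℕ) → dot (δ i) w ≡ w i
dot-δ = sum-δ

dot-assoc : ∀ {m n} (c : Fin m → ℕ) (Λ : Fin m → Fin n → ℕ) (w : Fin n → ℕ) →
            dot (λ k → sum (λ j → c j * Λ j k)) w ≡ sum (λ j → c j * dot (Λ j) w)
dot-assoc c Λ w = begin
  sum (λ k → sum (λ j → c j * Λ j k) * w k)
    ≡⟨ sum-cong-≗ (λ k → *-distribʳ-sum (w k) (λ j → c j * Λ j k)) ⟩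
  sum (λ k → sum (λ j → c j * Λ j k * w k))
    ≡⟨ ∑-comm (λ k j → c j * Λ j k * w k) ⟩
  sum (λ j → sum (λ k → c j * Λ j k * w k))
    ≡⟨ sum-cong-≗ (λ j → trans (sum-cong-≗ (λ k → *-assoc (c j) (Λ j k) (w k)))
                               (sym (*-distribˡ-sum (c j) (λ k → Λ j k * w k)))) ⟩
  sum (λ j → c j * dot (Λ j) w) ∎
  where open ≡-Reasoning

sum-term : ∀ {n} {c : Fin n → ℕ} {a} i → a ≤ c i → ∀ j → a * δ i j ≤ c j
sum-term {c = c} {a} i h j with i ≟ j
... | yes refl = subst (_≤ c i) (sym (trans (cong (a *_) (δ-refl i)) (*-identityʳ a))) h
... | no i≢j   = subst (_≤ c j) (sym (trans (cong (a *_) (δ-≢ i≢j)) (*-zeroʳ a))) z≤n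

-- Solutions of a single linear equation

+∸-swap : ∀ m n → m + (n ∸ m) ≡ n + (m ∸ n)
+∸-swap zero    zero    = refl
+∸-swap zero    (suc n) = cong suc (sym (+-identityʳ n))
+∸-swap (suc m) zero    = cong suc (+-identityʳ m)
+∸-swap (suc m) (suc n) = cong suc (+∸-swap m n)

∸-pos⇒≤ : ∀ m n → 0 < m ∸ n → n ≤ m
∸-pos⇒≤ m       zero    h = z≤n
∸-pos⇒≤ (suc m) (suc n) h = s≤s (∸-pos⇒≤ m n h)

∸-disjoint : ∀ m n → 0 < m ∸ n → n ∸ m ≡ 0
∸-disjoint (suc m) zero    _ = refl
∸-disjoint (suc m) (suc n) h = ∸-disjoint m n h

-- The solutions c of c·p = c·q are generated by those with entries at most bound: if c i > bound
-- with p i > q i, then some j with q j > p j also has a large entry, and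
-- (q j ∸ p j) δᵢ + (p i ∸ q i) δⱼ can be split off.
module SingleEquation {r : ℕ} where

  Balanced : (p q : Fin r → ℕ) → (Fin r → ℕ) → Set
  Balanced p q c = dot c p ≡ dot c q

  -- The summand `weight p q` keeps both entries of a split-off pair small; the summand with the
  -- squared weight is what an entry must exceed to force a `partner`.
  weight bound : (p q : Fin r → ℕ) → ℕ
  weight p q = sum p + sum q
  bound p q = suc (weight p q + r * (weight p q * weight p q))

  Small : (p q : Fin r → ℕ) → (Fin r → ℕ) → Set
  Small p q c = ∀ k → c k ≤ bound p q

  Split : (p q : Fin r → ℕ) → (Fin r → ℕ) → Set
  Split p q c = Σ (Fin r → ℕ) λ c₁ → Σ (Fin r → ℕ) λ c₂ →
    (∀ k → c k ≡ c₁ k + c₂ k) × Balanced p q c₁ × Balanced p q c₂ × Small p q c₁ × 0 < sum c₁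

  split-off : ∀ p q c (c₁ : Fin r → ℕ) → Balanced p q c → (∀ k → c₁ k ≤ c k) →
              Balanced p q c₁ → Small p q c₁ → 0 < sum c₁ → Split p q c
  split-off p q c c₁ bal le bal₁ small pos = c₁ , c₂ , eq , bal₁ , bal₂ , small , pos
    where
    c₂ : Fin r → ℕ
    c₂ k = c k ∸ c₁ k
    eq : ∀ k → c k ≡ c₁ k + c₂ k
    eq k = sym (m+[n∸m]≡n (le k))
    bal₂ : Balanced p q c₂
    bal₂ = +-cancelˡ-≡ (dot c₁ p) (dot c₂ p) (dot c₂ q) (begin
      dot c₁ p + dot c₂ p         ≡⟨ dot-+ c₁ c₂ p ⟨
      dot (λ k → c₁ k + c₂ k) p   ≡⟨ dot-cong p eq ⟨
      dot c p                     ≡⟨ bal ⟩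
      dot c q                     ≡⟨ dot-cong q eq ⟩
      dot (λ k → c₁ k + c₂ k) q   ≡⟨ dot-+ c₁ c₂ q ⟩
      dot c₁ q + dot c₂ q         ≡⟨ cong (_+ dot c₂ q) bal₁ ⟨
      dot c₁ p + dot c₂ q         ∎)
      where open ≡-Reasoning

  reduced : ∀ p q c → Balanced p q c → dot c (λ k → p k ∸ q k) ≡ dot c (λ k → q k ∸ p k)
  reduced p q c bal = +-cancelˡ-≡ (dot c q) _ _ (begin
    dot c q + dot c (λ k → p k ∸ q k)   ≡⟨ dot-+ʳ c q _ ⟨
    dot c (λ k → q k + (p k ∸ q k))     ≡⟨ sum-cong-≗ (λ k → cong (c k *_) (+∸-swap (q k) (p k))) ⟩
    dot c (λ k → p k + (q k ∸ p k))     ≡⟨ dot-+ʳ c p _ ⟩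
    dot c p + dot c (λ k → q k ∸ p k)   ≡⟨ cong (_+ dot c (λ k → q k ∸ p k)) bal ⟩
    dot c q + dot c (λ k → q k ∸ p k)   ∎)
    where open ≡-Reasoning

  -- By `reduced`, the surplus at `i` is compensated by deficits elsewhere. If `c` were below
  -- `weight` at every coordinate with a deficit, these would add up to at most
  -- `r * (weight * weight)`, which is less than `c i`.
  partner : ∀ p q c i → Balanced p q c → bound p q < c i → 0 < p i ∸ q i →
            ∃ λ j → 0 < q j ∸ p j × weight p q ≤ c j
  partner p q c i bal big pos
    with any? (λ j → (0 <? (q j ∸ p j)) ×-dec (weight p q ≤? c j))
  ... | yes found = found
  ... | no none   = ⊥-elim (<-irrefl refl (begin-strict
    bound p q                     <⟨ big ⟩
    c i                           ≤⟨ m≤m*n (c i) (p i ∸ q i) {{>-nonZero pos}} ⟩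
    c i * (p i ∸ q i)             ≤⟨ term≤sum (λ k → c k * (p k ∸ q k)) i ⟩
    dot c (λ k → p k ∸ q k)       ≡⟨ reduced p q c bal ⟩
    dot c (λ k → q k ∸ p k)       ≤⟨ sum≤const small-terms ⟩
    r * (W * W)                   ≤⟨ m≤n⇒m≤1+n (m≤n+m _ W) ⟩
    bound p q                     ∎))
    where
    open ≤-Reasoning
    W = weight p q
    small-terms : ∀ k → c k * (q k ∸ p k) ≤ W * W
    small-terms k with 0 <? (q k ∸ p k)
    ... | no h = subst (_≤ W * W) (sym (trans (cong (c k *_) (n≤0⇒n≡0 (≮⇒≥ h))) (*-zeroʳ (c k)))) z≤n
    ... | yes h with W ≤? c k
    ...   | yes h′ = ⊥-elim (none (k , h , h′))
    ...   | no h′  = *-mono-≤ (<⇒≤ (≰⇒> h′))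
                       (≤-trans (m∸n≤m (q k) (p k)) (≤-trans (term≤sum q k) (m≤n+m _ (sum p))))

  exchange : ∀ p q qⱼ pᵢ P Q → p + Q ≡ qⱼ → pᵢ ≡ q + P → Q * pᵢ + P * p ≡ Q * q + P * qⱼ
  exchange p q _ _ P Q refl refl = lemma p q P Q
    where
    lemma : ∀ p q P Q → Q * (q + P) + P * p ≡ Q * q + P * (p + Q)
    lemma = solve-∀

  split-pair : ∀ p q c i → Balanced p q c → bound p q < c i → 0 < p i ∸ q i → Split p q c
  split-pair p q c i bal big pos with partner p q c i bal big pos
  ... | j , posⱼ , bigⱼ = split-off p q c c₁ bal le bal₁ small
                            (<-≤-trans c₁ᵢ>0 (term≤sum c₁ i))
    where
    W = weight p q
    P = p i ∸ q i
    Q = q j ∸ p j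
    i≢j : i ≢ j
    i≢j refl = <-irrefl (sym (∸-disjoint (p i) (q i) pos)) posⱼ
    c₁ : Fin r → ℕ
    c₁ k = Q * δ i k + P * δ j k
    P≤W : P ≤ W
    P≤W = ≤-trans (m∸n≤m (p i) (q i)) (≤-trans (term≤sum p i) (m≤m+n _ (sum q)))
    Q≤W : Q ≤ W
    Q≤W = ≤-trans (m∸n≤m (q j) (p j)) (≤-trans (term≤sum q j) (m≤n+m _ (sum p)))
    W≤bound : W ≤ bound p q
    W≤bound = m≤n⇒m≤1+n (m≤m+n W _)
    W≤cᵢ : W ≤ c i
    W≤cᵢ = ≤-trans W≤bound (<⇒≤ big)
    below : ∀ (b : Fin r → ℕ) → W ≤ b i → W ≤ b j → ∀ k → c₁ k ≤ b k
    below b hᵢ hⱼ k with i ≟ k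
    ... | yes refl = subst (_≤ b i) (sym (trans (cong (λ z → Q * δ i i + P * z) (δ-≢ (i≢j ∘ sym)))
                       (trans (cong₂ _+_ (trans (cong (Q *_) (δ-refl i)) (*-identityʳ Q)) (*-zeroʳ P))
                              (+-identityʳ Q)))) (≤-trans Q≤W hᵢ)
    ... | no i≢k   = subst (_≤ b k) (sym (cong (_+ P * δ j k) (trans (cong (Q *_) (δ-≢ i≢k)) (*-zeroʳ Q))))
                       (sum-term {c = b} j (≤-trans P≤W hⱼ) k)
    le = below c W≤cᵢ bigⱼ
    small : Small p q c₁
    small = below (λ _ → bound p q) W≤bound W≤bound
    c₁ᵢ>0 : 0 < c₁ i
    c₁ᵢ>0 = ≤-trans (subst (0 <_) (sym (trans (cong (Q *_) (δ-refl i)) (*-identityʳ Q))) posⱼ)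
                    (m≤m+n _ _)
    dot-c₁ : ∀ w → dot c₁ w ≡ Q * w i + P * w j
    dot-c₁ w = trans (dot-+ (λ k → Q * δ i k) (λ k → P * δ j k) w)
      (cong₂ _+_ (trans (dot-* Q (δ i) w) (cong (Q *_) (dot-δ i w)))
                 (trans (dot-* P (δ j) w) (cong (P *_) (dot-δ j w))))
    bal₁ : Balanced p q c₁
    bal₁ = trans (dot-c₁ p) (trans
      (exchange (p j) (q i) (q j) (p i) P Q
        (m+[n∸m]≡n (∸-pos⇒≤ (q j) (p j) posⱼ))
        (sym (m+[n∸m]≡n (∸-pos⇒≤ (p i) (q i) pos))))
      (sym (dot-c₁ q)))

  Split-swap : ∀ p q c → Split q p c → Split p q c
  Split-swap p q c (c₁ , c₂ , eq , b₁ , b₂ , sm , pos) =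
    c₁ , c₂ , eq , sym b₁ , sym b₂ , subst (λ W → ∀ k → c₁ k ≤ suc (W + r * (W * W))) (+-comm (sum q) (sum p)) sm , pos

  small-or-split : ∀ p q c → Balanced p q c → Small p q c ⊎ Split p q c
  small-or-split p q c bal with all? (λ k → c k ≤? bound p q)
  ... | yes h = inj₁ h
  ... | no h with any? (λ k → bound p q <? c k)
  ...   | no h′ = ⊥-elim (h (λ k → ≮⇒≥ (λ lt → h′ (k , lt))))
  ...   | yes (i , big) with 0 <? (p i ∸ q i)
  ...     | yes pos = inj₂ (split-pair p q c i bal big pos)
  ...     | no ¬pos with 0 <? (q i ∸ p i)
  ...       | yes pos = inj₂ (Split-swap p q c (split-pair q p c i (sym bal)
                          (subst (λ W → suc (W + r * (W * W)) < c i) (+-comm (sum p) (sum q)) big) pos))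
  -- Here `p i` equals `q i`, so the unit vector at `i` is balanced on its own.
  ...       | no ¬pos′ = inj₂ (split-off p q c (δ i) bal le bal₁ small (subst (0 <_) (sym sum-one-δ) z<s))
    where
    p≡q : p i ≡ q i
    p≡q = ≤-antisym (m∸n≡0⇒m≤n (n≤0⇒n≡0 (≮⇒≥ ¬pos))) (m∸n≡0⇒m≤n (n≤0⇒n≡0 (≮⇒≥ ¬pos′)))
    le : ∀ k → δ i k ≤ c k
    le k = subst (_≤ c k) (*-identityˡ (δ i k)) (sum-term {c = c} i (≤-trans (s≤s z≤n) big) k)
    bal₁ : Balanced p q (δ i)
    bal₁ = trans (dot-δ i p) (trans p≡q (sym (dot-δ i q)))
    sum-one-δ : sum (δ i) ≡ 1
    sum-one-δ = trans (sum-cong-≗ (λ k → sym (*-identityʳ (δ i k)))) (sum-δ i (λ _ → 1))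
    small : Small p q (δ i)
    small k = ≤-trans (δ≤1 i k) (s≤s z≤n)

  count : (p q : Fin r → ℕ) → ℕ
  count p q = suc (bound p q) ^ r

  entries : (p q : Fin r → ℕ) → Fin (count p q) → Fin r → ℕ
  entries p q j k = toℕ (finToFun {n = r} j k)

  -- Indexing by all vectors with entries at most `bound` and sending the unbalanced ones to the
  -- zero solution gives a family over `Fin` without any filtering.
  generator : (p q : Fin r → ℕ) → Fin (count p q) → Fin r → ℕ
  generator p q j with dot (entries p q j) p ≟ℕ dot (entries p q j) q
  ... | yes _ = entries p q j
  ... | no _  = λ _ → 0

  generator-balanced : ∀ p q j → Balanced p q (generator p q j)
  generator-balanced p q j with dot (entries p q j) p ≟ℕ dot (entries p q j) q
  ... | yes h = h
  ... | no _  = trans (sum-zero {f = λ k → 0 * p k} (λ _ → refl)) (sym (sum-zero {f = λ k → 0 * q k} (λ _ → refl)))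

  small-is-generator : ∀ p q c → Balanced p q c → Small p q c → ∃ λ j → ∀ k → c k ≡ generator p q j k
  small-is-generator p q c bal small = j , gen
    where
    j = funToFin (λ k → fromℕ< (s≤s (small k)))
    same : ∀ k → entries p q j k ≡ c k
    same k = trans (cong toℕ (finToFun-funToFin (λ k → fromℕ< (s≤s (small k))) k)) (toℕ-fromℕ< _)
    gen : ∀ k → c k ≡ generator p q j k
    gen with dot (entries p q j) p ≟ℕ dot (entries p q j) q
    ... | yes _ = λ k → sym (same k)
    ... | no h  = ⊥-elim (h (trans (dot-cong p same) (trans bal (sym (dot-cong q same)))))

  Combination : (p q : Fin r → ℕ) → (Fin r → ℕ) → Set
  Combination p q c = Σ (Fin (count p q) → ℕ) λ μ → ∀ k → c k ≡ sum (λ j → μ j * generator p q j k)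

  generated : ∀ p q n c → sum c ≡ n → Balanced p q c → Combination p q c
  generated p q = <-rec _ go
    where
    go : ∀ n → (∀ {m} → m < n → ∀ c → sum c ≡ m → Balanced p q c → Combination p q c) →
           ∀ c → sum c ≡ n → Balanced p q c → Combination p q c
    go n rec c refl bal with small-or-split p q c bal
    ... | inj₁ small = let j , gen = small-is-generator p q c bal small in
                       δ j , λ k → trans (gen k) (sym (sum-δ j (λ j′ → generator p q j′ k)))
    ... | inj₂ (c₁ , c₂ , eq , bal₁ , bal₂ , small , pos) = add
      where
      smaller : sum c₂ < sum c
      smaller = subst (sum c₂ <_) (sym (trans (sum-cong-≗ eq) (∑-distrib-+ c₁ c₂))) (m<n+m (sum c₂) pos)
      add : Combination p q c
      add with rec smaller c₂ refl bal₂ | small-is-generator p q c₁ bal₁ small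
      ... | μ , h | j , gen = (λ j′ → δ j j′ + μ j′) , λ k → trans (eq k) (trans
        (cong₂ _+_ (trans (gen k) (sym (sum-δ j (λ j′ → generator p q j′ k)))) (h k))
        (sym (dot-+ (δ j) μ (λ j′ → generator p q j′ k))))

-- Linear systems over ℕ

-- Coefficients lie in ℕ and constant terms are absent, so evaluation is additive in the assignment
-- and every solution set is a submonoid; negative terms go to the other side of an equation.
data Lin (U : Set) : Set where
  var  : U → Lin U
  _·_  : ℕ → U → Lin U
  _⊕_  : Lin U → Lin U → Lin U
  ∑    : ∀ {n} → (Fin n → Lin U) → Lin U

eval : ∀ {U} → Lin U → (U → ℕ) → ℕ
eval (var u)   x = x u
eval (a · u)   x = x u * a
eval (f ⊕ g)   x = eval f x + eval g x
eval (∑ f)     x = sum (λ i → eval (f i) x)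

data System (U : Set) : Set where
  _≐_  : Lin U → Lin U → System U
  _∧_  : System U → System U → System U
  ⋀    : ∀ {n} → (Fin n → System U) → System U

infix  5 _≐_
infixr 6 _⊕_
infixr 4 _∧_

⟦_⟧ : ∀ {U} → System U → (U → ℕ) → Set
⟦ f ≐ g ⟧ x = eval f x ≡ eval g x
⟦ s ∧ t ⟧ x = ⟦ s ⟧ x × ⟦ t ⟧ x
⟦ ⋀ s ⟧   x = ∀ i → ⟦ s i ⟧ x

eval-combination : ∀ {U r} (f : Lin U) (x : U → ℕ) (c : Fin r → ℕ) (G : Fin r → U → ℕ) →
                   (∀ u → x u ≡ sum (λ k → c k * G k u)) → eval f x ≡ dot c (λ k → eval f (G k))
eval-combination (var u) x c G h = h u
eval-combination (a · u) x c G h = trans (cong (_* a) (h u)) (trans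
  (*-distribʳ-sum a (λ k → c k * G k u)) (sum-cong-≗ (λ k → *-assoc (c k) (G k u) a)))
eval-combination (f ⊕ g) x c G h = trans
  (cong₂ _+_ (eval-combination f x c G h) (eval-combination g x c G h))
  (sym (dot-+ʳ c (λ k → eval f (G k)) (λ k → eval g (G k))))
eval-combination (∑ f) x c G h = trans
  (sum-cong-≗ (λ i → eval-combination (f i) x c G h))
  (trans (∑-comm (λ i k → c k * eval (f i) (G k)))
         (sum-cong-≗ (λ k → sym (*-distribˡ-sum (c k) (λ i → eval (f i) (G k))))))

eval-0 : ∀ {U} (f : Lin U) → eval f (λ _ → 0) ≡ 0
eval-0 (var u) = refl
eval-0 (a · u) = refl
eval-0 (f ⊕ g) = cong₂ _+_ (eval-0 f) (eval-0 g)
eval-0 (∑ f)   = sum-zero (λ i → eval-0 (f i))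

solution-0 : ∀ {U} (s : System U) → ⟦ s ⟧ (λ _ → 0)
solution-0 (f ≐ g) = trans (eval-0 f) (sym (eval-0 g))
solution-0 (s ∧ t) = solution-0 s , solution-0 t
solution-0 (⋀ s)   = λ i → solution-0 (s i)

record FinitelyGenerated {U : Set} (P : (U → ℕ) → Set) : Set where
  field
    rank     : ℕ
    gen      : Fin rank → U → ℕ
    sound    : ∀ k → P (gen k)
    complete : ∀ x → P x → Σ (Fin rank → ℕ) λ c → ∀ u → x u ≡ sum (λ k → c k * gen k u)

record Finite (U : Set) : Set where
  field
    size    : ℕ
    enc     : U → Fin size
    dec     : Fin size → U
    dec-enc : ∀ u → dec (enc u) ≡ u

all-vectors-fg : ∀ {U} → Finite U → FinitelyGenerated {U} (λ _ → ⊤)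
all-vectors-fg F = record
  { rank     = size
  ; gen      = λ k u → δ (enc u) k
  ; sound    = λ _ → tt
  ; complete = λ x _ → (λ k → x (dec k)) , λ u → sym (trans
      (sum-cong-≗ (λ k → *-comm (x (dec k)) (δ (enc u) k)))
      (trans (sum-δ (enc u) (λ k → x (dec k))) (cong x (dec-enc u))))
  }
  where open Finite F

-- Inserting a combination of the generators `gen` turns the equation into a single balance equation
-- for the coefficients. Its generators, applied to `gen`, generate the new set, and `closed` keeps
-- them inside `P`.
equation-fg : ∀ {U} {P : (U → ℕ) → Set} (f g : Lin U) →
              (∀ {r} (c : Fin r → ℕ) (G : Fin r → U → ℕ) → (∀ k → P (G k)) → P (λ u → sum (λ k → c k * G k u))) →
              FinitelyGenerated P → FinitelyGenerated (λ x → P x × eval f x ≡ eval g x)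
equation-fg {U} {P} f g closed F = record
  { rank     = count p q
  ; gen      = gen′
  ; sound    = λ j → closed (generator p q j) gen sound ,
      trans (eval-combination f (gen′ j) (generator p q j) gen (λ _ → refl)) (trans (generator-balanced p q j)
        (sym (eval-combination g (gen′ j) (generator p q j) gen (λ _ → refl))))
  ; complete = complete′
  }
  where
  open FinitelyGenerated F
  open SingleEquation
  p q : Fin rank → ℕ
  p k = eval f (gen k)
  q k = eval g (gen k)
  gen′ : Fin (count p q) → U → ℕ
  gen′ j u = sum (λ k → generator p q j k * gen k u)
  complete′ : ∀ x → P x × eval f x ≡ eval g x →
              Σ (Fin (count p q) → ℕ) λ μ → ∀ u → x u ≡ sum (λ j → μ j * gen′ j u)
  complete′ x (hx , eq) with complete x hx
  ... | c , hc with generated p q (sum c) c refl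
                      (trans (sym (eval-combination f x c gen hc)) (trans eq (eval-combination g x c gen hc)))
  ...   | μ , hμ = μ , λ u → trans (hc u) (trans (dot-cong (λ k → gen k u) hμ)
                     (dot-assoc μ (generator p q) (λ k → gen k u)))

solution-combination : ∀ {U r} (s : System U) (c : Fin r → ℕ) (G : Fin r → U → ℕ) → (∀ k → ⟦ s ⟧ (G k)) →
                       ⟦ s ⟧ (λ u → sum (λ k → c k * G k u))
solution-combination (f ≐ g) c G h = trans (eval-combination f _ c G (λ _ → refl)) (trans
  (sum-cong-≗ (λ k → cong (c k *_) (h k))) (sym (eval-combination g _ c G (λ _ → refl))))
solution-combination (s ∧ t) c G h = solution-combination s c G (proj₁ ∘ h) , solution-combination t c G (proj₂ ∘ h)
solution-combination (⋀ s)   c G h = λ i → solution-combination (s i) c G (λ k → h k i)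

FG-map : ∀ {U} {P Q : (U → ℕ) → Set} → (∀ x → P x → Q x) → (∀ x → Q x → P x) →
         FinitelyGenerated P → FinitelyGenerated Q
FG-map to from F = record
  { rank = rank ; gen = gen ; sound = λ k → to _ (sound k) ; complete = λ x hx → complete x (from x hx) }
  where open FinitelyGenerated F

Closed : ∀ {U} → ((U → ℕ) → Set) → Set
Closed {U} P = ∀ {r} (c : Fin r → ℕ) (G : Fin r → U → ℕ) → (∀ k → P (G k)) → P (λ u → sum (λ k → c k * G k u))

-- Relative to an arbitrary closed and finitely generated `P`, so that the equations of a
-- conjunction can be imposed one after another.
Solver : ∀ {U} → System U → Set₁
Solver {U} s = ∀ {P : (U → ℕ) → Set} → Closed P → FinitelyGenerated P → FinitelyGenerated (λ x → P x × ⟦ s ⟧ x)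

solve-⋀ : ∀ {U n} (s : Fin n → System U) → (∀ i → Solver (s i)) → Solver (⋀ s)
solve-⋀ {n = zero} s solvers closed F = FG-map (λ x p → p , λ ()) (λ x → proj₁) F
solve-⋀ {n = suc n} s solvers closed F =
  FG-map (λ { x ((p , a) , b) → p , λ { zero → a ; (suc i) → b i } })
         (λ { x (p , a) → (p , a zero) , a ∘ suc })
    (solve-⋀ (s ∘ suc) (λ i → solvers (suc i))
      (λ c G h → closed c G (proj₁ ∘ h) , solution-combination (s zero) c G (proj₂ ∘ h))
      (solvers zero closed F))

solve : ∀ {U} (s : System U) → Solver s
solve (f ≐ g) closed F = equation-fg f g closed F
solve (s ∧ t) closed F =
  FG-map (λ { x ((p , a) , b) → p , a , b }) (λ { x (p , a , b) → (p , a) , b })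
    (solve t (λ c G h → closed c G (proj₁ ∘ h) , solution-combination s c G (proj₂ ∘ h)) (solve s closed F))
solve (⋀ s) = solve-⋀ s (λ i → solve (s i))

solutions-fg : ∀ {U} → Finite U → (s : System U) → FinitelyGenerated ⟦ s ⟧
solutions-fg F s = FG-map (λ _ → proj₂) (λ _ h → tt , h) (solve s (λ _ _ _ → tt) (all-vectors-fg F))

-- The constant terms of s are carried by the variable u₀, which has the value 1 in the intended solutions.
module Homogenised {U : Set} (F : Finite U) (s : System U) (u₀ : U) where
  open FinitelyGenerated (solutions-fg F s)

  Inhomogeneous Homogeneous : (U → ℕ) → Set
  Inhomogeneous x = ⟦ s ⟧ x × x u₀ ≡ 1
  Homogeneous x = ⟦ s ⟧ x × x u₀ ≡ 0

  -- A sum in ℕ equal to 1 has a term equal to 1, and then both factors of this term are 1. So if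
  -- there is an inhomogeneous solution, some generator is one.
  solvable? : Dec (∃ Inhomogeneous)
  solvable? with any? (λ k → gen k u₀ ≟ℕ 1)
  ... | yes (k , h) = yes (gen k , sound k , h)
  ... | no none = no λ { (x , hx , one) → let c , eq = complete x hx in
          case sum-one (λ k → c k * gen k u₀) (trans (sym (eq u₀)) one) of λ
            { (k , h) → none (k , m*n≡1⇒n≡1 (c k) (gen k u₀) h) } }

  -- In a combination with value 1 at `u₀`, the coefficients of the generators that are positive at
  -- `u₀` add up to at most 1. If no other generator is positive at `u`, only these contribute to
  -- `x u`, and the sum of all generators at `u` is a bound.
  unbounded-or-bounded : ∀ u → (∃ λ h → Homogeneous h × 0 < h u) ⊎
                               (∃ λ B → ∀ x → Inhomogeneous x → x u ≤ B)
  unbounded-or-bounded u with any? (λ k → (gen k u₀ ≟ℕ 0) ×-dec (0 <? gen k u))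
  ... | yes (k , z , pos) = inj₁ (gen k , (sound k , z) , pos)
  ... | no none = inj₂ (B , bounded)
    where
    open ≤-Reasoning
    B = sum (λ k → gen k u)
    bounded : ∀ x → Inhomogeneous x → x u ≤ B
    bounded x (hx , one) with complete x hx
    ... | c , eq = begin
      x u                                  ≡⟨ eq u ⟩
      sum (λ k → c k * gen k u)            ≤⟨ sum-mono term ⟩
      sum (λ k → c k * gen k u₀ * B)       ≡⟨ *-distribʳ-sum B (λ k → c k * gen k u₀) ⟨
      sum (λ k → c k * gen k u₀) * B       ≡⟨ cong (_* B) (trans (sym (eq u₀)) one) ⟩
      1 * B                                ≡⟨ *-identityˡ B ⟩
      B                                    ∎
      where
      term : ∀ k → c k * gen k u ≤ c k * gen k u₀ * B
      term k with gen k u₀ ≟ℕ 0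
      ... | yes z = subst (_≤ c k * gen k u₀ * B)
                      (sym (trans (cong (c k *_) (n≤0⇒n≡0 (≮⇒≥ (λ pos → none (k , z , pos))))) (*-zeroʳ (c k)))) z≤n
      ... | no nz = subst (c k * gen k u ≤_) (sym (*-assoc (c k) (gen k u₀) B)) (*-monoʳ-≤ (c k)
                      (≤-trans (term≤sum (λ k → gen k u) k) (m≤n*m B (gen k u₀) {{≢-nonZero nz}})))

  Bounded : U → Set
  Bounded u = ∃ λ B → ∀ x → Inhomogeneous x → x u ≤ B

  -- Adding up one witness per variable gives a single homogeneous solution for all unbounded
  -- variables at once, as pumping a whole chain requires.
  pos-or-bounded : ∃ λ H → Homogeneous H × (∀ u → 0 < H u ⊎ Bounded u)
  pos-or-bounded = H , (solution-combination s (λ _ → 1) h (λ k → proj₁ (hom k)) ,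
      sum-zero (λ k → cong (1 *_) (proj₂ (hom k)))) , positive
    where
    open Finite F
    candidate : ∀ u → ∃ λ h → Homogeneous h × (0 < h u ⊎ Bounded u)
    candidate u with unbounded-or-bounded u
    ... | inj₁ (h , hom , pos) = h , hom , inj₁ pos
    ... | inj₂ bounded = (λ _ → 0) , (solution-0 s , refl) , inj₂ bounded
    h : Fin size → U → ℕ
    h k = proj₁ (candidate (dec k))
    hom : ∀ k → Homogeneous (h k)
    hom k = proj₁ (proj₂ (candidate (dec k)))
    H : U → ℕ
    H u = sum (λ k → 1 * h k u)
    positive : ∀ u → 0 < H u ⊎ Bounded u
    positive u = Sum.map₁ below (proj₂ (proj₂ (candidate u)))
      where
      below : 0 < proj₁ (candidate u) u → 0 < H u
      below pos = <-≤-trans (subst (λ v → 0 < 1 * proj₁ (candidate v) u) (sym (dec-enc u))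
        (subst (0 <_) (sym (*-identityˡ _)) pos)) (term≤sum (λ k → 1 * h k u) (enc u))

variable
  d n : ℕ

-- Runs and Eulerian walks

-- A list, because each coordinate that becomes rigid is put in front of the former state; the type
-- of states then survives every splitting.
State : Set
State = List ℕ

_≟ₛ_ : (a b : State) → Dec (a ≡ b)
_≟ₛ_ = ≡-dec _≟ℕ_

ind : ∀ {A : Set} → Dec A → ℕ
ind (yes _) = 1
ind (no _)  = 0

ind-yes : ∀ {A : Set} (a? : Dec A) → A → ind a? ≡ 1
ind-yes (yes _) _ = refl
ind-yes (no h)  a = ⊥-elim (h a)

ind-no : ∀ {A : Set} (a? : Dec A) → ¬ A → ind a? ≡ 0
ind-no (yes a) h = ⊥-elim (h a)
ind-no (no _)  _ = refl

cnt : List (Fin n) → Fin n → ℕ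
cnt []      k = 0
cnt (e ∷ π) k = δ e k + cnt π k

cnt-++ : (π ρ : List (Fin n)) → ∀ k → cnt (π ++ ρ) k ≡ cnt π k + cnt ρ k
cnt-++ []      ρ k = refl
cnt-++ (e ∷ π) ρ k = trans (cong (δ e k +_) (cnt-++ π ρ k)) (sym (+-assoc (δ e k) _ _))

dot-cnt-∷ : (e : Fin n) (π : List (Fin n)) (w : Fin n → ℕ) → dot (cnt (e ∷ π)) w ≡ w e + dot (cnt π) w
dot-cnt-∷ e π w = trans (dot-+ (δ e) (cnt π) w) (cong (_+ dot (cnt π) w) (dot-δ e w))

dot-cnt-≤ : (π : List (Fin n)) {w : Fin n → ℕ} {c : ℕ} → (∀ e → w e ≤ c) → dot (cnt π) w ≤ length π * c
dot-cnt-≤ []      {w} h = ≤-reflexive (sum-zero {f = λ k → 0 * w k} (λ _ → refl))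
dot-cnt-≤ (e ∷ π) {w} {c} h = subst (_≤ c + length π * c) (sym (dot-cnt-∷ e π w)) (+-mono-≤ (h e) (dot-cnt-≤ π h))

-- The witness `z` counts the untouched tokens. This form is symmetric, so exchanging `p` and `q`
-- reverses a firing.
Fire : ℕ → ℕ → ℕ → ℕ → Set
Fire p q x y = ∃ λ z → x ≡ z + p × y ≡ z + q

Run : (p q : Fin n → ℕ) → List (Fin n) → ℕ → ℕ → Set
Run p q []      x y = x ≡ y
Run p q (e ∷ π) x y = ∃ λ x′ → Fire (p e) (q e) x x′ × Run p q π x′ y

module _ {p q : Fin n → ℕ} where

  run-++ : ∀ π {ρ x y z} → Run p q π x y → Run p q ρ y z → Run p q (π ++ ρ) x z
  run-++ []      refl        s = s
  run-++ (e ∷ π) (x′ , f , r) s = x′ , f , run-++ π r s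

  run-shift : ∀ π {x y} c → Run p q π x y → Run p q π (c + x) (c + y)
  run-shift []      c refl = refl
  run-shift (e ∷ π) c (x′ , (z , refl , refl) , r) =
    c + x′ , (c + z , sym (+-assoc c z (p e)) , sym (+-assoc c z (q e))) , run-shift π c r

  run-total : ∀ π {x y} → Run p q π x y → y + dot (cnt π) p ≡ x + dot (cnt π) q
  run-total [] {x} refl = cong (x +_) (trans (sum-zero {f = λ k → 0 * p k} (λ _ → refl))
                                            (sym (sum-zero {f = λ k → 0 * q k} (λ _ → refl))))
  run-total (e ∷ π) {y = y} (x′ , (z , refl , refl) , r) = begin
    y + dot (cnt (e ∷ π)) p              ≡⟨ cong (y +_) (dot-cnt-∷ e π p) ⟩
    y + (p e + dot (cnt π) p)            ≡⟨ swap y (p e) _ ⟩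
    (y + dot (cnt π) p) + p e            ≡⟨ cong (_+ p e) (run-total π r) ⟩
    (z + q e + dot (cnt π) q) + p e      ≡⟨ swap′ z (q e) _ (p e) ⟩
    z + p e + (q e + dot (cnt π) q)      ≡⟨ cong (z + p e +_) (dot-cnt-∷ e π q) ⟨
    z + p e + dot (cnt (e ∷ π)) q        ∎
    where
    open ≡-Reasoning
    swap : ∀ a b c → a + (b + c) ≡ (a + c) + b
    swap = solve-∀
    swap′ : ∀ a b c d → (a + b + c) + d ≡ a + d + (b + c)
    swap′ = solve-∀

  run-enough : ∀ π {x} → dot (cnt π) p ≤ x → ∃ λ y → Run p q π x y
  run-enough []      h = _ , refl
  run-enough (e ∷ π) {x} h with ≤-trans (≤-reflexive (sym (dot-cnt-∷ e π p))) h
  ... | h′ = let y , r = run-enough π {x ∸ p e + q e} (≤-trans (m+n≤o⇒m≤o∸n _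
                           (subst (_≤ x) (+-comm (p e) _) h′)) (m≤m+n _ (q e)))
             in y , x ∸ p e + q e , (x ∸ p e , sym (m∸n+n≡m (≤-trans (m≤m+n (p e) _) h′)) , refl) , r

  run-enough-to : ∀ π {x y} → dot (cnt π) p ≤ x → y + dot (cnt π) p ≡ x + dot (cnt π) q → Run p q π x y
  run-enough-to π {x} {y} h eq with run-enough π h
  ... | y′ , r = subst (Run p q π x) (+-cancelʳ-≡ (dot (cnt π) p) y′ y (trans (run-total π r) (sym eq))) r

  run-det : ∀ π {x y y′} → Run p q π x y → Run p q π x y′ → y ≡ y′
  run-det π r r′ = +-cancelʳ-≡ (dot (cnt π) p) _ _ (trans (run-total π r) (sym (run-total π r′)))

  run? : ∀ π x → Dec (∃ λ y → Run p q π x y)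
  run? []      x = yes (x , refl)
  run? (e ∷ π) x with p e ≤? x
  ... | no h  = no λ { (y , _ , (z , refl , _) , _) → h (m≤n+m (p e) z) }
  ... | yes h with run? π (x ∸ p e + q e)
  ...   | yes (y , r) = yes (y , x ∸ p e + q e , (x ∸ p e , sym (m∸n+n≡m h) , refl) , r)
  ...   | no h′ = no λ { (y , _ , (z , refl , refl) , r) →
                    h′ (y , subst (λ w → Run p q π (w + q e) y) (sym (m+n∸n≡m z (p e))) r) }

run-reverse : ∀ {p q : Fin n → ℕ} π {x y} → Run p q π x y → Run q p (reverse π) y x
run-reverse []      refl = refl
run-reverse {p = p} {q} (e ∷ π) {x} {y} (x′ , (z , f , g) , r) =
  subst (λ w → Run q p w y x) (sym (unfold-reverse e π))
    (run-++ (reverse π) (run-reverse π r) (x , (z , g , f) , refl))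

module _ (s t : Fin n → State) where

  Path : State → List (Fin n) → State → Set
  Path a []      b = a ≡ b
  Path a (e ∷ π) b = s e ≡ a × Path (t e) π b

  Thru : List (Fin n) → State → State → Set
  Thru []      a q = a ≡ q
  Thru (e ∷ π) a q = a ≡ q ⊎ Thru π (t e) q

  out into : (Fin n → ℕ) → State → ℕ
  out  φ q = dot φ (λ e → ind (s e ≟ₛ q))
  into φ q = dot φ (λ e → ind (t e ≟ₛ q))

  BalancedAt : (Fin n → ℕ) → State → State → State → Set
  BalancedAt φ a b q = out φ q + ind (b ≟ₛ q) ≡ into φ q + ind (a ≟ₛ q)

  Circulation : (Fin n → ℕ) → Set
  Circulation φ = ∀ q → out φ q ≡ into φ q

module _ {s t : Fin n → State} where

  path-++ : ∀ π {ρ a b c} → Path s t a π b → Path s t b ρ c → Path s t a (π ++ ρ) c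
  path-++ []      refl    q = q
  path-++ (e ∷ π) (h , p) q = h , path-++ π p q

  thru-start : ∀ π {a} → Thru s t π a a
  thru-start []      = refl
  thru-start (e ∷ π) = inj₁ refl

  thru-++ˡ : ∀ π {ρ a q} → Thru s t π a q → Thru s t (π ++ ρ) a q
  thru-++ˡ []      {ρ} refl  = thru-start ρ
  thru-++ˡ (e ∷ π) (inj₁ h)  = inj₁ h
  thru-++ˡ (e ∷ π) (inj₂ h)  = inj₂ (thru-++ˡ π h)

  thru-++ʳ : ∀ π {ρ a b q} → Path s t a π b → Thru s t ρ b q → Thru s t (π ++ ρ) a q
  thru-++ʳ []      refl    h = h
  thru-++ʳ (e ∷ π) (_ , p) h = inj₂ (thru-++ʳ π p h)

  -- The last clause keeps every visited state visited, so that further cycles can be spliced in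
  -- later.
  insert : ∀ π {a b q} c → Path s t a π b → Thru s t π a q → Path s t q c q →
           ∃ λ π′ → Path s t a π′ b × (∀ k → cnt π′ k ≡ cnt π k + cnt c k) ×
                    (∀ q′ → Thru s t π a q′ → Thru s t π′ a q′)
  insert-here : ∀ π {a b} c → Path s t a π b → Path s t a c a →
           ∃ λ π′ → Path s t a π′ b × (∀ k → cnt π′ k ≡ cnt π k + cnt c k) ×
                    (∀ q′ → Thru s t π a q′ → Thru s t π′ a q′)
  insert-here π c p cyc = c ++ π , path-++ c cyc p ,
    (λ k → trans (cnt-++ c π k) (+-comm (cnt c k) (cnt π k))) , λ _ → thru-++ʳ c cyc
  insert []      c p refl cyc = insert-here [] c p cyc
  insert (e ∷ π) c p (inj₁ refl) cyc = insert-here (e ∷ π) c p cyc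
  insert (e ∷ π) c (h , p) (inj₂ th) cyc =
    let π′ , p′ , eq , thr = insert π c p th cyc in
    e ∷ π′ , (h , p′) , (λ k → trans (cong (δ e k +_) (eq k)) (sym (+-assoc (δ e k) _ _))) ,
    λ { q′ (inj₁ x) → inj₁ x ; q′ (inj₂ x) → inj₂ (thr q′ x) }

  path-balanced : ∀ π {a b} → Path s t a π b → ∀ q → BalancedAt s t (cnt π) a b q
  path-balanced [] {a} refl q = cong (_+ ind (a ≟ₛ q)) (trans
    (sum-zero {f = λ k → 0 * ind (s k ≟ₛ q)} (λ _ → refl)) (sym (sum-zero {f = λ k → 0 * ind (t k ≟ₛ q)} (λ _ → refl))))
  path-balanced (e ∷ π) {a} {b} (refl , p) q = begin
    out s t (cnt (e ∷ π)) q + ind (b ≟ₛ q)                ≡⟨ cong (_+ ind (b ≟ₛ q)) (dot-cnt-∷ e π _) ⟩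
    ind (s e ≟ₛ q) + out s t (cnt π) q + ind (b ≟ₛ q)     ≡⟨ +-assoc (ind (s e ≟ₛ q)) _ _ ⟩
    ind (s e ≟ₛ q) + (out s t (cnt π) q + ind (b ≟ₛ q))   ≡⟨ cong (ind (s e ≟ₛ q) +_) (path-balanced π p q) ⟩
    ind (s e ≟ₛ q) + (into s t (cnt π) q + ind (t e ≟ₛ q)) ≡⟨ swap (ind (s e ≟ₛ q)) (into s t (cnt π) q) (ind (t e ≟ₛ q)) ⟩
    ind (t e ≟ₛ q) + into s t (cnt π) q + ind (s e ≟ₛ q)   ≡⟨ cong (_+ ind (s e ≟ₛ q)) (dot-cnt-∷ e π _) ⟨
    into s t (cnt (e ∷ π)) q + ind (s e ≟ₛ q)              ∎
    where
    open ≡-Reasoning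
    swap : ∀ a b c → a + (b + c) ≡ c + b + a
    swap = solve-∀

  -- A linear system can express Kirchhoff's law at finitely many states only. At a state other than
  -- `a`, `b` and the ends of edges, every term vanishes.
  balanced-everywhere : ∀ φ (α β : State → ℕ) a b → (∀ q → a ≢ q → α q ≡ 0) → (∀ q → b ≢ q → β q ≡ 0) →
    (let At = λ q → out s t φ q + β q ≡ into s t φ q + α q) →
    At a → At b → (∀ e → At (s e)) → (∀ e → At (t e)) → ∀ q → At q
  balanced-everywhere φ α β a b hα hβ ha hb hs ht q with a ≟ₛ q
  ... | yes refl = ha
  ... | no na with b ≟ₛ q
  ...   | yes refl = hb
  ...   | no nb with any? (λ e → s e ≟ₛ q)
  ...     | yes (e , refl) = hs e
  ...     | no ns with any? (λ e → t e ≟ₛ q)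
  ...       | yes (e , refl) = ht e
  ...       | no nt = cong₂ _+_ (trans
          (sum-zero (λ e → trans (cong (φ e *_) (ind-no (s e ≟ₛ q) (λ h → ns (e , h)))) (*-zeroʳ (φ e))))
          (sym (sum-zero (λ e → trans (cong (φ e *_) (ind-no (t e ≟ₛ q) (λ h → nt (e , h)))) (*-zeroʳ (φ e))))))
          (trans (hβ q nb) (sym (hα q na)))

  remove-one : ∀ (φ : Fin n → ℕ) e → 0 < φ e → ∃ λ φ′ → (∀ k → φ k ≡ δ e k + φ′ k) × sum φ ≡ suc (sum φ′)
  remove-one φ e pos = φ′ , eq , trans (sum-cong-≗ eq) (trans (∑-distrib-+ (δ e) φ′)
      (cong (_+ sum φ′) (trans (sum-cong-≗ (λ k → sym (*-identityʳ (δ e k)))) (sum-δ e (λ _ → 1)))))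
    where
    φ′ : Fin n → ℕ
    φ′ k = φ k ∸ δ e k
    eq : ∀ k → φ k ≡ δ e k + φ′ k
    eq k = sym (m+[n∸m]≡n (subst (_≤ φ k) (*-identityˡ (δ e k)) (sum-term {c = φ} e pos k)))

  dot-remove : ∀ {φ φ′ : Fin n → ℕ} {e} (w : Fin n → ℕ) → (∀ k → φ k ≡ δ e k + φ′ k) → dot φ w ≡ w e + dot φ′ w
  dot-remove {φ′ = φ′} {e} w eq = trans (dot-cong w eq) (trans (dot-+ (δ e) φ′ w) (cong (_+ dot φ′ w) (dot-δ e w)))

  -- A walk that greedily follows unused edges from a can only get stuck at b.
  trail : ∀ N (φ : Fin n → ℕ) a b → sum φ ≡ N → (∀ q → BalancedAt s t φ a b q) →
          ∃ λ π → ∃ λ ψ → Path s t a π b × (∀ k → φ k ≡ cnt π k + ψ k) × Circulation s t ψ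
  trail N φ a b size bal with any? (λ e → (0 <? φ e) ×-dec (s e ≟ₛ a))
  trail N φ a b size bal | no none with a ≟ₛ b
  ... | yes refl = [] , φ , refl , (λ _ → refl) , λ q → +-cancelʳ-≡ (ind (a ≟ₛ q)) _ _ (bal q)
  ... | no a≢b = ⊥-elim (1+n≢0 (begin
      suc (into s t φ a)                    ≡⟨ +-comm 1 _ ⟩
      into s t φ a + 1                      ≡⟨ cong (into s t φ a +_) (ind-yes (a ≟ₛ a) refl) ⟨
      into s t φ a + ind (a ≟ₛ a)           ≡⟨ bal a ⟨
      out s t φ a + ind (b ≟ₛ a)            ≡⟨ cong₂ _+_ (sum-zero no-out) (ind-no (b ≟ₛ a) (a≢b ∘ sym)) ⟩
      0                                     ∎))
    where
    open ≡-Reasoning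
    no-out : ∀ e → φ e * ind (s e ≟ₛ a) ≡ 0
    no-out e with s e ≟ₛ a
    ... | no _  = *-zeroʳ (φ e)
    ... | yes h = trans (*-identityʳ (φ e)) (n≤0⇒n≡0 (≮⇒≥ (λ pos → none (e , pos , h))))
  trail zero φ a b size bal | yes (e , pos , _) = ⊥-elim (<-irrefl refl
    (subst (0 <_) size (<-≤-trans pos (term≤sum φ e))))
  trail (suc N) φ a b size bal | yes (e , pos , refl) with remove-one φ e pos
  ... | φ′ , eq , sz with trail N φ′ (t e) b (suc-injective (trans (sym sz) size)) bal′
    where
    bal′ : ∀ q → BalancedAt s t φ′ (t e) b q
    bal′ q = +-cancelˡ-≡ (ind (s e ≟ₛ q)) _ _ (begin
      ind (s e ≟ₛ q) + (out s t φ′ q + ind (b ≟ₛ q))    ≡⟨ +-assoc (ind (s e ≟ₛ q)) _ _ ⟨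
      ind (s e ≟ₛ q) + out s t φ′ q + ind (b ≟ₛ q)      ≡⟨ cong (_+ ind (b ≟ₛ q)) (dot-remove _ eq) ⟨
      out s t φ q + ind (b ≟ₛ q)                        ≡⟨ bal q ⟩
      into s t φ q + ind (s e ≟ₛ q)                     ≡⟨ cong (_+ ind (s e ≟ₛ q)) (dot-remove _ eq) ⟩
      ind (t e ≟ₛ q) + into s t φ′ q + ind (s e ≟ₛ q)   ≡⟨ swap (ind (t e ≟ₛ q)) _ _ ⟩
      ind (s e ≟ₛ q) + (into s t φ′ q + ind (t e ≟ₛ q)) ∎)
      where
      open ≡-Reasoning
      swap : ∀ a b c → a + b + c ≡ c + (b + a)
      swap = solve-∀
  ...   | π , ψ , p , eq′ , circ = e ∷ π , ψ , (refl , p) ,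
          (λ k → trans (eq k) (trans (cong (δ e k +_) (eq′ k)) (sym (+-assoc (δ e k) _ _)))) , circ

  closed-trail : ∀ (φ : Fin n → ℕ) e → Circulation s t φ → 0 < φ e →
    ∃ λ ρ → ∃ λ ψ → Path s t (t e) ρ (s e) × (∀ k → φ k ≡ cnt (e ∷ ρ) k + ψ k) × Circulation s t ψ × sum ψ < sum φ
  closed-trail φ e circ pos with remove-one φ e pos
  ... | φ′ , eq , sz with trail (sum φ′) φ′ (t e) (s e) refl bal′
    where
    bal′ : ∀ q → BalancedAt s t φ′ (t e) (s e) q
    bal′ q = begin
      out s t φ′ q + ind (s e ≟ₛ q)     ≡⟨ +-comm (out s t φ′ q) _ ⟩
      ind (s e ≟ₛ q) + out s t φ′ q     ≡⟨ dot-remove _ eq ⟨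
      out s t φ q                       ≡⟨ circ q ⟩
      into s t φ q                      ≡⟨ dot-remove _ eq ⟩
      ind (t e ≟ₛ q) + into s t φ′ q    ≡⟨ +-comm (ind (t e ≟ₛ q)) _ ⟩
      into s t φ′ q + ind (t e ≟ₛ q)    ∎
      where open ≡-Reasoning
  ...   | ρ , ψ , p , eq′ , circ′ = ρ , ψ , p ,
          (λ k → trans (eq k) (trans (cong (δ e k +_) (eq′ k)) (sym (+-assoc (δ e k) _ _)))) , circ′ ,
          subst (sum ψ <_) (sym sz) (s≤s (sum-mono (λ k → subst (ψ k ≤_) (sym (eq′ k)) (m≤n+m (ψ k) _))))

  -- Hierholzer's construction: the circulation is used up in closed trails, each spliced in at the
  -- source of one of its edges. As the walk visits all sources, every trail can be attached.
  euler : ∀ N (φ : Fin n → ℕ) π a b → sum φ ≡ N → Circulation s t φ → Path s t a π b →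
          (∀ e → Thru s t π a (s e)) → ∃ λ π′ → Path s t a π′ b × (∀ k → cnt π′ k ≡ cnt π k + φ k)
  euler = <-rec _ go
    where
    go : ∀ N → (∀ {M} → M < N → ∀ φ π a b → sum φ ≡ M → Circulation s t φ → Path s t a π b →
             (∀ e → Thru s t π a (s e)) → ∃ λ π′ → Path s t a π′ b × (∀ k → cnt π′ k ≡ cnt π k + φ k)) →
           ∀ φ π a b → sum φ ≡ N → Circulation s t φ → Path s t a π b →
             (∀ e → Thru s t π a (s e)) → ∃ λ π′ → Path s t a π′ b × (∀ k → cnt π′ k ≡ cnt π k + φ k)
    go N rec φ π a b refl circ p thr with any? (λ e → 0 <? φ e)
    ... | no none = π , p , λ k → trans (sym (+-identityʳ _)) (cong (cnt π k +_) (sym (n≤0⇒n≡0 (≮⇒≥ (λ h → none (k , h))))))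
    ... | yes (e , pos) with closed-trail φ e circ pos
    ...   | ρ , ψ , r , eq , circ′ , lt with insert π (e ∷ ρ) p (thr e) (refl , r)
    ...     | π₁ , p₁ , eq₁ , thr₁ with rec lt ψ π₁ a b refl circ′ p₁ (λ e → thr₁ _ (thr e))
    ...       | π₂ , p₂ , eq₂ = π₂ , p₂ , λ k → trans (eq₂ k) (trans (cong (_+ ψ k) (eq₁ k))
                  (trans (+-assoc (cnt π k) _ (ψ k)) (cong (cnt π k +_) (sym (eq k)))))

  path-back : (∀ e → ∃ λ ρ → Path s t (t e) ρ (s e)) → ∀ π {a b} → Path s t a π b → ∃ λ ρ → Path s t b ρ a
  path-back ret []      refl = [] , refl
  path-back ret (e ∷ π) (refl , p) with path-back ret π p | ret e
  ... | ρ , r | σ , q = ρ ++ σ , path-++ ρ r q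

  tour : ∀ {m} (f : Fin m → State) a → (∀ i → ∃ λ π → Path s t a π (f i)) →
         (∀ i → ∃ λ π → Path s t (f i) π a) → ∃ λ ω → Path s t a ω a × ∀ i → Thru s t ω a (f i)
  tour {zero}  f a to from = [] , refl , λ ()
  tour {suc m} f a to from with to zero | from zero | tour (f ∘ suc) a (to ∘ suc) (from ∘ suc)
  ... | π , p | ρ , r | ω , w , thr = π ++ (ρ ++ ω) , path-++ π p (path-++ ρ r w) ,
    λ { zero → thru-++ʳ π p (thru-start (ρ ++ ω)) ; (suc i) → thru-++ʳ π p (thru-++ʳ ρ r (thr i)) }

  -- The circulation left over by a trail for `φ` may be disconnected from it. Putting the tour `ω`
  -- in front makes all sources visited; the price is that `ω` is counted in the result.
  euler-through : ∀ (φ : Fin n → ℕ) ω a b → (∀ q → BalancedAt s t φ a b q) → Path s t a ω a →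
    (∀ e → Thru s t ω a (s e)) → ∃ λ π → Path s t a π b × (∀ k → cnt π k ≡ cnt ω k + φ k)
  euler-through φ ω a b bal w thr with trail (sum φ) φ a b refl bal
  ... | π , ψ , p , eq , circ
    with euler (sum ψ) ψ (ω ++ π) a b refl circ (path-++ ω w p) (λ e → thru-++ˡ ω (thr e))
  ...   | π′ , p′ , eq′ = π′ , p′ , λ k → trans (eq′ k) (trans (cong (_+ ψ k) (cnt-++ ω π k))
            (trans (+-assoc (cnt ω k) _ (ψ k)) (cong (cnt ω k +_) (sym (eq k)))))

path-reverse : ∀ {s t : Fin n → State} π {a b} → Path s t a π b → Path t s b (reverse π) a
path-reverse []      refl = refl
path-reverse {s = s} {t} (e ∷ π) {a} {b} (refl , p) =
  subst (λ w → Path t s b w (s e)) (sym (unfold-reverse e π)) (path-++ (reverse π) (path-reverse π p) (refl , refl))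

-- Chains of components and their linear systems

Marks : ℕ → Set
Marks d = Fin d → ℕ

-- A coordinate i is rigid when every state q determines its value, namely val i q.
record Graph (d : ℕ) : Set where
  field
    nE        : ℕ
    src tgt   : Fin nE → State
    need give : Fin nE → Fin d → ℕ
    rigid     : Fin d → Bool
    val       : Fin d → State → ℕ
    val-ok    : ∀ e i → rigid i ≡ true → Fire (need e i) (give e i) (val i (src e)) (val i (tgt e))

-- In cin and cout, nothing stands for ω.
record Comp (d : ℕ) : Set where
  field
    graph    : Graph d
    qin qout : State
  open Graph graph public
  field
    cin cout : Fin d → Maybe ℕ
    rin      : ∀ i → rigid i ≡ true → cin i ≡ just (val i qin)
    rout     : ∀ i → rigid i ≡ true → cout i ≡ just (val i qout)

Meets : (Fin d → Maybe ℕ) → Marks d → Set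
Meets c x = ∀ i k → c i ≡ just k → x i ≡ k

module _ (c : Comp d) where
  open Comp c

  RunC : Marks d → Marks d → Set
  RunC m n = ∃ λ π → Path src tgt qin π qout ×
    (∀ i → Run (λ e → need e i) (λ e → give e i) π (m i) (n i)) × Meets cin m × Meets cout n

-- A `link` is fired exactly once between its neighbours: an edge that was cut out of a component,
-- or the final test of a query.
data Item (d : ℕ) : Set where
  comp : Comp d → Item d
  link : (p q : Marks d) → Item d

RunI : Item d → Marks d → Marks d → Set
RunI (comp c)   m n = RunC c m n
RunI (link p q) m n = ∀ i → Fire (p i) (q i) (m i) (n i)

Chain : List (Item d) → Marks d → Marks d → Set
Chain []       m n = m ≡ n
Chain (it ∷ ξ) m n = ∃ λ m′ → RunI it m m′ × Chain ξ m′ n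

chain-++ : ∀ (ξ : List (Item d)) {ζ m m′ n} → Chain ξ m m′ → Chain ζ m′ n → Chain (ξ ++ ζ) m n
chain-++ []       refl        s = s
chain-++ (it ∷ ξ) (x , r , c) s = x , r , chain-++ ξ c s

chain-split : ∀ (ξ : List (Item d)) {ζ m n} → Chain (ξ ++ ζ) m n → ∃ λ m′ → Chain ξ m m′ × Chain ζ m′ n
chain-split []       s = _ , refl , s
chain-split (it ∷ ξ) (x , r , c) = let y , c₁ , c₂ = chain-split ξ c in y , (x , r , c₁) , c₂

replace : {c : Comp d} {ξ : List (Item d)} → comp c ∈ ξ → List (Item d) → List (Item d)
replace {ξ = _ ∷ ξ}  (here _)  new = new ++ ξ
replace {ξ = it ∷ _} (there p) new = it ∷ replace p new

replace-sound : ∀ {c : Comp d} {ξ} (p : comp c ∈ ξ) {new m n} → (∀ {m n} → Chain new m n → RunC c m n) →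
                Chain (replace p new) m n → Chain ξ m n
replace-sound (here refl) {new} f r = let m′ , r₁ , r₂ = chain-split new r in m′ , f r₁ , r₂
replace-sound (there p) f (m′ , r , rs) = m′ , r , replace-sound p f rs

-- A well-founded order on chains

free : Bool → ℕ
free true  = 0
free false = 1

flexible : Comp d → ℕ
flexible c = sum (λ i → free (Comp.rigid c i))

isω : Maybe ℕ → ℕ
isω nothing  = 1
isω (just _) = 0

ωs : Comp d → ℕ
ωs c = sum (λ i → isω (Comp.cin c i)) + sum (λ i → isω (Comp.cout c i))

-- The order of the three measures is forced: moving a coordinate into the states multiplies the
-- edges, and cutting out an edge puts ω at the flexible coordinates of the new ends.
data _≺_ (c′ c : Comp d) : Set where
  by-flexible : flexible c′ < flexible c → c′ ≺ c
  by-edges    : flexible c′ ≤ flexible c → Comp.nE c′ < Comp.nE c → c′ ≺ c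
  by-ωs       : flexible c′ ≤ flexible c → Comp.nE c′ ≤ Comp.nE c → ωs c′ < ωs c → c′ ≺ c

≺-wellFounded : WellFounded (_≺_ {d})
≺-wellFounded {d} c₀ =
  bounded (<-wellFounded _) (<-wellFounded _) (<-wellFounded _) c₀ ≤-refl ≤-refl ≤-refl
  where
  -- `f`, `e` and `w` are only upper bounds of the measures, since a step that decreases a later
  -- measure may decrease an earlier one as well.
  bounded : ∀ {f e w} → Acc _<_ f → Acc _<_ e → Acc _<_ w →
            (c : Comp d) → flexible c ≤ f → Comp.nE c ≤ e → ωs c ≤ w → Acc _≺_ c
  below : ∀ {f e w} → Acc _<_ f → Acc _<_ e → Acc _<_ w →
          (c : Comp d) → flexible c ≤ f → Comp.nE c ≤ e → ωs c ≤ w → ∀ {c′} → c′ ≺ c → Acc _≺_ c′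
  bounded af ae aw c hf he hw = acc (below af ae aw c hf he hw)
  below (acc rf) ae aw c hf he hw {c′} (by-flexible h) =
    bounded (rf (<-≤-trans h hf)) (<-wellFounded _) (<-wellFounded _) c′ ≤-refl ≤-refl ≤-refl
  below af (acc re) aw c hf he hw {c′} (by-edges h h′) =
    bounded af (re (<-≤-trans h′ he)) (<-wellFounded _) c′ (≤-trans h hf) ≤-refl ≤-refl
  below af ae (acc rw) c hf he hw {c′} (by-ωs h h′ h″) =
    bounded af ae (rw (<-≤-trans h″ hw)) c′ (≤-trans h hf) (≤-trans h′ he) ≤-refl

Below : Comp d → Item d → Set
Below c (comp c′)  = c′ ≺ c
Below c (link _ _) = ⊤

-- A step of the Dershowitz-Manna multiset order, on lists: one component gives way to any number of
-- smaller ones, with links added freely.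
data _◁_ {d : ℕ} : List (Item d) → List (Item d) → Set where
  here  : ∀ {c new ξ} → All (Below c) new → (new ++ ξ) ◁ (comp c ∷ ξ)
  there : ∀ {it ξ′ ξ} → ξ′ ◁ ξ → (it ∷ ξ′) ◁ (it ∷ ξ)

replace-◁ : ∀ {c : Comp d} {ξ} (p : comp c ∈ ξ) {new} → All (Below c) new → replace p new ◁ ξ
replace-◁ (here refl) h = here h
replace-◁ (there p)   h = there (replace-◁ p h)

-- Nested induction on the accessibility of the head component and on that of the tail. The items of
-- `new` are prepended one by one to an accessible chain, and each component among them is below the
-- replaced one.
◁-wellFounded : WellFounded (_◁_ {d})
◁-wellFounded {d} = go
  where
  acc-link : ∀ {p q} {ξ : List (Item d)} → Acc _◁_ ξ → Acc _◁_ (link p q ∷ ξ)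
  below-link : ∀ {p q} {ξ : List (Item d)} → Acc _◁_ ξ → ∀ {ζ} → ζ ◁ (link p q ∷ ξ) → Acc _◁_ ζ
  acc-link a = acc (below-link a)
  below-link (acc r) (there h) = acc-link (r h)
  acc-comp : ∀ {c : Comp d} {ξ} → Acc _≺_ c → Acc _◁_ ξ → Acc _◁_ (comp c ∷ ξ)
  below-comp : ∀ {c : Comp d} {ξ} → Acc _≺_ c → Acc _◁_ ξ → ∀ {ζ} → ζ ◁ (comp c ∷ ξ) → Acc _◁_ ζ
  acc-new : ∀ {c : Comp d} → Acc _≺_ c → ∀ {new ξ} → All (Below c) new → Acc _◁_ ξ → Acc _◁_ (new ++ ξ)
  acc-comp ac a = acc (below-comp ac a)
  below-comp ac a (here h) = acc-new ac h a
  below-comp ac (acc r) (there h) = acc-comp ac (r h)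
  acc-new ac [] a = a
  acc-new ac@(acc rc) (_∷_ {x = comp _} h hs) a = acc-comp (rc h) (acc-new ac hs a)
  acc-new ac (_∷_ {x = link _ _} h hs) a = acc-link (acc-new ac hs a)
  go : ∀ (ξ : List (Item d)) → Acc _◁_ ξ
  go []             = acc λ ()
  go (link p q ∷ ξ) = acc-link (go ξ)
  go (comp c ∷ ξ)   = acc-comp (≺-wellFounded c) (go ξ)

-- The linear system of a chain

-- The last marking of an item has no variables of its own: it is the first marking of the rest,
-- found by `boundary`. This is what glues neighbours together.
Var : List (Item d) → Set
Var {d} [] = Fin d
Var {d} (comp c ∷ ξ)   = Fin d ⊎ (Fin (Comp.nE c) ⊎ Var ξ)
Var {d} (link _ _ ∷ ξ) = Fin d ⊎ (Fin d ⊎ Var ξ)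

boundary : (ξ : List (Item d)) → Fin d → Var ξ
boundary []             = id
boundary (comp _ ∷ ξ)   = inj₁
boundary (link _ _ ∷ ξ) = inj₁

rest : (it : Item d) {ξ : List (Item d)} → Var ξ → Var (it ∷ ξ)
rest (comp _)   v = inj₂ (inj₂ v)
rest (link _ _) v = inj₂ (inj₂ v)

inV outV : {c : Comp d} {ξ : List (Item d)} → comp c ∈ ξ → Fin d → Var ξ
inV (here refl) = inj₁
inV {ξ = it ∷ _} (there p) i = rest it (inV p i)
outV {ξ = _ ∷ ξ} (here refl) i = inj₂ (inj₂ (boundary ξ i))
outV {ξ = it ∷ _} (there p) i = rest it (outV p i)

edgeV : {c : Comp d} {ξ : List (Item d)} → comp c ∈ ξ → Fin (Comp.nE c) → Var ξ
edgeV (here refl) e = inj₂ (inj₁ e)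
edgeV {ξ = it ∷ _} (there p) e = rest it (edgeV p e)

finite-Fin : ∀ n → Finite (Fin n)
finite-Fin n = record { size = n ; enc = id ; dec = id ; dec-enc = λ _ → refl }

finite-⊎ : ∀ {A B : Set} → Finite A → Finite B → Finite (A ⊎ B)
finite-⊎ {A} {B} FA FB = record { size = A.size + B.size ; enc = enc′ ; dec = dec′ ; dec-enc = dec-enc′ }
  where
  module A = Finite FA
  module B = Finite FB
  enc′ : A ⊎ B → Fin (A.size + B.size)
  enc′ = join A.size B.size ∘ Sum.map A.enc B.enc
  dec′ : Fin (A.size + B.size) → A ⊎ B
  dec′ = Sum.map A.dec B.dec ∘ splitAt A.size
  dec-enc′ : ∀ x → dec′ (enc′ x) ≡ x
  dec-enc′ (inj₁ a) = trans (cong (Sum.map A.dec B.dec) (splitAt-join A.size B.size (inj₁ (A.enc a)))) (cong inj₁ (A.dec-enc a))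
  dec-enc′ (inj₂ b) = trans (cong (Sum.map A.dec B.dec) (splitAt-join A.size B.size (inj₂ (B.enc b)))) (cong inj₂ (B.dec-enc b))

finite-Maybe : ∀ {A : Set} → Finite A → Finite (Maybe A)
finite-Maybe {A} FA = record { size = suc size ; enc = enc′ ; dec = dec′ ; dec-enc = dec-enc′ }
  where
  open Finite FA
  enc′ : Maybe A → Fin (suc size)
  enc′ nothing  = zero
  enc′ (just a) = suc (enc a)
  dec′ : Fin (suc size) → Maybe A
  dec′ zero    = nothing
  dec′ (suc k) = just (dec k)
  dec-enc′ : ∀ x → dec′ (enc′ x) ≡ x
  dec-enc′ nothing  = refl
  dec-enc′ (just a) = cong just (dec-enc a)

finite-Var : (ξ : List (Item d)) → Finite (Var ξ)
finite-Var {d} []             = finite-Fin d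
finite-Var {d} (comp c ∷ ξ)   = finite-⊎ (finite-Fin d) (finite-⊎ (finite-Fin (Comp.nE c)) (finite-Var ξ))
finite-Var {d} (link _ _ ∷ ξ) = finite-⊎ (finite-Fin d) (finite-⊎ (finite-Fin d) (finite-Var ξ))

trivial : ∀ {U} → System U
trivial = ⋀ {n = 0} λ ()

fixed : ∀ {U} → Maybe ℕ → U → U → System U
fixed nothing  v u₀ = trivial
fixed (just k) v u₀ = var v ≐ k · u₀

module _ (c : Comp d) where
  open Comp c

  kirchhoff-system : ∀ {U} → (Fin nE → U) → U → State → System U
  kirchhoff-system Φ u₀ q = ∑ (λ e → ind (src e ≟ₛ q) · Φ e) ⊕ ind (qout ≟ₛ q) · u₀ ≐
                            ∑ (λ e → ind (tgt e ≟ₛ q) · Φ e) ⊕ ind (qin ≟ₛ q) · u₀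

  comp-system : ∀ {U} → (Fin d → U) → (Fin nE → U) → (Fin d → U) → U → System U
  comp-system M Φ N u₀ =
    (⋀ λ i → fixed (cin i) (M i) u₀) ∧ (⋀ λ i → fixed (cout i) (N i) u₀) ∧
    (⋀ λ i → var (M i) ⊕ ∑ (λ e → give e i · Φ e) ≐ var (N i) ⊕ ∑ (λ e → need e i · Φ e)) ∧
    kirchhoff-system Φ u₀ qin ∧ kirchhoff-system Φ u₀ qout ∧
    (⋀ λ e → kirchhoff-system Φ u₀ (src e)) ∧ (⋀ λ e → kirchhoff-system Φ u₀ (tgt e))

  -- `h` is the value of the homogenising variable. With `h = 1` these are the equations of a run;
  -- with `h = 0` prescribed entries vanish and the flow is a circulation.
  record CompSol (h : ℕ) (m : Marks d) (φ : Fin nE → ℕ) (n : Marks d) : Set where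
    field
      at-in     : ∀ i k → cin i ≡ just k → m i ≡ h * k
      at-out    : ∀ i k → cout i ≡ just k → n i ≡ h * k
      flow      : ∀ i → m i + dot φ (λ e → give e i) ≡ n i + dot φ (λ e → need e i)
      kirchhoff : ∀ q → out src tgt φ q + h * ind (qout ≟ₛ q) ≡ into src tgt φ q + h * ind (qin ≟ₛ q)

  comp-system-elim : ∀ {U} {M : Fin d → U} {Φ N u₀ x} → ⟦ comp-system M Φ N u₀ ⟧ x →
                     CompSol (x u₀) (x ∘ M) (x ∘ Φ) (x ∘ N)
  comp-system-elim {M = M} {Φ} {N} {u₀} {x} (hin , hout , hflow , kin , kout , ks , kt) = record
    { at-in = at cin M hin ; at-out = at cout N hout ; flow = hflow
    ; kirchhoff = balanced-everywhere (x ∘ Φ) (λ q → x u₀ * ind (qin ≟ₛ q)) (λ q → x u₀ * ind (qout ≟ₛ q)) qin qout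
        (λ q h → trans (cong (x u₀ *_) (ind-no (qin ≟ₛ q) h)) (*-zeroʳ (x u₀)))
        (λ q h → trans (cong (x u₀ *_) (ind-no (qout ≟ₛ q) h)) (*-zeroʳ (x u₀)))
        kin kout ks kt }
    where
    at : ∀ (f : Fin d → Maybe ℕ) W → (∀ i → ⟦ fixed (f i) (W i) u₀ ⟧ x) → ∀ i k → f i ≡ just k → x (W i) ≡ x u₀ * k
    at f W h i k eq with f i | h i
    at f W h i k refl | just .k | h′ = h′

  comp-system-intro : ∀ {U} {M : Fin d → U} {Φ N u₀ x m n} (r : RunC c m n) → x u₀ ≡ 1 → (∀ i → x (M i) ≡ m i) →
                      (∀ e → x (Φ e) ≡ cnt (proj₁ r) e) → (∀ i → x (N i) ≡ n i) → ⟦ comp-system M Φ N u₀ ⟧ x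
  comp-system-intro {M = M} {Φ} {N} {u₀} {x} {m} {n} (π , p , r , mi , mo) one hM hΦ hN =
    at cin M m hM mi , at cout N n hN mo , flow′ ,
    kirch qin , kirch qout , (λ e → kirch (src e)) , (λ e → kirch (tgt e))
    where
    at : ∀ (f : Fin d → Maybe ℕ) W w → (∀ i → x (W i) ≡ w i) → Meets f w → ∀ i → ⟦ fixed (f i) (W i) u₀ ⟧ x
    at f W w hW mt i with f i in eq
    ... | nothing = λ ()
    ... | just k  = trans (hW i) (trans (mt i k eq) (sym (trans (cong (_* k) one) (*-identityˡ k))))
    flow′ : ∀ i → x (M i) + dot (x ∘ Φ) (λ e → give e i) ≡ x (N i) + dot (x ∘ Φ) (λ e → need e i)
    flow′ i = trans (cong₂ _+_ (hM i) (dot-cong _ hΦ)) (trans (sym (run-total π (r i)))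
                (sym (cong₂ _+_ (hN i) (dot-cong _ hΦ))))
    one* : ∀ a → x u₀ * a ≡ a
    one* a = trans (cong (_* a) one) (*-identityˡ a)
    kirch : ∀ q → ⟦ kirchhoff-system Φ u₀ q ⟧ x
    kirch q = trans (cong₂ _+_ (dot-cong _ hΦ) (one* _)) (trans (path-balanced π p q)
                (sym (cong₂ _+_ (dot-cong _ hΦ) (one* _))))

system : ∀ (ξ : List (Item d)) {U} → (Var ξ → U) → U → System U
system [] emb u₀ = trivial
system (comp c ∷ ξ) emb u₀ =
  comp-system c (emb ∘ inj₁) (emb ∘ inj₂ ∘ inj₁) (emb ∘ inj₂ ∘ inj₂ ∘ boundary ξ) u₀ ∧ system ξ (emb ∘ inj₂ ∘ inj₂) u₀
system (link p q ∷ ξ) emb u₀ =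
  (⋀ λ i → var (emb (inj₁ i)) ≐ var (emb (inj₂ (inj₁ i))) ⊕ p i · u₀) ∧
  (⋀ λ i → var (emb (inj₂ (inj₂ (boundary ξ i)))) ≐ var (emb (inj₂ (inj₁ i))) ⊕ q i · u₀) ∧
  system ξ (emb ∘ inj₂ ∘ inj₂) u₀

sol : ∀ (ξ : List (Item d)) {m n} → Chain ξ m n → Var ξ → ℕ
sol [] {m} _ = m
sol (comp c ∷ ξ)   {m} (_ , (π , _) , r) = Sum.[ m , Sum.[ cnt π , sol ξ r ] ]
sol (link _ _ ∷ ξ) {m} (_ , f , r)       = Sum.[ m , Sum.[ (λ i → proj₁ (f i)) , sol ξ r ] ]

sol-boundary : ∀ (ξ : List (Item d)) {m n} (r : Chain ξ m n) i → sol ξ r (boundary ξ i) ≡ m i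
sol-boundary []             r i = refl
sol-boundary (comp _ ∷ ξ)   r i = refl
sol-boundary (link _ _ ∷ ξ) r i = refl

sol-solves : ∀ (ξ : List (Item d)) {U} (emb : Var ξ → U) u₀ x {m n} (r : Chain ξ m n) → x u₀ ≡ 1 →
             (∀ v → x (emb v) ≡ sol ξ r v) → ⟦ system ξ emb u₀ ⟧ x
sol-solves [] emb u₀ x r one h = λ ()
sol-solves (comp c ∷ ξ) emb u₀ x (m′ , r , rs) one h =
  comp-system-intro c {M = emb ∘ inj₁} {emb ∘ inj₂ ∘ inj₁} {emb ∘ inj₂ ∘ inj₂ ∘ boundary ξ} r one (h ∘ inj₁) (h ∘ inj₂ ∘ inj₁)
    (λ i → trans (h _) (sol-boundary ξ rs i)) ,
  sol-solves ξ (emb ∘ inj₂ ∘ inj₂) u₀ x rs one (h ∘ inj₂ ∘ inj₂)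
sol-solves (link p q ∷ ξ) emb u₀ x {m} (m′ , f , rs) one h =
  (λ i → trans (h _) (trans (proj₁ (proj₂ (f i))) (sym (cong₂ _+_ (h _) (one* (p i)))))) ,
  (λ i → trans (trans (h _) (sol-boundary ξ rs i)) (trans (proj₂ (proj₂ (f i))) (sym (cong₂ _+_ (h _) (one* (q i)))))) ,
  sol-solves ξ (emb ∘ inj₂ ∘ inj₂) u₀ x rs one (h ∘ inj₂ ∘ inj₂)
  where
  one* : ∀ a → x u₀ * a ≡ a
  one* a = trans (cong (_* a) one) (*-identityˡ a)

system-at : ∀ {c : Comp d} {ξ} (p : comp c ∈ ξ) {U} (emb : Var ξ → U) u₀ {x} → ⟦ system ξ emb u₀ ⟧ x →
            CompSol c (x u₀) (x ∘ emb ∘ inV p) (x ∘ emb ∘ edgeV p) (x ∘ emb ∘ outV p)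
system-at (here refl) emb u₀ (h , _) = comp-system-elim _ {M = emb ∘ inj₁} {emb ∘ inj₂ ∘ inj₁} h
system-at {ξ = comp _ ∷ _} (there p) emb u₀ (_ , h) = system-at p (emb ∘ inj₂ ∘ inj₂) u₀ h
system-at {ξ = link _ _ ∷ _} (there p) emb u₀ (_ , _ , h) = system-at p (emb ∘ inj₂ ∘ inj₂) u₀ h

-- `plug` exchanges the run at `p` for another chain with the same ends; it carries a local
-- splitting over to the whole chain.
record RunAt {c : Comp d} {ξ} (p : comp c ∈ ξ) {m n} (r : Chain ξ m n) : Set where
  field
    m′ n′   : Marks d
    run     : RunC c m′ n′
    in-sol  : ∀ i → sol ξ r (inV p i) ≡ m′ i
    out-sol : ∀ i → sol ξ r (outV p i) ≡ n′ i
    cnt-sol : ∀ e → sol ξ r (edgeV p e) ≡ cnt (proj₁ run) e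
    plug    : ∀ {new} → Chain new m′ n′ → Chain (replace p new) m n

run-at : ∀ {c : Comp d} {ξ} (p : comp c ∈ ξ) {m n} (r : Chain ξ m n) → RunAt p r
run-at {ξ = _ ∷ ξ} (here refl) (m′ , r , rs) = record
  { run = r ; in-sol = λ _ → refl ; out-sol = sol-boundary ξ rs ; cnt-sol = λ _ → refl
  ; plug = λ {new} s → chain-++ new s rs }
run-at {ξ = comp _ ∷ _} (there p) (x , s₀ , rs) = record
  { run = run ; in-sol = in-sol ; out-sol = out-sol ; cnt-sol = cnt-sol ; plug = λ s → x , s₀ , plug s }
  where open RunAt (run-at p rs)
run-at {ξ = link _ _ ∷ _} (there p) (x , s₀ , rs) = record
  { run = run ; in-sol = in-sol ; out-sol = out-sol ; cnt-sol = cnt-sol ; plug = λ s → x , s₀ , plug s }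
  where open RunAt (run-at p rs)

-- Runs of perfect components

rep : ∀ {A : Set} → ℕ → List A → List A
rep zero    π = []
rep (suc k) π = π ++ rep k π

rep-path : ∀ {s t : Fin n → State} k {π a} → Path s t a π a → Path s t a (rep k π) a
rep-path zero    p = refl
rep-path (suc k) {π} p = path-++ π p (rep-path k p)

module _ {p q : Fin n → ℕ} where

  -- `g r j` is the amount of tokens when `r` iterations are still ahead and `j` are done.
  rep-run : ∀ {M} π (g : ℕ → ℕ → ℕ) → (∀ r j → suc r + j ≡ M → Run p q π (g (suc r) j) (g r (suc j))) →
            ∀ r j → r + j ≡ M → Run p q (rep r π) (g r j) (g 0 M)
  rep-run π g h zero    j refl = refl
  rep-run π g h (suc r) j eq   = run-++ π (h r j eq) (rep-run π g h r (suc j) (trans (+-suc r j) eq))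

  -- Along uᴹ wᴹ σ vᴹ: each u trades h for a, each w trades a for b and each v trades b for k,
  -- where h and k are the amounts added to the two end values per iteration and a, b are positive.
  pumped-run : ∀ u w σ v M x h y k →
    (dot (cnt u) p < h ⊎ (h ≡ 0 × ∃ λ x′ → x < x′ × Run p q u x x′)) →
    (dot (cnt v) q < k ⊎ (k ≡ 0 × ∃ λ y′ → y < y′ × Run p q v y′ y)) →
    dot (cnt w) q + (dot (cnt u) q + dot (cnt v) q) + h ≡ dot (cnt w) p + (dot (cnt u) p + dot (cnt v) p) + k →
    dot (cnt σ) q + (x + h) ≡ dot (cnt σ) p + (y + k) →
    dot (cnt w) p ≤ M → dot (cnt σ) p ≤ M →
    Run p q (rep M u ++ rep M w ++ σ ++ rep M v) (x + suc M * h) (y + suc M * k)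
  pumped-run u w σ v M x h y k u-ok v-ok w-flow σ-flow w-low σ-low =
    subst₂ (Run p q (rep M u ++ rep M w ++ σ ++ rep M v)) start end
      (run-++ (rep M u) (rep-run u gᵤ stepᵤ M 0 (+-identityʳ M))
        (subst (λ z → Run p q (rep M w ++ σ ++ rep M v) z (gᵥ 0 M)) (mid₁ x h M a)
          (run-++ (rep M w) (rep-run w g-w step-w M 0 (+-identityʳ M))
            (run-++ σ σ-run (rep-run v gᵥ stepᵥ M 0 (+-identityʳ M))))))
    where
    pu = dot (cnt u) p
    qu = dot (cnt u) q
    pv = dot (cnt v) p
    qv = dot (cnt v) q
    pw = dot (cnt w) p
    qw = dot (cnt w) q

    pu<h+qu : pu < h + qu
    pu<h+qu = go u-ok
      where
      go : pu < h ⊎ (h ≡ 0 × ∃ λ x′ → x < x′ × Run p q u x x′) → pu < h + qu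
      go (inj₁ lt) = <-≤-trans lt (m≤m+n h qu)
      go (inj₂ (_ , x′ , lt , r)) = <-≤-trans (+-cancelˡ-< x pu qu
            (subst (x + pu <_) (run-total u r) (+-monoˡ-< pu lt))) (m≤n+m qu h)
    qv<k+pv : qv < k + pv
    qv<k+pv = go v-ok
      where
      go : qv < k ⊎ (k ≡ 0 × ∃ λ y′ → y < y′ × Run p q v y′ y) → qv < k + pv
      go (inj₁ lt) = <-≤-trans lt (m≤m+n k pv)
      go (inj₂ (_ , y′ , lt , r)) = <-≤-trans (+-cancelˡ-< y qv pv
            (subst (y + qv <_) (sym (run-total v r)) (+-monoˡ-< qv lt))) (m≤n+m pv k)

    a = (h + qu) ∸ pu
    b = (k + pv) ∸ qv
    a-eq : a + pu ≡ h + qu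
    a-eq = m∸n+n≡m (<⇒≤ pu<h+qu)
    b-eq : b + qv ≡ k + pv
    b-eq = m∸n+n≡m (<⇒≤ qv<k+pv)
    a>0 : 0 < a
    a>0 = m<n⇒0<n∸m pu<h+qu
    b>0 : 0 < b
    b>0 = m<n⇒0<n∸m qv<k+pv

    -- Besides the `M` copies of `h` that are traded there is a spare one: `σ` contains one copy of
    -- the homogeneous flow and turns it into `k`. Hence `suc M` in the statement.
    gᵤ g-w gᵥ : ℕ → ℕ → ℕ
    gᵤ r j = x + h + (r * h + j * a)
    g-w r j = x + h + (r * a + j * b)
    gᵥ r j = y + k + (r * b + j * k)

    start : gᵤ M 0 ≡ x + suc M * h
    start = lemma x h M
      where
      lemma : ∀ x h M → x + h + (M * h + 0) ≡ x + (h + M * h)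
      lemma = solve-∀
    mid₁ : ∀ x h M a → x + h + (M * a + 0) ≡ x + h + (0 + M * a)
    mid₁ = solve-∀
    end : gᵥ 0 M ≡ y + suc M * k
    end = lemma y k M
      where
      lemma : ∀ y k M → y + k + (0 + M * k) ≡ y + (k + M * k)
      lemma = solve-∀

    trade : ∀ {c α β γ ε} → α + γ ≡ β + ε → (c + α) + γ ≡ (c + β) + ε
    trade {c} {α} {β} {γ} {ε} eq = trans (+-assoc c α γ) (trans (cong (c +_) eq) (sym (+-assoc c β ε)))

    split-off : ∀ z α β r j → z + (suc r * α + j * β) ≡ (z + (r * α + j * β)) + α
    split-off = solve-∀
    split-off′ : ∀ z α β r j → z + (r * α + suc j * β) ≡ (z + (r * α + j * β)) + β
    split-off′ = solve-∀

    stepᵤ : ∀ r j → suc r + j ≡ M → Run p q u (gᵤ (suc r) j) (gᵤ r (suc j))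
    stepᵤ r j _ = subst₂ (Run p q u) (sym (split-off (x + h) h a r j)) (sym (split-off′ (x + h) h a r j)) (go u-ok)
      where
      z = x + h + (r * h + j * a)
      go : pu < h ⊎ (h ≡ 0 × ∃ λ x′ → x < x′ × Run p q u x x′) → Run p q u (z + h) (z + a)
      go (inj₁ lt) = run-enough-to u (≤-trans (<⇒≤ lt) (m≤n+m h z)) (trade {z} {a} {h} a-eq)
      go (inj₂ (h≡0 , x′ , lt , run)) = subst₂ (Run p q u) (e₁ h≡0) (e₂ h≡0) (run-shift u (r * h + j * a) run)
        where
        e₁ : h ≡ 0 → r * h + j * a + x ≡ z + h
        e₁ refl = lemma x r (j * a)
          where
          lemma : ∀ x r y → r * 0 + y + x ≡ x + 0 + (r * 0 + y) + 0
          lemma = solve-∀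
        x′≡ : h ≡ 0 → x′ ≡ x + a
        x′≡ refl = +-cancelʳ-≡ pu x′ (x + a) (trans (run-total u run) (trans (cong (x +_) (sym a-eq)) (sym (+-assoc x a pu))))
        e₂ : h ≡ 0 → r * h + j * a + x′ ≡ z + a
        e₂ h≡0 = trans (cong (r * h + j * a +_) (x′≡ h≡0)) (e₃ h≡0)
          where
          lemma : ∀ x r y a → r * 0 + y + (x + a) ≡ x + 0 + (r * 0 + y) + a
          lemma = solve-∀
          e₃ : h ≡ 0 → r * h + j * a + (x + a) ≡ z + a
          e₃ h≡0 rewrite h≡0 = lemma x r (j * _) _

    w-eq : b + pw ≡ a + qw
    w-eq = +-cancelʳ-≡ (pu + qv) (b + pw) (a + qw) (begin
      (b + pw) + (pu + qv)        ≡⟨ l₁ b pw pu qv ⟩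
      (b + qv) + (pw + pu)        ≡⟨ cong (_+ (pw + pu)) b-eq ⟩
      (k + pv) + (pw + pu)        ≡⟨ l₂ k pv pw pu ⟩
      pw + (pu + pv) + k          ≡⟨ w-flow ⟨
      qw + (qu + qv) + h          ≡⟨ l₃ qw qu qv h ⟩
      (h + qu) + (qw + qv)        ≡⟨ cong (_+ (qw + qv)) a-eq ⟨
      (a + pu) + (qw + qv)        ≡⟨ l₄ a pu qw qv ⟩
      (a + qw) + (pu + qv)        ∎)
      where
      open ≡-Reasoning
      l₁ : ∀ b pw pu qv → (b + pw) + (pu + qv) ≡ (b + qv) + (pw + pu)
      l₁ = solve-∀
      l₂ : ∀ k pv pw pu → (k + pv) + (pw + pu) ≡ pw + (pu + pv) + k
      l₂ = solve-∀
      l₃ : ∀ qw qu qv h → qw + (qu + qv) + h ≡ (h + qu) + (qw + qv)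
      l₃ = solve-∀
      l₄ : ∀ a pu qw qv → (a + pu) + (qw + qv) ≡ (a + qw) + (pu + qv)
      l₄ = solve-∀

    -- Before each iteration, `M` portions of size `a` or `b` are present. Both sizes are positive,
    -- so there are at least `M` tokens, enough for `w`.
    step-w : ∀ r j → suc r + j ≡ M → Run p q w (g-w (suc r) j) (g-w r (suc j))
    step-w r j eq = subst₂ (Run p q w) (sym (split-off (x + h) a b r j)) (sym (split-off′ (x + h) a b r j))
      (run-enough-to w (begin
        pw                             ≤⟨ w-low ⟩
        M                              ≡⟨ eq ⟨
        suc r + j                      ≤⟨ +-mono-≤ (m≤m*n (suc r) a {{>-nonZero a>0}}) (m≤m*n j b {{>-nonZero b>0}}) ⟩
        suc r * a + j * b              ≤⟨ m≤n+m _ (x + h) ⟩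
        x + h + (suc r * a + j * b)    ≡⟨ split-off (x + h) a b r j ⟩
        x + h + (r * a + j * b) + a    ∎) (trade {x + h + (r * a + j * b)} {b} {a} w-eq))
      where open ≤-Reasoning

    σ-run : Run p q σ (g-w 0 M) (gᵥ M 0)
    σ-run = run-enough-to σ
      (≤-trans σ-low (≤-trans (m≤m*n M b {{>-nonZero b>0}}) (m≤n+m (M * b) (x + h))))
      (begin
        y + k + (M * b + 0) + dot (cnt σ) p     ≡⟨ l₁ (y + k) (M * b) _ ⟩
        dot (cnt σ) p + (y + k) + M * b         ≡⟨ cong (_+ M * b) σ-flow ⟨
        dot (cnt σ) q + (x + h) + M * b         ≡⟨ l₂ _ (x + h) (M * b) ⟩
        x + h + (0 + M * b) + dot (cnt σ) q     ∎)
      where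
      open ≡-Reasoning
      l₁ : ∀ z m s → z + (m + 0) + s ≡ s + z + m
      l₁ = solve-∀
      l₂ : ∀ s z m → s + z + m ≡ z + (0 + m) + s
      l₂ = solve-∀

    stepᵥ : ∀ r j → suc r + j ≡ M → Run p q v (gᵥ (suc r) j) (gᵥ r (suc j))
    stepᵥ r j _ = subst₂ (Run p q v) (sym (split-off (y + k) b k r j)) (sym (split-off′ (y + k) b k r j)) (go v-ok)
      where
      z = y + k + (r * b + j * k)
      go : qv < k ⊎ (k ≡ 0 × ∃ λ y′ → y < y′ × Run p q v y′ y) → Run p q v (z + b) (z + k)
      go (inj₁ lt) = run-enough-to v (≤-trans pv≤b (m≤n+m b z)) (trade {z} {k} {b} (sym b-eq))
        where
        pv≤b : pv ≤ b
        pv≤b = +-cancelʳ-≤ qv pv b (subst (pv + qv ≤_) (sym b-eq)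
                 (subst (_≤ k + pv) (+-comm qv pv) (+-monoˡ-≤ pv (<⇒≤ lt))))
      go (inj₂ (k≡0 , y′ , lt , run)) = subst₂ (Run p q v) (e₂ k≡0) (e₁ k≡0) (run-shift v (r * b + j * k) run)
        where
        e₁ : k ≡ 0 → r * b + j * k + y ≡ z + k
        e₁ k≡0 rewrite k≡0 = lemma y j (r * _)
          where
          lemma : ∀ x r y → y + r * 0 + x ≡ x + 0 + (y + r * 0) + 0
          lemma = solve-∀
        y′≡ : k ≡ 0 → y′ ≡ y + b
        y′≡ k≡0 = +-cancelʳ-≡ qv y′ (y + b) (trans (sym (run-total v run))
                    (trans (cong (y +_) (sym (trans b-eq (cong (_+ pv) k≡0)))) (sym (+-assoc y b qv))))
        e₂ : k ≡ 0 → r * b + j * k + y′ ≡ z + b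
        e₂ k≡0 = trans (cong (r * b + j * k +_) (y′≡ k≡0)) (e₃ k≡0)
          where
          lemma : ∀ y j x b → x + j * 0 + (y + b) ≡ y + 0 + (x + j * 0) + b
          lemma = solve-∀
          e₃ : k ≡ 0 → r * b + j * k + (y + b) ≡ z + b
          e₃ k≡0 rewrite k≡0 = lemma y j (r * _) _

module _ (c : Comp d) where
  open Comp c

  Reached : Set
  Reached = ∀ e → ∃ λ π → Path src tgt qin π (src e)

  Returns : Set
  Returns = ∀ e → ∃ λ π → Path src tgt (tgt e) π (src e)

  PumpIn PumpOut : Set
  PumpIn = ∃ λ u → Path src tgt qin u qin × (∀ i k → rigid i ≡ false → cin i ≡ just k →
             ∃ λ k′ → k < k′ × Run (λ e → need e i) (λ e → give e i) u k k′)
  PumpOut = ∃ λ v → Path src tgt qout v qout × (∀ i k → rigid i ≡ false → cout i ≡ just k →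
             ∃ λ k′ → k < k′ × Run (λ e → need e i) (λ e → give e i) v k′ k)

  rigid-run : ∀ {i} → rigid i ≡ true → ∀ π {a b} → Path src tgt a π b →
              Run (λ e → need e i) (λ e → give e i) π (val i a) (val i b)
  rigid-run h []      refl       = refl
  rigid-run h (e ∷ π) (refl , p) = _ , val-ok e _ h , rigid-run h π p

  -- The flow of a homogeneous solution is a circulation, so every edge that it uses lies on a
  -- closed trail.
  returns : ∀ {m φ n} → CompSol c 0 m φ n → (∀ e → 0 < φ e) → Returns
  returns {φ = φ} H pos e with closed-trail φ e circ (pos e)
    where
    circ : Circulation src tgt φ
    circ q = trans (sym (+-identityʳ _)) (trans (CompSol.kirchhoff H q) (+-identityʳ _))
  ... | ρ , _ , r , _ = ρ , r

  -- Claimed for all large `K` and `N`, because the components of a chain have to agree on both.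
  -- `N₀` may depend on `K`: the cycle to be iterated is built from `K` copies of the flow.
  Pumped : (m h n k : Marks d) → Set
  Pumped m h n k = ∃ λ K₀ → ∀ K → K₀ ≤ K → ∃ λ N₀ → ∀ N → N₀ ≤ N →
    RunC c (λ i → m i + N * (K * h i)) (λ i → n i + N * (K * k i))

  private
    P Q : (Fin nE → ℕ) → Fin d → ℕ
    P ζ i = dot ζ (λ e → need e i)
    Q ζ i = dot ζ (λ e → give e i)

  closed-circulation : ∀ {a} π → Path src tgt a π a → Circulation src tgt (cnt π)
  closed-circulation π p q = +-cancelʳ-≡ _ _ _ (path-balanced π p q)

  hom-circulation : ∀ {m φ n} → CompSol c 0 m φ n → Circulation src tgt φ
  hom-circulation H q = trans (sym (+-identityʳ _)) (trans (CompSol.kirchhoff H q) (+-identityʳ _))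

  -- The cycle w realises the flow K ψ together with u and v; the tour ω keeps it connected.
  loop-walk : ∀ K (ψ : Fin nE → ℕ) u v ω {a} → Circulation src tgt ψ → Path src tgt qin u qin → Path src tgt a v a →
    Path src tgt qin ω qin → (∀ e → Thru src tgt ω qin (src e)) → (∀ e → cnt u e + cnt v e + cnt ω e ≤ K * ψ e) →
    ∃ λ w → Path src tgt qin w qin × (∀ g → dot (cnt w) g + (dot (cnt u) g + dot (cnt v) g) ≡ K * dot ψ g)
  loop-walk K ψ u v ω circ u-path v-path ω-path ω-thru cyc≤ =
    finish (euler-through φ ω qin qin bal ω-path ω-thru)
    where
    cyc φ : Fin nE → ℕ
    cyc e = cnt u e + cnt v e + cnt ω e
    φ e = K * ψ e ∸ cyc e
    dot-cyc : ∀ g → dot cyc g ≡ dot (cnt u) g + dot (cnt v) g + dot (cnt ω) g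
    dot-cyc g = trans (dot-+ (λ e → cnt u e + cnt v e) (cnt ω) g) (cong (_+ dot (cnt ω) g) (dot-+ (cnt u) (cnt v) g))
    dot-φ : ∀ g → dot φ g + dot cyc g ≡ K * dot ψ g
    dot-φ g = trans (sym (dot-+ φ cyc g)) (trans (dot-cong g (λ e → m∸n+n≡m (cyc≤ e))) (dot-* K ψ g))
    bal : ∀ q → BalancedAt src tgt φ qin qin q
    bal q = cong (_+ ind (qin ≟ₛ q)) (+-cancelʳ-≡ (out src tgt cyc q) _ _ (begin
      out src tgt φ q + out src tgt cyc q     ≡⟨ dot-φ _ ⟩
      K * out src tgt ψ q                     ≡⟨ cong (K *_) (circ q) ⟩
      K * into src tgt ψ q                    ≡⟨ dot-φ _ ⟨
      into src tgt φ q + into src tgt cyc q   ≡⟨ cong (into src tgt φ q +_) (trans (dot-cyc _) (trans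
        (sym (cong₂ _+_ (cong₂ _+_ (closed-circulation u u-path q) (closed-circulation v v-path q))
                        (closed-circulation ω ω-path q))) (sym (dot-cyc _)))) ⟩
      into src tgt φ q + out src tgt cyc q    ∎))
      where open ≡-Reasoning
    finish : (∃ λ w → Path src tgt qin w qin × (∀ e → cnt w e ≡ cnt ω e + φ e)) →
      ∃ λ w → Path src tgt qin w qin × (∀ g → dot (cnt w) g + (dot (cnt u) g + dot (cnt v) g) ≡ K * dot ψ g)
    finish (w , p , eq) = w , p , λ g → begin
      dot (cnt w) g + (dot (cnt u) g + dot (cnt v) g)
        ≡⟨ cong (_+ (dot (cnt u) g + dot (cnt v) g)) (trans (dot-cong g eq) (dot-+ (cnt ω) φ g)) ⟩
      dot (cnt ω) g + dot φ g + (dot (cnt u) g + dot (cnt v) g)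
        ≡⟨ rot (dot (cnt ω) g) (dot φ g) (dot (cnt u) g + dot (cnt v) g) ⟩
      dot φ g + (dot (cnt u) g + dot (cnt v) g + dot (cnt ω) g)
        ≡⟨ cong (dot φ g +_) (dot-cyc g) ⟨
      dot φ g + dot cyc g
        ≡⟨ dot-φ g ⟩
      K * dot ψ g ∎
      where
      open ≡-Reasoning
      rot : ∀ a b c → a + b + c ≡ b + (c + a)
      rot = solve-∀

  -- `K * ψ` is added to make room for the tour: `ω` is subtracted from the flow beforehand and
  -- returned by the Eulerian walk.
  through-walk : ∀ K (φ ψ : Fin nE → ℕ) ω → Circulation src tgt ψ → (∀ q → BalancedAt src tgt φ qin qout q) →
    Path src tgt qin ω qin → (∀ e → Thru src tgt ω qin (src e)) → (∀ e → cnt ω e ≤ K * ψ e) →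
    ∃ λ σ → Path src tgt qin σ qout × (∀ g → dot (cnt σ) g ≡ dot φ g + K * dot ψ g)
  through-walk K φ ψ ω circ kir ω-path ω-thru ω≤ = finish (euler-through ζ ω qin qout bal ω-path ω-thru)
    where
    ζ : Fin nE → ℕ
    ζ e = φ e + (K * ψ e ∸ cnt ω e)
    ζ-eq : ∀ e → ζ e + cnt ω e ≡ φ e + K * ψ e
    ζ-eq e = trans (+-assoc (φ e) _ _) (cong (φ e +_) (m∸n+n≡m (ω≤ e)))
    dot-ζ : ∀ g → dot ζ g + dot (cnt ω) g ≡ dot φ g + K * dot ψ g
    dot-ζ g = trans (sym (dot-+ ζ (cnt ω) g)) (trans (dot-cong g ζ-eq)
                (trans (dot-+ φ (λ e → K * ψ e) g) (cong (dot φ g +_) (dot-* K ψ g))))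
    bal : ∀ q → BalancedAt src tgt ζ qin qout q
    bal q = +-cancelʳ-≡ (out src tgt (cnt ω) q) _ _ (begin
      out src tgt ζ q + ind (qout ≟ₛ q) + out src tgt (cnt ω) q     ≡⟨ rot (out src tgt ζ q) (ind (qout ≟ₛ q)) (out src tgt (cnt ω) q) ⟩
      out src tgt ζ q + out src tgt (cnt ω) q + ind (qout ≟ₛ q)     ≡⟨ cong (_+ ind (qout ≟ₛ q)) (dot-ζ _) ⟩
      out src tgt φ q + K * out src tgt ψ q + ind (qout ≟ₛ q)       ≡⟨ rot (out src tgt φ q) (K * out src tgt ψ q) (ind (qout ≟ₛ q)) ⟩
      out src tgt φ q + ind (qout ≟ₛ q) + K * out src tgt ψ q       ≡⟨ cong₂ _+_ (kir q) (cong (K *_) (circ q)) ⟩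
      into src tgt φ q + ind (qin ≟ₛ q) + K * into src tgt ψ q      ≡⟨ rot (into src tgt φ q) (ind (qin ≟ₛ q)) (K * into src tgt ψ q) ⟩
      into src tgt φ q + K * into src tgt ψ q + ind (qin ≟ₛ q)      ≡⟨ cong (_+ ind (qin ≟ₛ q)) (dot-ζ _) ⟨
      into src tgt ζ q + into src tgt (cnt ω) q + ind (qin ≟ₛ q)    ≡⟨ rot (into src tgt ζ q) (into src tgt (cnt ω) q) (ind (qin ≟ₛ q)) ⟩
      into src tgt ζ q + ind (qin ≟ₛ q) + into src tgt (cnt ω) q    ≡⟨ cong (into src tgt ζ q + ind (qin ≟ₛ q) +_) (closed-circulation ω ω-path q) ⟨
      into src tgt ζ q + ind (qin ≟ₛ q) + out src tgt (cnt ω) q     ∎)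
      where
      open ≡-Reasoning
      rot : ∀ a b c → a + b + c ≡ a + c + b
      rot = solve-∀
    finish : (∃ λ σ → Path src tgt qin σ qout × (∀ e → cnt σ e ≡ cnt ω e + ζ e)) →
      ∃ λ σ → Path src tgt qin σ qout × (∀ g → dot (cnt σ) g ≡ dot φ g + K * dot ψ g)
    finish (σ , p , eq) = σ , p , λ g → trans (dot-cong g eq) (trans (dot-+ (cnt ω) ζ g)
      (trans (+-comm (dot (cnt ω) g) _) (dot-ζ g)))

  assemble : ∀ {m φ n h ψ k} K u w σ v → CompSol c 1 m φ n → CompSol c 0 h ψ k →
    Path src tgt qin u qin → Path src tgt qin w qin → Path src tgt qin σ qout → Path src tgt qout v qout →
    (∀ i x → rigid i ≡ false → cin i ≡ just x → ∃ λ x′ → x < x′ × Run (λ e → need e i) (λ e → give e i) u x x′) →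
    (∀ i y → rigid i ≡ false → cout i ≡ just y → ∃ λ y′ → y < y′ × Run (λ e → need e i) (λ e → give e i) v y′ y) →
    (∀ i → cin i ≡ nothing → P (cnt u) i < K * h i) → (∀ i → cout i ≡ nothing → Q (cnt v) i < K * k i) →
    (∀ g → dot (cnt w) g + (dot (cnt u) g + dot (cnt v) g) ≡ K * dot ψ g) →
    (∀ g → dot (cnt σ) g ≡ dot φ g + K * dot ψ g) →
    ∃ λ N₀ → ∀ N → N₀ ≤ N → RunC c (λ i → m i + N * (K * h i)) (λ i → n i + N * (K * k i))
  assemble {m} {φ} {n} {h} {ψ} {k} K u w σ v S H u-path w-path σ-path v-path u-run v-run h-big k-big dot-w dot-σ =
    suc (sum (P (cnt w)) + sum (P (cnt σ))) , runs
    where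
    flow-Kψ : ∀ i → K * Q ψ i + K * h i ≡ K * P ψ i + K * k i
    flow-Kψ i = trans (sym (*-distribˡ-+ K (Q ψ i) (h i))) (trans
      (cong (K *_) (trans (+-comm (Q ψ i) (h i)) (trans (CompSol.flow H i) (+-comm (k i) (P ψ i)))))
      (*-distribˡ-+ K (P ψ i) (k i)))
    σ-flow : ∀ i → Q (cnt σ) i + (m i + K * h i) ≡ P (cnt σ) i + (n i + K * k i)
    σ-flow i = begin
      Q (cnt σ) i + (m i + K * h i)               ≡⟨ cong (_+ (m i + K * h i)) (dot-σ _) ⟩
      Q φ i + K * Q ψ i + (m i + K * h i)         ≡⟨ l (Q φ i) (K * Q ψ i) (m i) (K * h i) ⟩
      (m i + Q φ i) + (K * Q ψ i + K * h i)       ≡⟨ cong₂ _+_ (CompSol.flow S i) (flow-Kψ i) ⟩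
      (n i + P φ i) + (K * P ψ i + K * k i)       ≡⟨ l (P φ i) (K * P ψ i) (n i) (K * k i) ⟨
      P φ i + K * P ψ i + (n i + K * k i)         ≡⟨ cong (_+ (n i + K * k i)) (dot-σ _) ⟨
      P (cnt σ) i + (n i + K * k i)               ∎
      where
      open ≡-Reasoning
      l : ∀ a b c d → a + b + (c + d) ≡ (c + a) + (b + d)
      l = solve-∀
    u-ok : ∀ i → rigid i ≡ false → P (cnt u) i < K * h i ⊎
             (K * h i ≡ 0 × ∃ λ x′ → m i < x′ × Run (λ e → need e i) (λ e → give e i) u (m i) x′)
    u-ok i fl with cin i in eq
    ... | nothing = inj₁ (h-big i eq)
    ... | just x  = inj₂ (trans (cong (K *_) (CompSol.at-in H i x eq)) (*-zeroʳ K) ,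
          subst (λ z → ∃ λ x′ → z < x′ × Run (λ e → need e i) (λ e → give e i) u z x′)
            (sym (trans (CompSol.at-in S i x eq) (*-identityˡ x))) (u-run i x fl eq))
    v-ok : ∀ i → rigid i ≡ false → Q (cnt v) i < K * k i ⊎
             (K * k i ≡ 0 × ∃ λ y′ → n i < y′ × Run (λ e → need e i) (λ e → give e i) v y′ (n i))
    v-ok i fl with cout i in eq
    ... | nothing = inj₁ (k-big i eq)
    ... | just y  = inj₂ (trans (cong (K *_) (CompSol.at-out H i y eq)) (*-zeroʳ K) ,
          subst (λ z → ∃ λ y′ → z < y′ × Run (λ e → need e i) (λ e → give e i) v y′ z)
            (sym (trans (CompSol.at-out S i y eq) (*-identityˡ y))) (v-run i y fl eq))
    pinned : ∀ M {x y : ℕ} {z} → x ≡ 1 * z → y ≡ 0 * z → x + suc M * (K * y) ≡ z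
    pinned M {z = z} refl refl = lemma z M K
      where
      lemma : ∀ z M K → 1 * z + (1 + M) * (K * 0) ≡ z
      lemma = solve-∀
    runs : ∀ N → suc (sum (P (cnt w)) + sum (P (cnt σ))) ≤ N →
           RunC c (λ i → m i + N * (K * h i)) (λ i → n i + N * (K * k i))
    runs (suc M) (s≤s M≥) = rep M u ++ rep M w ++ σ ++ rep M v , path , run ,
        (λ i z eq → pinned M (CompSol.at-in S i z eq) (CompSol.at-in H i z eq)) ,
        (λ i z eq → pinned M (CompSol.at-out S i z eq) (CompSol.at-out H i z eq))
      where
      path : Path src tgt qin (rep M u ++ rep M w ++ σ ++ rep M v) qout
      path = path-++ (rep M u) (rep-path M u-path) (path-++ (rep M w) (rep-path M w-path)
               (path-++ σ σ-path (rep-path M v-path)))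
      run : ∀ i → Run (λ e → need e i) (λ e → give e i) (rep M u ++ rep M w ++ σ ++ rep M v)
                      (m i + suc M * (K * h i)) (n i + suc M * (K * k i))
      run i with rigid i in eq
      ... | false = pumped-run u w σ v M (m i) (K * h i) (n i) (K * k i) (u-ok i eq) (v-ok i eq)
          (trans (cong (_+ K * h i) (dot-w _)) (trans (flow-Kψ i) (cong (_+ K * k i) (sym (dot-w _)))))
          (σ-flow i)
          (≤-trans (term≤sum (P (cnt w)) i) (≤-trans (m≤m+n (sum (P (cnt w))) (sum (P (cnt σ)))) M≥))
          (≤-trans (term≤sum (P (cnt σ)) i) (≤-trans (m≤n+m (sum (P (cnt σ))) (sum (P (cnt w)))) M≥))
      -- On a rigid coordinate nothing is pumped: the states along the path dictate its values, and
      -- both ends are prescribed.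
      ... | true = subst₂ (Run (λ e → need e i) (λ e → give e i) (rep M u ++ rep M w ++ σ ++ rep M v))
          (sym (pinned M (CompSol.at-in S i _ (rin i eq)) (CompSol.at-in H i _ (rin i eq))))
          (sym (pinned M (CompSol.at-out S i _ (rout i eq)) (CompSol.at-out H i _ (rout i eq))))
          (rigid-run eq (rep M u ++ rep M w ++ σ ++ rep M v) path)

  perfect-tour : ∀ {m φ n h ψ k} ω → Path src tgt qin ω qin → (∀ e → Thru src tgt ω qin (src e)) →
    CompSol c 1 m φ n → CompSol c 0 h ψ k →
    (∀ e → 0 < ψ e) → (∀ i → cin i ≡ nothing → 0 < h i) → (∀ i → cout i ≡ nothing → 0 < k i) →
    PumpIn → PumpOut → Pumped m h n k
  perfect-tour {m} {φ} {n} {h} {ψ} {k} ω ω-path ω-thru S H ψ>0 h>0 k>0 (u , u-path , u-run) (v , v-path , v-run) = K₀ , go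
    where
    cyc : Fin nE → ℕ
    cyc e = cnt u e + cnt v e + cnt ω e
    -- As `ψ`, and `h` and `k` at ωs, are positive, this makes `K * ψ` cover `u`, `v` and the tour
    -- on every edge, and makes `K * h` and `K * k` exceed what `u` consumes and what `v` produces
    -- at ωs.
    K₀ = suc (sum cyc + (sum (P (cnt u)) + sum (Q (cnt v))))
    kir : ∀ q → BalancedAt src tgt φ qin qout q
    kir q = trans (cong (out src tgt φ q +_) (sym (*-identityˡ (ind (qout ≟ₛ q)))))
              (trans (CompSol.kirchhoff S q) (cong (into src tgt φ q +_) (*-identityˡ (ind (qin ≟ₛ q)))))
    go : ∀ K → K₀ ≤ K → ∃ λ N₀ → ∀ N → N₀ ≤ N →
         RunC c (λ i → m i + N * (K * h i)) (λ i → n i + N * (K * k i))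
    go K K≥ = finish
      (loop-walk K ψ u v ω (hom-circulation H) u-path v-path ω-path ω-thru cyc≤)
      (through-walk K φ ψ ω (hom-circulation H) kir ω-path ω-thru (λ e → ≤-trans (m≤n+m (cnt ω e) (cnt u e + cnt v e)) (cyc≤ e)))
      where
      cyc≤ : ∀ e → cyc e ≤ K * ψ e
      cyc≤ e = ≤-trans (term≤sum cyc e) (≤-trans (m≤m+n (sum cyc) (sum (P (cnt u)) + sum (Q (cnt v)))) (≤-trans (n≤1+n _)
                 (≤-trans K≥ (m≤m*n K (ψ e) {{>-nonZero (ψ>0 e)}}))))
      u-low : ∀ i → cin i ≡ nothing → P (cnt u) i < K * h i
      u-low i eq = ≤-trans (s≤s (≤-trans (term≤sum (P (cnt u)) i)
        (≤-trans (m≤m+n (sum (P (cnt u))) (sum (Q (cnt v)))) (m≤n+m (sum (P (cnt u)) + sum (Q (cnt v))) (sum cyc)))))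
        (≤-trans K≥ (m≤m*n K (h i) {{>-nonZero (h>0 i eq)}}))
      v-low : ∀ i → cout i ≡ nothing → Q (cnt v) i < K * k i
      v-low i eq = ≤-trans (s≤s (≤-trans (term≤sum (Q (cnt v)) i)
        (≤-trans (m≤n+m (sum (Q (cnt v))) (sum (P (cnt u)))) (m≤n+m (sum (P (cnt u)) + sum (Q (cnt v))) (sum cyc)))))
        (≤-trans K≥ (m≤m*n K (k i) {{>-nonZero (k>0 i eq)}}))
      finish : (∃ λ w → Path src tgt qin w qin × (∀ g → dot (cnt w) g + (dot (cnt u) g + dot (cnt v) g) ≡ K * dot ψ g)) →
               (∃ λ σ → Path src tgt qin σ qout × (∀ g → dot (cnt σ) g ≡ dot φ g + K * dot ψ g)) →
               ∃ λ N₀ → ∀ N → N₀ ≤ N → RunC c (λ i → m i + N * (K * h i)) (λ i → n i + N * (K * k i))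
      finish (w , w-path , dot-w) (σ , σ-path , dot-σ) =
        assemble K u w σ v S H u-path w-path σ-path v-path u-run v-run u-low v-low dot-w dot-σ

  perfect : ∀ {m φ n h ψ k} → CompSol c 1 m φ n → CompSol c 0 h ψ k →
            (∀ e → 0 < ψ e) → (∀ i → cin i ≡ nothing → 0 < h i) → (∀ i → cout i ≡ nothing → 0 < k i) →
            Reached → PumpIn → PumpOut → Pumped m h n k
  perfect S H ψ>0 h>0 k>0 reached pump-in pump-out
    with tour src qin reached (λ e → path-back (returns H ψ>0) (proj₁ (reached e)) (proj₂ (reached e)))
  ... | ω , ω-path , ω-thru = perfect-tour ω ω-path ω-thru S H ψ>0 h>0 k>0 pump-in pump-out

-- Pumping cycles

all-or-any : {A B : Fin n → Set} → (∀ i → A i ⊎ B i) → (∀ i → A i) ⊎ ∃ B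
all-or-any {zero}  f = inj₁ λ ()
all-or-any {suc n} f with f zero | all-or-any (f ∘ suc)
... | inj₂ b | _            = inj₂ (zero , b)
... | inj₁ a | inj₂ (i , b) = inj₂ (suc i , b)
... | inj₁ a | inj₁ as      = inj₁ λ { zero → a ; (suc i) → as i }

enumerate : {P : Fin d → Set} → (∀ i → Dec (P i)) →
            ∃ λ n → Σ (Fin n → Fin d) λ J → (∀ k → P (J k)) × (∀ i → P i → ∃ λ k → J k ≡ i)
enumerate {zero} P? = 0 , (λ ()) , (λ ()) , λ ()
enumerate {suc d} P? with enumerate (P? ∘ suc) | P? zero
... | n , J , sound , complete | no h = n , suc ∘ J , sound ,
        λ { zero p → ⊥-elim (h p) ; (suc i) p → map₂ (cong suc) (complete i p) }
... | n , J , sound , complete | yes h = suc n , (λ { zero → zero ; (suc k) → suc (J k) }) ,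
        (λ { zero → h ; (suc k) → sound k }) ,
        λ { zero p → zero , refl ; (suc i) p → let k , eq = complete i p in suc k , cong suc eq }

short-list? : {P : List (Fin n) → Set} → ∀ K → (∀ w → Dec (P w)) → Dec (∃ λ w → length w ≤ K × P w)
short-list? {P = P} zero P? with P? []
... | yes p = yes ([] , z≤n , p)
... | no h = no λ { ([] , _ , p) → h p }
short-list? {P = P} (suc K) P? with P? [] | any? (λ e → short-list? K (λ w → P? (e ∷ w)))
... | yes p | _ = yes ([] , z≤n , p)
... | no _  | yes (e , w , le , p) = yes (e ∷ w , s≤s le , p)
... | no h  | no h′ = no λ { ([] , _ , p) → h p ; (e ∷ w , s≤s le , p) → h′ (e , w , le , p) }

module Shorten {A L : Set} (_≟A_ : DecidableEquality A) (Step : A → L → A → Set) where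

  Walk : A → List L → A → Set
  Walk a []      b = a ≡ b
  Walk a (l ∷ w) b = ∃ λ a′ → Step a l a′ × Walk a′ w b

  -- Only points that are left by a step must lie in `V`; the final one may lie outside, like the
  -- first configuration beyond a box.
  WalkIn : List A → A → List L → A → Set
  WalkIn V a []      b = a ≡ b
  WalkIn V a (l ∷ w) b = a ∈ V × ∃ λ a′ → Step a l a′ × WalkIn V a′ w b

  without : A → List A → List A
  without a = filter (λ x → ¬? (a ≟A x))

  -- After its last departure from `a` the walk avoids `a` as a starting point of steps, so `V`
  -- shrinks with every step that `shorten` keeps.
  last-visit : ∀ V a w {a′ b} → WalkIn V a′ w b →
    WalkIn (without a V) a′ w b ⊎ ∃ λ l → ∃ λ a″ → ∃ λ w′ → Step a l a″ × WalkIn (without a V) a″ w′ b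
  last-visit V a [] refl = inj₁ refl
  last-visit V a (l ∷ w) {a′} (v , a″ , st , r) with last-visit V a w r
  ... | inj₂ later = inj₂ later
  ... | inj₁ r′ with a ≟A a′
  ...   | yes refl = inj₂ (l , a″ , w , st , r′)
  ...   | no a≢a′  = inj₁ (∈-filter⁺ (λ x → ¬? (a ≟A x)) v a≢a′ , a″ , st , r′)

  shorten : ∀ K V → length V ≤ K → ∀ {a} w {b} → WalkIn V a w b → ∃ λ w′ → Walk a w′ b × length w′ ≤ K
  shorten K V le [] refl = [] , refl , z≤n
  shorten zero [] le (l ∷ w) (() , _)
  shorten (suc K) V le {a} (l ∷ w) (v , a′ , st , r) with last-visit V a w r
  ... | inj₁ r′ = let w′ , p , le′ = shorten K (without a V) smaller w r′ in l ∷ w′ , (a′ , st , p) , s≤s le′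
    where
    smaller : length (without a V) ≤ K
    smaller = s≤s⁻¹ (<-≤-trans (filter-notAll (λ x → ¬? (a ≟A x)) V (lose v (λ h → h refl))) le)
  ... | inj₂ (l′ , a″ , w″ , st′ , r′) =
    let w′ , p , le′ = shorten K (without a V) smaller w″ r′ in l′ ∷ w′ , (a″ , st′ , p) , s≤s le′
    where
    smaller : length (without a V) ≤ K
    smaller = s≤s⁻¹ (<-≤-trans (filter-notAll (λ x → ¬? (a ≟A x)) V (lose v (λ h → h refl))) le)

module _ {s t : Fin n → State} where

  path-shorten : ∀ π {a b} → Path s t a π b → ∃ λ π′ → Path s t a π′ b × length π′ ≤ n
  path-shorten π p = let π′ , w , le = shorten n V (≤-reflexive (length-tabulate s)) π (to π p) in π′ , from π′ w , le
    where
    open Shorten _≟ₛ_ (λ a e b → s e ≡ a × t e ≡ b)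
    V = List.tabulate s
    to : ∀ π {a b} → Path s t a π b → WalkIn V a π b
    to []      p          = p
    to (e ∷ π) (refl , p) = ∈-tabulate⁺ e , t e , (refl , refl) , to π p
    from : ∀ π {a b} → Walk a π b → Path s t a π b
    from []      p                       = p
    from (e ∷ π) (_ , (h , refl) , p) = h , from π p

  path? : ∀ a π b → Dec (Path s t a π b)
  path? a []      b = a ≟ₛ b
  path? a (e ∷ π) b = (s e ≟ₛ a) ×-dec path? (t e) π b

  connected? : ∀ a b → Dec (∃ λ π → Path s t a π b)
  connected? a b with short-list? n (λ π → path? a π b)
  ... | yes (π , _ , p) = yes (π , p)
  ... | no h = no λ { (π , p) → let π′ , p′ , le = path-shorten π p in h (π′ , le , p′) }

fire-det : ∀ {p q x y y′} → Fire p q x y → Fire p q x y′ → y ≡ y′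
fire-det {p} (z , eq , refl) (z′ , eq′ , refl) = cong (_+ _) (+-cancelʳ-≡ p z z′ (trans (sym eq) eq′))

module _ (p q : Fin n → ℕ) where

  Reaches : ℕ → List (Fin n) → ℕ → Set
  Reaches B []      x = B ≤ x
  Reaches B (e ∷ π) x = B ≤ x ⊎ ∃ λ x′ → Fire (p e) (q e) x x′ × Reaches B π x′

  Stays : ℕ → List (Fin n) → ℕ → ℕ → Set
  Stays B []      x y = x < B × x ≡ y
  Stays B (e ∷ π) x y = x < B × ∃ λ x′ → Fire (p e) (q e) x x′ × Stays B π x′ y

  reaches-or-stays : ∀ B π {x y} → Run p q π x y → Reaches B π x ⊎ Stays B π x y
  reaches-or-stays B [] {x} r with B ≤? x
  ... | yes h = inj₁ h
  ... | no h  = inj₂ (≰⇒> h , r)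
  reaches-or-stays B (e ∷ π) {x} (x′ , f , r) with B ≤? x | reaches-or-stays B π r
  ... | yes h | _      = inj₁ (inj₁ h)
  ... | no h | inj₁ h′ = inj₁ (inj₂ (x′ , f , h′))
  ... | no h | inj₂ h′ = inj₂ (≰⇒> h , x′ , f , h′)

  reaches-weaken : ∀ {B B′} → B′ ≤ B → ∀ π {x} → Reaches B π x → Reaches B′ π x
  reaches-weaken le []      h                   = ≤-trans le h
  reaches-weaken le (e ∷ π) (inj₁ h)            = inj₁ (≤-trans le h)
  reaches-weaken le (e ∷ π) (inj₂ (x′ , f , h)) = inj₂ (x′ , f , reaches-weaken le π h)

vectors : ∀ n → ℕ → List (Vec ℕ n)
vectors zero    B = [] ∷ []
vectors (suc n) B = cartesianProductWith _∷_ (upTo B) (vectors n B)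

∈-vectors : ∀ {n B} (x : Fin n → ℕ) → (∀ k → x k < B) → tabulate x ∈ vectors n B
∈-vectors {zero}  x h = here refl
∈-vectors {suc n} x h = ∈-cartesianProductWith⁺ _∷_ (∈-upTo⁺ (h zero)) (∈-vectors (x ∘ suc) (h ∘ suc))

module Extraction (g : Graph d) where
  open Graph g

  RunOn : Fin d → List (Fin nE) → ℕ → ℕ → Set
  RunOn i = Run (λ e → need e i) (λ e → give e i)

  ReachesOn : Fin d → ℕ → List (Fin nE) → ℕ → Set
  ReachesOn i = Reaches (λ e → need e i) (λ e → give e i)

  maxNeed : ℕ
  maxNeed = sum (λ e → sum (need e))

  need≤ : ∀ i e → need e i ≤ maxNeed
  need≤ i e = ≤-trans (term≤sum (need e) i) (term≤sum (λ e → sum (need e)) e)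

  high-run : ∀ i π {C L x} → length π ≤ L → C + L * maxNeed ≤ x → ∃ λ y → C ≤ y × RunOn i π x y
  high-run i π {C} {L} {x} le h = y , +-cancelʳ-≤ (dot (cnt π) (λ e → need e i)) C y (begin
      C + dot (cnt π) (λ e → need e i)    ≤⟨ +-monoʳ-≤ C low ⟩
      C + L * maxNeed                     ≤⟨ h ⟩
      x                                   ≤⟨ m≤m+n x _ ⟩
      x + dot (cnt π) (λ e → give e i)    ≡⟨ run-total π r ⟨
      y + dot (cnt π) (λ e → need e i)    ∎) , r
    where
    open ≤-Reasoning
    low : dot (cnt π) (λ e → need e i) ≤ L * maxNeed
    low = ≤-trans (dot-cnt-≤ π (need≤ i)) (*-monoˡ-≤ maxNeed le)
    y,r = run-enough {q = λ e → give e i} π (≤-trans low (≤-trans (m≤n+m _ C) h))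
    y = proj₁ y,r
    r = proj₂ y,r

  module _ {n} (J : Fin n → Fin d) where

    Config : Set
    Config = State × Vec ℕ n

    StepJ : Config → Fin nE → Config → Set
    StepJ (a , x) e (b , y) = src e ≡ a × tgt e ≡ b ×
      (∀ k → Fire (need e (J k)) (give e (J k)) (lookup x k) (lookup y k))

    open Shorten {Config} (Product.≡-dec _≟ₛ_ (Vec.≡-dec _≟ℕ_)) StepJ

    boxed : ℕ → List Config
    boxed B = cartesianProduct (List.tabulate src) (vectors n B)

    -- Before the first time that some coordinate reaches `B`, all configurations lie in the finite
    -- list `boxed B`, so this part can be shortened. By `later`, every coordinate reaches `B` at
    -- that time or afterwards.
    record FirstHit (B : ℕ) (a : State) (x : Fin n → ℕ) (b : State) : Set where
      field
        w     : List (Fin nE)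
        a′    : State
        x′    : Fin n → ℕ
        walk  : WalkIn (boxed B) (a , tabulate x) w (a′ , tabulate x′)
        k     : Fin n
        high  : B ≤ x′ k
        π     : List (Fin nE)
        path  : Path src tgt a′ π b
        runs  : ∀ k → ∃ λ y → RunOn (J k) π (x′ k) y
        later : ∀ k → ReachesOn (J k) B π (x′ k)

    first-hit : ∀ B π {a b} x → Fin n → Path src tgt a π b → (∀ k → ∃ λ y → RunOn (J k) π (x k) y) →
                (∀ k → ReachesOn (J k) B π (x k)) → FirstHit B a x b
    first-hit B π x k₀ p runs reach with any? (λ k → B ≤? x k)
    first-hit B π x k₀ p runs reach | yes (k , h) = record
      { w = [] ; walk = refl ; k = k ; high = h ; π = π ; path = p ; runs = runs ; later = reach }
    first-hit B [] x k₀ p runs reach | no h = ⊥-elim (h (k₀ , reach k₀))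
    first-hit B (e ∷ π) {a} x k₀ (refl , p) runs reach | no h = record
      { FirstHit rec
      ; w = e ∷ FirstHit.w rec
      ; walk = ∈-cartesianProduct⁺ (∈-tabulate⁺ e) (∈-vectors x (λ k → ≰⇒> (λ le → h (k , le)))) ,
               (tgt e , tabulate x₁) , (refl , refl , fires) , FirstHit.walk rec }
      where
      x₁ : Fin n → ℕ
      x₁ k = proj₁ (proj₂ (runs k))
      fire₁ : ∀ k → Fire (need e (J k)) (give e (J k)) (x k) (x₁ k)
      fire₁ k = proj₁ (proj₂ (proj₂ (runs k)))
      fires : ∀ k → Fire (need e (J k)) (give e (J k)) (lookup (tabulate x) k) (lookup (tabulate x₁) k)
      fires k = subst₂ (Fire _ _) (sym (lookup∘tabulate x k)) (sym (lookup∘tabulate x₁ k)) (fire₁ k)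
      reach₁ : ∀ k → ReachesOn (J k) B π (x₁ k)
      reach₁ k with reach k
      ... | inj₁ le = ⊥-elim (h (k , le))
      ... | inj₂ (x″ , f , r) = subst (ReachesOn (J k) B π) (fire-det f (fire₁ k)) r
      rec = first-hit B π x₁ k₀ p (λ k → proj₁ (runs k) , proj₂ (proj₂ (proj₂ (runs k)))) reach₁

    walk-path : ∀ w {a x b y} → Walk (a , x) w (b , y) → Path src tgt a w b
    walk-path []      refl                                  = refl
    walk-path (e ∷ w) (_ , (h , refl , _) , r) = h , walk-path w r

    walk-run : ∀ w {a x b y} → Walk (a , x) w (b , y) → ∀ k → RunOn (J k) w (lookup x k) (lookup y k)
    walk-run []      refl                      k = refl
    walk-run (e ∷ w) (_ , (_ , _ , f) , r) k = _ , f k , walk-run w r k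

    first-hit-short : ∀ {B a x b} (hit : FirstHit B a x b) → let open FirstHit hit in
      ∃ λ w′ → length w′ ≤ length (boxed B) × Path src tgt a w′ a′ × (∀ k → RunOn (J k) w′ (x k) (x′ k))
    first-hit-short {B} {a} {x} hit with shorten (length (boxed B)) (boxed B) ≤-refl w walk
      where open FirstHit hit
    ... | w′ , wk , le = w′ , le , walk-path w′ wk ,
            λ k → subst₂ (RunOn (J k) w′) (lookup∘tabulate x k) (lookup∘tabulate (FirstHit.x′ hit) k) (walk-run w′ wk k)

  -- Rackoff's argument: shorten the run up to the first time some coordinate k is huge, then
  -- extract a short run for the remaining coordinates, along which k cannot get low.
  extract : ∀ n C → ∃ λ B → ∃ λ L → ∀ (J : Fin n → Fin d) π {a b} (x : Fin n → ℕ) → Path src tgt a π b →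
    (∀ k → ∃ λ y → RunOn (J k) π (x k) y) → (∀ k → ReachesOn (J k) B π (x k)) →
    ∃ λ π′ → ∃ λ b′ → Path src tgt a π′ b′ × length π′ ≤ L × (∀ k → ∃ λ y → C ≤ y × RunOn (J k) π′ (x k) y)
  extract zero C = 0 , 0 , λ J π x p runs reach → [] , _ , refl , z≤n , λ ()
  extract (suc n) C with extract n C
  ... | B′ , L′ , rec = B , L , main
    where
    -- From `B` tokens a coordinate can pay for `L′` further steps and keep `C`; as `B` is at least
    -- `B′`, the other coordinates still satisfy the induction hypothesis.
    B = B′ + (C + L′ * maxNeed)
    L = length (cartesianProduct (List.tabulate src) (vectors (suc n) B)) + L′
    main : ∀ (J : Fin (suc n) → Fin d) π {a b} (x : Fin (suc n) → ℕ) → Path src tgt a π b →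
      (∀ k → ∃ λ y → RunOn (J k) π (x k) y) → (∀ k → ReachesOn (J k) B π (x k)) →
      ∃ λ π′ → ∃ λ b′ → Path src tgt a π′ b′ × length π′ ≤ L × (∀ k → ∃ λ y → C ≤ y × RunOn (J k) π′ (x k) y)
    main J π x p runs reach with first-hit J B π x zero p runs reach
    ... | hit with first-hit-short J hit
    ...   | w , w-short , w-path , w-run
      with rec (J ∘ punchIn k) π₁ (x′ ∘ punchIn k) path (runs₁ ∘ punchIn k)
               (λ j → reaches-weaken _ _ (m≤m+n B′ _) π₁ (later (punchIn k j)))
      where open FirstHit hit renaming (π to π₁; runs to runs₁)
    ...     | π₂ , b₂ , p₂ , short , good =
      w ++ π₂ , b₂ , path-++ w w-path p₂ , subst (_≤ L) (sym (length-++ w)) (+-mono-≤ w-short short) , ends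
      where
      open FirstHit hit using (k; high; x′)
      end : ∀ j → ∃ λ y → C ≤ y × RunOn (J j) π₂ (x′ j) y
      end j with k ≟ j
      ... | yes refl = high-run (J k) π₂ short (≤-trans (m≤n+m _ B′) high)
      ... | no k≢j   = subst (λ j → ∃ λ y → C ≤ y × RunOn (J j) π₂ (x′ j) y) (punchIn-punchOut k≢j) (good (punchOut k≢j))
      ends : ∀ j → ∃ λ y → C ≤ y × RunOn (J j) (w ++ π₂) (x j) y
      ends j = let y , le , r = end j in y , le , run-++ w (w-run j) r

module _ (c : Comp d) where
  open Comp c
  open Extraction graph

  StaysOn : Fin d → ℕ → List (Fin nE) → ℕ → ℕ → Set
  StaysOn i = Stays (λ e → need e i) (λ e → give e i)

  -- The bound is uniform, but which coordinate stays below it depends on the run.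
  Unpumpable : ℕ → Set
  Unpumpable B = ∀ π {b} {m n : Marks d} → Path src tgt qin π b → (∀ i → RunOn i π (m i) (n i)) → Meets cin m →
    ∃ λ i → rigid i ≡ false × (∃ λ k → cin i ≡ just k) × StaysOn i B π (m i) (n i)

  finite? : ∀ i → Dec (rigid i ≡ false × ∃ λ k → cin i ≡ just k)
  finite? i with rigid i | cin i
  ... | true  | _       = no λ { (() , _) }
  ... | false | nothing = no λ { (_ , _ , ()) }
  ... | false | just k  = yes (refl , k , refl)

  -- If all finite flexible coordinates reach `B` along some run, `extract` gives a path of length
  -- at most `L` that leaves `C` tokens on each. Returning takes at most `nE` edges and costs at
  -- most `nE * maxNeed`, so more than the initial values remains. Hence, if no pump of length at
  -- most `L + nE` exists, each run keeps some coordinate below `B`.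
  pumpable? : Returns c → PumpIn c ⊎ ∃ Unpumpable
  pumpable? ret with enumerate finite?
  ... | n , J , sound , complete = decide (short-list? (L + nE) is-pump?)
    where
    x : Fin n → ℕ
    x k = proj₁ (proj₂ (sound k))
    C = suc (sum x) + nE * maxNeed
    B,L = extract n C
    B = proj₁ B,L
    L = proj₁ (proj₂ B,L)
    IsPump : List (Fin nE) → Set
    IsPump u = Path src tgt qin u qin × (∀ k → ∃ λ y → x k < y × RunOn (J k) u (x k) y)
    grows? : ∀ i u x → Dec (∃ λ y → x < y × RunOn i u x y)
    grows? i u x with run? u x
    ... | no h = no λ { (y , _ , r) → h (y , r) }
    ... | yes (y , r) with x <? y
    ...   | yes lt = yes (y , lt , r)
    ...   | no h   = no λ { (y′ , lt , r′) → h (subst (x <_) (run-det u r′ r) lt) }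
    is-pump? : ∀ u → Dec (IsPump u)
    is-pump? u = path? qin u qin ×-dec all? (λ k → grows? (J k) u (x k))
    pump-exists : ∀ π {b} → Path src tgt qin π b → (∀ k → ∃ λ y → RunOn (J k) π (x k) y) →
                  (∀ k → ReachesOn (J k) B π (x k)) → ∃ λ u → length u ≤ L + nE × IsPump u
    pump-exists π p runs reach with proj₂ (proj₂ B,L) J π x p runs reach
    ... | π′ , b′ , p′ , short , high with path-back ret π′ p′
    ...   | ρ₀ , r₀ with path-shorten ρ₀ r₀
    ...     | ρ , r , ρ-short = π′ ++ ρ , subst (_≤ L + nE) (sym (length-++ π′)) (+-mono-≤ short ρ-short) ,
              path-++ π′ p′ r , grow
      where
      grow : ∀ k → ∃ λ y → x k < y × RunOn (J k) (π′ ++ ρ) (x k) y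
      grow k with high k
      ... | y , le , run with high-run (J k) ρ {C = suc (sum x)} ρ-short le
      ...   | z , le′ , run′ = z , ≤-trans (s≤s (term≤sum x k)) le′ , run-++ π′ run run′
    decide : Dec (∃ λ u → length u ≤ L + nE × IsPump u) → PumpIn c ⊎ ∃ Unpumpable
    decide (yes (u , _ , p , grow)) = inj₁ (u , p , pump)
      where
      pump : ∀ i k → rigid i ≡ false → cin i ≡ just k → ∃ λ k′ → k < k′ × RunOn i u k k′
      pump i k fl eq with complete i (fl , k , eq)
      ... | j , refl with trans (sym (proj₂ (proj₂ (sound j)))) eq
      ...   | refl = grow j
    decide (no none) = inj₂ (B , stays)
      where
      stays : Unpumpable B
      stays π {m = m} {n′} p runs meets
        with all-or-any (λ k → reaches-or-stays _ _ B π (runs (J k)))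
      ... | inj₂ (k , h) = J k , proj₁ (sound k) , proj₂ (sound k) , h
      ... | inj₁ reach = ⊥-elim (none (pump-exists π p
              (λ k → n′ (J k) , subst (λ z → RunOn (J k) π z (n′ (J k))) (start k) (runs (J k)))
              (λ k → subst (ReachesOn (J k) B π) (start k) (reach k))))
        where
        start : ∀ k → m (J k) ≡ x k
        start k = meets (J k) (x k) (proj₂ (proj₂ (sound k)))

-- Splitting a component

-- A finitely branching tree, so that alternatives indexed by `Fin` can be nested without
-- flattening.
data Alts (A : Set) : Set where
  alt  : A → Alts A
  alts : ∀ {n} → (Fin n → Alts A) → Alts A

Some : ∀ {A} → (A → Set) → Alts A → Set
Some P (alt a)  = P a
Some P (alts f) = ∃ λ i → Some P (f i)

some? : ∀ {A} {P : A → Set} → (∀ a → Dec (P a)) → ∀ t → Dec (Some P t)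
some? P? (alt a)  = P? a
some? P? (alts f) = any? (λ i → some? P? (f i))

some-elim : ∀ {A} {P : A → Set} {X : Set} → (∀ a → P a → X) → ∀ t → Some P t → X
some-elim h (alt a)  p       = h a p
some-elim h (alts f) (i , p) = some-elim h (f i) p

some-imp : ∀ {A} {P Q : A → Set} → (∀ a → P a → Q a) → ∀ t → Some P t → Some Q t
some-imp h (alt a)  p       = h a p
some-imp h (alts f) (i , p) = i , some-imp h (f i) p

map-alts : ∀ {A B : Set} → (A → B) → Alts A → Alts B
map-alts g (alt a)  = alt (g a)
map-alts g (alts f) = alts (λ i → map-alts g (f i))

some-map : ∀ {A B : Set} {P : A → Set} {Q : B → Set} (g : A → B) → (∀ a → P a → Q (g a)) →
           ∀ t → Some P t → Some Q (map-alts g t)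
some-map g h (alt a)  p       = h a p
some-map g h (alts f) (i , p) = i , some-map g h (f i) p

Refinement : Comp d → Set
Refinement {d} c = Σ (List (Item d)) λ new → All (Below c) new × (∀ {m n} → Chain new m n → RunC c m n)

Taken : {c : Comp d} → Marks d → Marks d → Alts (Refinement c) → Set
Taken m n = Some (λ a → Chain (proj₁ a) m n)

set : ∀ {A : Set} → (Fin d → A) → Fin d → A → Fin d → A
set f i v j with i ≟ j
... | yes _ = v
... | no _  = f j

set-same : ∀ {A : Set} (f : Fin d → A) i v → set f i v i ≡ v
set-same f i v with i ≟ i
... | yes _ = refl
... | no h  = ⊥-elim (h refl)

set-other : ∀ {A : Set} (f : Fin d → A) {i j} v → i ≢ j → set f i v j ≡ f j
set-other f {i} {j} v h with i ≟ j
... | yes eq = ⊥-elim (h eq)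
... | no _   = refl

sum-strict : ∀ {f g : Fin n → ℕ} i → (∀ j → f j ≤ g j) → f i < g i → sum f < sum g
sum-strict zero    h lt = +-mono-<-≤ lt (sum-mono (h ∘ suc))
sum-strict (suc i) h lt = +-mono-≤-< (h zero) (sum-strict i (h ∘ suc) lt)

meets-set : ∀ {f : Fin d → Maybe ℕ} {m i v} → Meets f m → m i ≡ v → Meets (set f i (just v)) m
meets-set {f = f} {m} {i} {v} mt eq j k h with i ≟ j
... | yes refl = trans eq (just-injective h)
... | no _     = mt j k h

meets-unset : ∀ {f : Fin d → Maybe ℕ} {m i v} → (∀ k → f i ≡ just k → k ≡ v) → Meets (set f i (just v)) m → Meets f m
meets-unset {f = f} {m} {i} {v} compat mt j k h with i ≟ j
... | yes refl = trans (mt i v (set-same f i (just v))) (sym (compat k h))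
... | no i≢j   = mt j k (trans (set-other f (just v) i≢j) h)

set-rigid : ∀ {f : Fin d → Maybe ℕ} {i v} {R : Fin d → Bool} {w : Fin d → ℕ} → f i ≡ nothing →
            (∀ j → R j ≡ true → f j ≡ just (w j)) → ∀ j → R j ≡ true → set f i (just v) j ≡ just (w j)
set-rigid {i = i} eq h j r with i ≟ j
... | yes refl = case trans (sym eq) (h j r) of λ ()
... | no _     = h j r

ω-decrease : ∀ (f : Fin d → Maybe ℕ) i v → f i ≡ nothing → sum (λ j → isω (set f i (just v) j)) < sum (λ j → isω (f j))
ω-decrease f i v eq = sum-strict i le
  (subst₂ (λ a b → isω a < isω b) (sym (set-same f i (just v))) (sym eq) z<s)
  where
  le : ∀ j → isω (set f i (just v) j) ≤ isω (f j)
  le j with i ≟ j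
  ... | yes _ = z≤n
  ... | no _  = ≤-refl

module _ (c : Comp d) where
  open Comp c

  refine-in : ∀ i → cin i ≡ nothing → ℕ → Comp d
  refine-in i eq v = record
    { graph = graph ; qin = qin ; qout = qout ; cin = set cin i (just v) ; cout = cout
    ; rin = set-rigid eq rin ; rout = rout }

  refine-out : ∀ i → cout i ≡ nothing → ℕ → Comp d
  refine-out i eq v = record
    { graph = graph ; qin = qin ; qout = qout ; cin = cin ; cout = set cout i (just v)
    ; rin = rin ; rout = set-rigid eq rout }

  in-values : ∀ i → cin i ≡ nothing → ℕ → Alts (Refinement c)
  in-values i eq B = alts {n = suc B} λ v → alt (comp (refine-in i eq (toℕ v)) ∷ [] ,
    by-ωs ≤-refl ≤-refl (+-monoˡ-< (sum (λ j → isω (cout j))) (ω-decrease cin i (toℕ v) eq)) ∷ [] ,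
    λ { (_ , (π , p , r , mi , mo) , refl) →
        π , p , r , meets-unset (λ k h → case trans (sym eq) h of λ ()) mi , mo })

  out-values : ∀ i → cout i ≡ nothing → ℕ → Alts (Refinement c)
  out-values i eq B = alts {n = suc B} λ v → alt (comp (refine-out i eq (toℕ v)) ∷ [] ,
    by-ωs ≤-refl ≤-refl (+-monoʳ-< (sum (λ j → isω (cin j))) (ω-decrease cout i (toℕ v) eq)) ∷ [] ,
    λ { (_ , (π , p , r , mi , mo) , refl) →
        π , p , r , mi , meets-unset (λ k h → case trans (sym eq) h of λ ()) mo })

  in-values-complete : ∀ i eq B {m n} → RunC c m n → m i ≤ B → Taken m n (in-values i eq B)
  in-values-complete i eq B {n = n} (π , p , r , mi , mo) le =
    fromℕ< (s≤s le) , n , (π , p , r , meets-set mi (sym (toℕ-fromℕ< (s≤s le))) , mo) , refl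

  out-values-complete : ∀ i eq B {m n} → RunC c m n → n i ≤ B → Taken m n (out-values i eq B)
  out-values-complete i eq B {n = n} (π , p , r , mi , mo) le =
    fromℕ< (s≤s le) , n , (π , p , r , mi , meets-set mo (sym (toℕ-fromℕ< (s≤s le)))) , refl

others : ∀ {N} (e : Fin N) → ∃ λ n → Σ (Fin n → Fin N) λ J → n < N × (∀ k → e ≢ k → ∃ λ j → J j ≡ k)
others {suc n} e = n , punchIn e , ≤-refl , λ k h → punchOut h , punchIn-punchOut h

run-map : ∀ {m} {p q : Fin m → ℕ} (f : Fin n → Fin m) π {x y} → Run (p ∘ f) (q ∘ f) π x y → Run p q (List.map f π) x y
run-map f []      r           = r
run-map f (e ∷ π) (x′ , h , r) = x′ , h , run-map f π r

run-unmap : ∀ {m} {p q : Fin m → ℕ} (f : Fin n → Fin m) π {x y} → Run p q (List.map f π) x y → Run (p ∘ f) (q ∘ f) π x y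
run-unmap f []      r           = r
run-unmap f (e ∷ π) (x′ , h , r) = x′ , h , run-unmap f π r

path-map : ∀ {m} {s t : Fin m → State} (f : Fin n → Fin m) π {a b} → Path (s ∘ f) (t ∘ f) a π b → Path s t a (List.map f π) b
path-map f []      p       = p
path-map f (e ∷ π) (h , p) = h , path-map f π p

visits-source : ∀ {s t : Fin n → State} π {a b} e → Path s t a π b → 0 < cnt π e → ∃ λ ρ → Path s t a ρ (s e)
visits-source (e′ ∷ π) e (refl , p) h with e′ ≟ e
... | yes refl = [] , refl
... | no e′≢e with visits-source π e p (subst (λ z → 0 < z + cnt π e) (δ-≢ e′≢e) h)
...   | ρ , r = e′ ∷ ρ , refl , r

subgraph : ∀ (g : Graph d) {n} → (Fin n → Fin (Graph.nE g)) → Graph d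
subgraph g {n} J = record
  { nE = n ; src = src ∘ J ; tgt = tgt ∘ J ; need = need ∘ J ; give = give ∘ J
  ; rigid = rigid ; val = val ; val-ok = λ e → val-ok (J e) }
  where open Graph g

-- A run that uses e exactly k times is a chain of k + 1 runs of the graph without e.
module EdgeRemoval (c : Comp d) (e : Fin (Comp.nE c)) where
  open Comp c

  N′ : ℕ
  N′ = proj₁ (others e)
  inc : Fin N′ → Fin nE
  inc = proj₁ (proj₂ (others e))
  N′<nE : N′ < nE
  N′<nE = proj₁ (proj₂ (proj₂ (others e)))

  label : State → Fin d → Maybe ℕ
  label a i with rigid i
  ... | true  = just (val i a)
  ... | false = nothing

  label-rigid : ∀ a i → rigid i ≡ true → label a i ≡ just (val i a)
  label-rigid a i h with rigid i
  label-rigid a i refl | true = refl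

  RigidAt : State → Marks d → Set
  RigidAt a m = ∀ i → rigid i ≡ true → m i ≡ val i a

  label-meets : ∀ {a m} → RigidAt a m → Meets (label a) m
  label-meets {a} h i k eq with rigid i in r
  label-meets {a} h i k refl | true = h i r

  Labelled : State → (Fin d → Maybe ℕ) → Set
  Labelled a f = ∀ i → rigid i ≡ true → f i ≡ just (val i a)

  piece : ∀ a b f g → Labelled a f → Labelled b g → Comp d
  piece a b f g hf hg = record
    { graph = subgraph graph inc ; qin = a ; qout = b ; cin = f ; cout = g ; rin = hf ; rout = hg }

  pieces : ℕ → ∀ a f → Labelled a f → List (Item d)
  pieces zero    a f hf = comp (piece a qout f cout hf rout) ∷ []
  pieces (suc k) a f hf = comp (piece a (src e) f (label (src e)) hf (label-rigid (src e))) ∷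
                          link (need e) (give e) ∷ pieces k (tgt e) (label (tgt e)) (label-rigid (tgt e))

  pieces-below : ∀ k a f hf → All (Below c) (pieces k a f hf)
  pieces-below zero    a f hf = by-edges ≤-refl N′<nE ∷ []
  pieces-below (suc k) a f hf = by-edges ≤-refl N′<nE ∷ tt ∷ pieces-below k (tgt e) _ _

  RunFrom : State → (Fin d → Maybe ℕ) → Marks d → Marks d → Set
  RunFrom a f m n = ∃ λ π → Path src tgt a π qout ×
    (∀ i → Run (λ e → need e i) (λ e → give e i) π (m i) (n i)) × Meets f m × Meets cout n

  pieces-sound : ∀ k a f hf {m n} → Chain (pieces k a f hf) m n → RunFrom a f m n
  pieces-sound zero a f hf (_ , (π , p , r , mi , mo) , refl) =
    List.map inc π , path-map inc π p , (λ i → run-map inc π (r i)) , mi , mo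
  pieces-sound (suc k) a f hf (_ , (π , p , r , mi , _) , _ , fires , ch) with pieces-sound k (tgt e) _ _ ch
  ... | ρ , p′ , r′ , _ , mo = List.map inc π ++ e ∷ ρ , path-++ (List.map inc π) (path-map inc π p) (refl , p′) ,
        (λ i → run-++ (List.map inc π) (run-map inc π (r i)) (_ , fires i , r′ i)) , mi , mo

  -- An edge other than `e` extends the first piece. The two cases are alike: the first piece
  -- appears only once `pieces` unfolds.
  prepend : ∀ k j {f hf hf′ m m′ n} → (∀ i → Fire (need (inc j) i) (give (inc j) i) (m i) (m′ i)) → Meets f m →
    Chain (pieces k (tgt (inc j)) (label (tgt (inc j))) hf′) m′ n → Chain (pieces k (src (inc j)) f hf) m n
  prepend zero j fires mt (x , (π , p , r , _ , mo) , rest) =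
    x , (j ∷ π , (refl , p) , (λ i → _ , fires i , r i) , mt , mo) , rest
  prepend (suc k) j fires mt (x , (π , p , r , _ , mo) , rest) =
    x , (j ∷ π , (refl , p) , (λ i → _ , fires i , r i) , mt , mo) , rest

  pieces-complete : ∀ π a f hf {m n} → Path src tgt a π qout →
    (∀ i → Run (λ e → need e i) (λ e → give e i) π (m i) (n i)) → Meets f m → Meets cout n →
    ∃ λ k → k ≡ cnt π e × Chain (pieces k a f hf) m n
  pieces-complete [] a f hf {m} {n} refl runs mi mo =
    0 , refl , n , ([] , refl , runs , mi , mo) , refl
  pieces-complete (e′ ∷ π) .(src e′) f hf {m} {n} (refl , p) runs mi mo
    with pieces-complete π (tgt e′) (label (tgt e′)) (label-rigid (tgt e′)) {m = λ i → proj₁ (runs i)} p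
           (λ i → proj₂ (proj₂ (runs i))) (label-meets rigid-after) mo
       | e ≟ e′
    where
    rigid-after : RigidAt (tgt e′) (λ i → proj₁ (runs i))
    rigid-after i h = fire-det (subst (λ z → Fire (need e′ i) (give e′ i) z (proj₁ (runs i)))
                        (mi i _ (hf i h)) (proj₁ (proj₂ (runs i)))) (val-ok e′ i h)
  ... | k , eq , ch | yes refl = suc k , cong₂ _+_ (sym (δ-refl e)) eq ,
        m , ([] , refl , (λ i → refl) , mi , label-meets (λ i h → mi i _ (hf i h))) ,
        (λ i → proj₁ (runs i)) , (λ i → proj₁ (proj₂ (runs i))) , ch
  ... | k , eq , ch | no e≢e′ with proj₂ (proj₂ (proj₂ (others e))) e′ e≢e′
  ...   | j , refl = k , trans eq (cong (_+ cnt π e) (sym (δ-≢ (e≢e′ ∘ sym)))) ,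
          prepend k j (λ i → proj₁ (proj₂ (runs i))) mi ch

  edge-splits : ℕ → Alts (Refinement c)
  edge-splits B = alts {n = suc B} λ k → alt (pieces (toℕ k) qin cin rin , pieces-below (toℕ k) qin cin rin ,
                  pieces-sound (toℕ k) qin cin rin)

  edge-splits-complete : ∀ B {m n} (r : RunC c m n) → cnt (proj₁ r) e ≤ B → Taken m n (edge-splits B)
  edge-splits-complete B {m} {n} (π , p , r , mi , mo) le with pieces-complete π qin cin rin p r mi mo
  ... | k , refl , ch = fromℕ< (s≤s le) ,
        subst (λ k → Chain (pieces k qin cin rin) m n) (sym (toℕ-fromℕ< (s≤s le))) ch

-- The coordinate i, kept below suc B, is moved into the states and becomes rigid. An edge of the
-- product is an edge of c together with the amount z of tokens on i that it leaves untouched.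
module CoordinateProduct (c : Comp d) (i : Fin d) (B : ℕ) where
  open Comp c

  edge : Fin (nE * suc B) → Fin nE
  edge e = proj₁ (remQuot (suc B) e)

  untouched : Fin (nE * suc B) → ℕ
  untouched e = toℕ (proj₂ (remQuot {nE} (suc B) e))

  -- The head of a product state is the value of `i`, the tail the former state. Product states are
  -- non-empty, so the clause for `[]` is a default.
  value : Fin d → State → ℕ
  value j []      = 0
  value j (v ∷ a) with i ≟ j
  ... | yes _ = v
  ... | no _  = val j a

  graph′ : Graph d
  graph′ = record
    { nE = nE * suc B
    ; src = λ e → untouched e + need (edge e) i ∷ src (edge e)
    ; tgt = λ e → untouched e + give (edge e) i ∷ tgt (edge e)
    ; need = need ∘ edge ; give = give ∘ edge
    ; rigid = set rigid i true ; val = value ; val-ok = ok }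
    where
    ok : ∀ e j → set rigid i true j ≡ true → Fire (need (edge e) j) (give (edge e) j)
           (value j (untouched e + need (edge e) i ∷ src (edge e))) (value j (untouched e + give (edge e) i ∷ tgt (edge e)))
    ok e j h with i ≟ j
    ... | yes refl = untouched e , refl , refl
    ... | no _     = val-ok (edge e) j h

  module _ (flex : rigid i ≡ false) (k : ℕ) (at-in : cin i ≡ just k) (v : ℕ) (compatible : ∀ y → cout i ≡ just y → y ≡ v) where

    comp′ : Comp d
    comp′ = record
      { graph = graph′ ; qin = k ∷ qin ; qout = v ∷ qout ; cin = cin ; cout = set cout i (just v)
      ; rin = rin′ ; rout = rout′ }
      where
      rin′ : ∀ j → set rigid i true j ≡ true → cin j ≡ just (value j (k ∷ qin))
      rin′ j h with i ≟ j
      ... | yes refl = at-in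
      ... | no _     = rin j h
      rout′ : ∀ j → set rigid i true j ≡ true → set cout i (just v) j ≡ just (value j (v ∷ qout))
      rout′ j h with i ≟ j
      ... | yes refl = refl
      ... | no _     = rout j h

    less-flexible : flexible comp′ < flexible c
    less-flexible = sum-strict i le (subst₂ (λ a b → free a < free b) (sym (set-same rigid i true)) (sym flex) z<s)
      where
      le : ∀ j → free (set rigid i true j) ≤ free (rigid j)
      le j with i ≟ j
      ... | yes _ = z≤n
      ... | no _  = ≤-refl

    project-path : ∀ π {x y a b} → Path (Graph.src graph′) (Graph.tgt graph′) (x ∷ a) π (y ∷ b) →
                   Path src tgt a (List.map edge π) b
    project-path []      refl    = refl
    project-path (e ∷ π) (h , p) = proj₂ (∷-injective h) , project-path π p

    project-run : ∀ {m n} → RunC comp′ m n → RunC c m n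
    project-run (π , p , r , mi , mo) =
      List.map edge π , project-path π p , (λ j → run-map edge π (r j)) , mi , meets-unset compatible mo

  lift-edge : ∀ e {z} → z < suc B → ∃ λ e′ → edge e′ ≡ e × untouched e′ ≡ z
  lift-edge e lt = combine e (fromℕ< lt) , cong proj₁ (remQuot-combine e (fromℕ< lt)) ,
    trans (cong (toℕ ∘ proj₂) (remQuot-combine e (fromℕ< lt))) (toℕ-fromℕ< lt)

  lift-path : ∀ π {a b x y} → Path src tgt a π b → Stays (λ e → need e i) (λ e → give e i) B π x y →
    ∃ λ π′ → List.map edge π′ ≡ π × Path (Graph.src graph′) (Graph.tgt graph′) (x ∷ a) π′ (y ∷ b)
  lift-path []      refl (_ , refl) = [] , refl , refl
  lift-path (e ∷ π) (refl , p) (x<B , _ , (z , refl , refl) , st)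
    with lift-edge e (m<n⇒m<1+n (≤-<-trans (m≤m+n z (need e i)) x<B)) | lift-path π p st
  ... | e′ , refl , refl | π′ , refl , p′ = e′ ∷ π′ , refl , refl , p′

  stays-end : ∀ π {x y} → Stays (λ e → need e i) (λ e → give e i) B π x y → y < B
  stays-end []      (lt , refl)        = lt
  stays-end (e ∷ π) (_ , _ , _ , st) = stays-end π st

  lift-run : ∀ flex k at-in v compatible {m n} (r : RunC c m n) → n i ≡ v →
    Stays (λ e → need e i) (λ e → give e i) B (proj₁ r) (m i) (n i) → RunC (comp′ flex k at-in v compatible) m n
  lift-run flex k at-in _ compatible {m} {n} (π , p , r , mi , mo) refl st with lift-path π p st
  ... | π′ , refl , p′ = π′ ,
        subst (λ x → Path (Graph.src graph′) (Graph.tgt graph′) (x ∷ qin) π′ (n i ∷ qout)) (mi i k at-in) p′ ,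
        (λ j → run-unmap edge π′ (r j)) , mi , meets-set {f = cout} {n} {i} mo refl

-- A refinement by a single component, a form that carries over to the reversed component.
LessFlexible : Comp d → Set
LessFlexible {d} c = Σ (Comp d) λ c′ → flexible c′ < flexible c × (∀ {m n} → RunC c′ m n → RunC c m n)

module _ (c : Comp d) (B : ℕ) where
  open Comp c

  only-value : ∀ {i y} → cout i ≡ just y → ∀ y′ → cout i ≡ just y′ → y′ ≡ y
  only-value h y′ h′ = just-injective (trans (sym h′) h)

  no-value : ∀ {i} → cout i ≡ nothing → ∀ v y′ → cout i ≡ just y′ → y′ ≡ v
  no-value h v y′ h′ = case trans (sym h′) h of λ ()

  final-values : ∀ i → rigid i ≡ false → ∀ k → cin i ≡ just k → (y : Maybe ℕ) → cout i ≡ y → Alts (LessFlexible c)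
  final-values i fl k eq (just y) h = alt (comp′ fl k eq y (only-value h) ,
      less-flexible fl k eq y (only-value h) , project-run fl k eq y (only-value h))
    where open CoordinateProduct c i B
  final-values i fl k eq nothing h = alts {n = B} λ v → alt (comp′ fl k eq (toℕ v) (no-value h (toℕ v)) ,
      less-flexible fl k eq (toℕ v) (no-value h (toℕ v)) , project-run fl k eq (toℕ v) (no-value h (toℕ v)))
    where open CoordinateProduct c i B

  coordinate-alts : ∀ i → Dec (rigid i ≡ false × ∃ λ k → cin i ≡ just k) → Alts (LessFlexible c)
  coordinate-alts i (no _)              = alts {n = 0} λ ()
  coordinate-alts i (yes (fl , k , eq)) = final-values i fl k eq (cout i) refl

  bounded-coordinate : Alts (LessFlexible c)
  bounded-coordinate = alts {n = d} λ i → coordinate-alts i (finite? c i)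

  final-values-complete : ∀ i fl k eq y h {m n} (r : RunC c m n) →
    Stays (λ e → need e i) (λ e → give e i) B (proj₁ r) (m i) (n i) →
    Some (λ a → RunC (proj₁ a) m n) (final-values i fl k eq y h)
  final-values-complete i fl k eq (just y) h r st = lift-run fl k eq y (only-value h) r (proj₂ (proj₂ (proj₂ (proj₂ r))) i y h) st
    where open CoordinateProduct c i B
  final-values-complete i fl k eq nothing h {n = n} r st =
    fromℕ< (stays-end (proj₁ r) st) , lift-run fl k eq _ (no-value h _) r (sym (toℕ-fromℕ< (stays-end (proj₁ r) st))) st
    where open CoordinateProduct c i B

  coordinate-alts-complete : ∀ i D → rigid i ≡ false × (∃ λ k → cin i ≡ just k) → ∀ {m n} (r : RunC c m n) →
    Stays (λ e → need e i) (λ e → give e i) B (proj₁ r) (m i) (n i) →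
    Some (λ a → RunC (proj₁ a) m n) (coordinate-alts i D)
  coordinate-alts-complete i (no h)              fin r st = ⊥-elim (h fin)
  coordinate-alts-complete i (yes (fl , k , eq)) fin r st = final-values-complete i fl k eq (cout i) refl r st

  bounded-coordinate-complete : Unpumpable c B → ∀ {m n} → RunC c m n → Some (λ a → RunC (proj₁ a) m n) bounded-coordinate
  bounded-coordinate-complete unp r@(π , p , runs , mi , mo) with unp π p runs mi
  ... | i , fl , fin , st = i , coordinate-alts-complete i (finite? c i) (fl , fin) r st

-- Pumping down at the end is pumping up at the start of the reversed component, so `pumpable?` and
-- the coordinate splitting serve both ends.
reverse-comp : Comp d → Comp d
reverse-comp c = record
  { graph = record
    { nE = nE ; src = tgt ; tgt = src ; need = give ; give = need ; rigid = rigid ; val = val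
    ; val-ok = λ e i h → map₂ Product.swap (val-ok e i h) }
  ; qin = qout ; qout = qin ; cin = cout ; cout = cin ; rin = rout ; rout = rin }
  where open Comp c

reverse-runC : ∀ (c : Comp d) {m n} → RunC c m n → RunC (reverse-comp c) n m
reverse-runC c (π , p , r , mi , mo) = reverse π , path-reverse π p , (λ i → run-reverse π (r i)) , mo , mi

reverse-returns : ∀ (c : Comp d) → Returns c → Returns (reverse-comp c)
reverse-returns c ret e = let π , p = ret e in reverse π , path-reverse π p

reverse-pump : ∀ (c : Comp d) → PumpIn (reverse-comp c) → PumpOut c
reverse-pump c (u , p , grow) = reverse u , path-reverse u p ,
  λ i k fl eq → let k′ , lt , r = grow i k fl eq in k′ , lt , run-reverse u r

reverse-less-flexible : ∀ {c : Comp d} → LessFlexible (reverse-comp c) → LessFlexible c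
reverse-less-flexible {c = c} (c′ , lt , sound) =
  reverse-comp c′ , lt , λ r → reverse-runC (reverse-comp c) (sound (reverse-runC (reverse-comp c′) r))

less-flexible-refinement : ∀ {c : Comp d} → LessFlexible c → Refinement c
less-flexible-refinement (c′ , lt , sound) = comp c′ ∷ [] , by-flexible lt ∷ [] , λ { (_ , r , refl) → sound r }

-- Classification of components and the decision procedure for chains

comp-all-or-any : ∀ (ξ : List (Item d)) {A B : ∀ {c} → comp c ∈ ξ → Set} → (∀ {c} (p : comp c ∈ ξ) → A p ⊎ B p) →
                  (∀ {c} (p : comp c ∈ ξ) → A p) ⊎ ∃ λ c → Σ (comp c ∈ ξ) B
comp-all-or-any [] f = inj₁ λ ()
comp-all-or-any (link _ _ ∷ ξ) f with comp-all-or-any ξ (λ p → f (there p))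
... | inj₁ as          = inj₁ λ { (there p) → as p }
... | inj₂ (c , p , b) = inj₂ (c , there p , b)
comp-all-or-any (comp c ∷ ξ) f with f (here refl) | comp-all-or-any ξ (λ p → f (there p))
... | inj₂ b | _                  = inj₂ (c , here refl , b)
... | inj₁ a | inj₂ (c′ , p , b)  = inj₂ (c′ , there p , b)
... | inj₁ a | inj₁ as            = inj₁ λ { (here refl) → a ; (there p) → as p }

-- Completeness is asked only of runs with `R`: the bounds come from the linear system of the whole
-- chain and hold only for runs that occur in it.
Reducible : (c : Comp d) → (∀ {m n} → RunC c m n → Set) → Set
Reducible {d} c R = Σ (Alts (Refinement c)) λ t → ∀ {m n : Marks d} (r : RunC c m n) → R r → Taken m n t

module Classify (c : Comp d) (R : ∀ {m n} → RunC c m n → Set) where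
  open Comp c

  BoundedEdge : Fin nE → Set
  BoundedEdge e = ∃ λ B → ∀ {m n : Marks d} (r : RunC c m n) → R r → cnt (proj₁ r) e ≤ B
  BoundedIn BoundedOut : Fin d → Set
  BoundedIn i = ∃ λ B → ∀ {m n : Marks d} (r : RunC c m n) → R r → m i ≤ B
  BoundedOut i = ∃ λ B → ∀ {m n : Marks d} (r : RunC c m n) → R r → n i ≤ B

  by-edge : ∀ e → BoundedEdge e → Reducible c R
  by-edge e (B , h) = edge-splits B , λ r x → edge-splits-complete B r (h r x)
    where open EdgeRemoval c e

  unreached : ∀ e → ¬ (∃ λ π → Path src tgt qin π (src e)) → BoundedEdge e
  unreached e h = 0 , λ { (π , p , _) _ → ≮⇒≥ (λ pos → h (visits-source π e p pos)) }

  by-in : ∃ (λ i → cin i ≡ nothing × BoundedIn i) → Reducible c R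
  by-in (i , eq , B , h) = in-values c i eq B , λ r x → in-values-complete c i eq B r (h r x)

  by-out : ∃ (λ i → cout i ≡ nothing × BoundedOut i) → Reducible c R
  by-out (i , eq , B , h) = out-values c i eq B , λ r x → out-values-complete c i eq B r (h r x)

  by-unpumpable : ∃ (Unpumpable c) → Reducible c R
  by-unpumpable (B , unp) = map-alts less-flexible-refinement (bounded-coordinate c B) , λ r _ →
    some-map less-flexible-refinement (λ a r′ → _ , r′ , refl) (bounded-coordinate c B) (bounded-coordinate-complete c B unp r)

  by-unpumpable-reverse : ∃ (Unpumpable (reverse-comp c)) → Reducible c R
  by-unpumpable-reverse (B , unp) = map-alts refine (bounded-coordinate (reverse-comp c) B) , λ r _ →
    some-map refine (λ a r′ → _ , reverse-runC (proj₁ a) r′ , refl) (bounded-coordinate (reverse-comp c) B)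
      (bounded-coordinate-complete (reverse-comp c) B unp (reverse-runC c r))
    where
    refine : LessFlexible (reverse-comp c) → Refinement c
    refine a = less-flexible-refinement (reverse-less-flexible {c = c} a)

  when-ω : ∀ {A : Set} {B : Set} (y : Maybe ℕ) → (A ⊎ B) → (y ≡ nothing → A) ⊎ (y ≡ nothing × B)
  when-ω (just _) _        = inj₁ λ ()
  when-ω nothing  (inj₁ a) = inj₁ λ _ → a
  when-ω nothing  (inj₂ b) = inj₂ (refl , b)

  -- The pumping tests come last because they use the return paths, which exist once `ψ` is positive
  -- on every edge.
  classify : ∀ {m φ n h ψ k} → CompSol c 1 m φ n → CompSol c 0 h ψ k → (∀ e → 0 < ψ e ⊎ BoundedEdge e) →
    (∀ i → 0 < h i ⊎ BoundedIn i) → (∀ i → 0 < k i ⊎ BoundedOut i) → Pumped c m h n k ⊎ Reducible c R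
  classify {m} {φ} {n} {h} {ψ} {k} S H edges ins outs =
    case all-or-any (λ e → reach e (connected? qin (src e))) of λ where
      (inj₂ (e , b)) → inj₂ (by-edge e b)
      (inj₁ reached) → case all-or-any edges of λ where
        (inj₂ (e , b)) → inj₂ (by-edge e b)
        (inj₁ ψ>0) → case all-or-any (λ i → when-ω (cin i) (ins i)) of λ where
          (inj₂ b) → inj₂ (by-in b)
          (inj₁ h>0) → case all-or-any (λ i → when-ω (cout i) (outs i)) of λ where
            (inj₂ b) → inj₂ (by-out b)
            (inj₁ k>0) → pumps reached ψ>0 h>0 k>0 (returns c H ψ>0)
    where
    reach : ∀ e → Dec (∃ λ π → Path src tgt qin π (src e)) → (∃ λ π → Path src tgt qin π (src e)) ⊎ BoundedEdge e
    reach e (yes p) = inj₁ p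
    reach e (no h)  = inj₂ (unreached e h)
    pumps : Reached c → (∀ e → 0 < ψ e) → (∀ i → cin i ≡ nothing → 0 < h i) → (∀ i → cout i ≡ nothing → 0 < k i) →
            Returns c → Pumped c m h n k ⊎ Reducible c R
    pumps reached ψ>0 h>0 k>0 ret =
      case pumpable? c ret of λ where
        (inj₂ b) → inj₂ (by-unpumpable b)
        (inj₁ pump-in) → case pumpable? (reverse-comp c) (reverse-returns c ret) of λ where
          (inj₂ b) → inj₂ (by-unpumpable-reverse b)
          (inj₁ pump) → inj₁ (perfect c S H ψ>0 h>0 k>0 reached pump-in (reverse-pump c pump))

pumped-chain : ∀ (ξ : List (Item d)) {U} (emb : Var ξ → U) u₀ (s h : U → ℕ) → ⟦ system ξ emb u₀ ⟧ s → ⟦ system ξ emb u₀ ⟧ h →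
  s u₀ ≡ 1 → h u₀ ≡ 0 →
  (∀ {c} (p : comp c ∈ ξ) → Pumped c (s ∘ emb ∘ inV p) (h ∘ emb ∘ inV p) (s ∘ emb ∘ outV p) (h ∘ emb ∘ outV p)) →
  ∃ λ K₀ → ∀ K → K₀ ≤ K → ∃ λ N₀ → ∀ N → N₀ ≤ N → ∃ λ n →
    Chain ξ (λ i → s (emb (boundary ξ i)) + N * (K * h (emb (boundary ξ i)))) n
pumped-chain [] emb u₀ s h _ _ _ _ _ = 0 , λ _ _ → 0 , λ _ _ → _ , refl
pumped-chain (comp c ∷ ξ) emb u₀ s h (_ , Ss) (_ , Sh) one nil pumped =
  let K₁ , f₁ = pumped (here refl)
      K₂ , f₂ = pumped-chain ξ (emb ∘ inj₂ ∘ inj₂) u₀ s h Ss Sh one nil (λ p → pumped (there p))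
  in K₁ + K₂ , λ K le →
  let N₁ , g₁ = f₁ K (≤-trans (m≤m+n K₁ K₂) le)
      N₂ , g₂ = f₂ K (≤-trans (m≤n+m K₂ K₁) le)
  in N₁ + N₂ , λ N le′ →
  let n , ch = g₂ N (≤-trans (m≤n+m N₂ N₁) le′)
  in n , _ , g₁ N (≤-trans (m≤m+n N₁ N₂) le′) , ch
pumped-chain (link p q ∷ ξ) {U} emb u₀ s h (s-in , s-out , Ss) (h-in , h-out , Sh) one nil pumped =
  let K₂ , f₂ = pumped-chain ξ (emb ∘ inj₂ ∘ inj₂) u₀ s h Ss Sh one nil (λ p → pumped (there p))
  in K₂ , λ K le →
  let N₂ , g₂ = f₂ K le
  in N₂ , λ N le′ →
  let n , ch = g₂ N le′
  in n , _ , (λ i → s (emb (inj₂ (inj₁ i))) + N * (K * h (emb (inj₂ (inj₁ i)))) ,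
               shift N K (p i) (s-in i) (h-in i) , shift N K (q i) (s-out i) (h-out i)) , ch
  where
  -- As `h u₀ = 0`, the homogeneous solution takes equal values before, within and after a link, so
  -- the added tokens pass it untouched.
  shift : ∀ N K a {x y z w} → x ≡ z + s u₀ * a → y ≡ w + h u₀ * a → x + N * (K * y) ≡ z + N * (K * w) + a
  shift N K a {z = z} {w} refl refl rewrite one | nil = lemma N K a z w
    where
    lemma : ∀ N K a z w → z + (a + 0) + N * (K * (w + 0)) ≡ z + N * (K * w) + a
    lemma = solve-∀

Inhabited : List (Item d) → Set
Inhabited {d} ξ = Σ (Marks d) λ m → Σ (Marks d) λ n → Chain ξ m n

module Step (ξ : List (Item d)) where

  U : Set
  U = Maybe (Var ξ)

  open Homogenised {U} (finite-Maybe (finite-Var ξ)) (system ξ just nothing) nothing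

  sol⁺ : ∀ {m n} → Chain ξ m n → U → ℕ
  sol⁺ r nothing  = 1
  sol⁺ r (just v) = sol ξ r v

  sol⁺-solves : ∀ {m n} (r : Chain ξ m n) → Inhomogeneous (sol⁺ r)
  sol⁺-solves r = sol-solves ξ just nothing (sol⁺ r) r refl (λ _ → refl) , refl

  -- What the linear system of ξ knows about a run that occurs at the position p.
  Part : ∀ {c} (p : comp c ∈ ξ) {m n} → RunC c m n → Set
  Part p {m} {n} r = ∃ λ x → Inhomogeneous x × (∀ i → x (just (inV p i)) ≡ m i) ×
    (∀ e → x (just (edgeV p e)) ≡ cnt (proj₁ r) e) × (∀ i → x (just (outV p i)) ≡ n i)

  Reduction : Set
  Reduction = ∃ λ c → Σ (comp c ∈ ξ) λ p → Σ (Alts (Refinement c)) λ t →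
    Inhabited ξ → Some (λ a → Inhabited (replace p (proj₁ a))) t

  reduction : ∀ {c} (p : comp c ∈ ξ) → Reducible c (Part p) → Reduction
  reduction p (t , h) = _ , p , t , λ { (m , n , r) →
    let open RunAt (run-at p r) in
    some-imp (λ a ch → m , n , plug ch) t (h run (sol⁺ r , sol⁺-solves r , in-sol , cnt-sol , out-sol)) }

  progress : (∃ Inhomogeneous) → (∃ λ H → Homogeneous H × (∀ u → 0 < H u ⊎ Bounded u)) → Inhabited ξ ⊎ Reduction
  progress (s , Ss , one) (H , (SH , nil) , pos) = finish (comp-all-or-any ξ local)
    where
    local : ∀ {c} (p : comp c ∈ ξ) →
      Pumped c (s ∘ just ∘ inV p) (H ∘ just ∘ inV p) (s ∘ just ∘ outV p) (H ∘ just ∘ outV p) ⊎ Reducible c (Part p)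
    local {c} p = classify
      (subst (λ z → CompSol c z (s ∘ just ∘ inV p) (s ∘ just ∘ edgeV p) (s ∘ just ∘ outV p)) one (system-at p just nothing Ss))
      (subst (λ z → CompSol c z (H ∘ just ∘ inV p) (H ∘ just ∘ edgeV p) (H ∘ just ∘ outV p)) nil (system-at p just nothing SH))
      (λ e → Sum.map₂ (λ { (B , b) → B , λ { r (x , hx , _ , eq , _) → subst (_≤ B) (eq e) (b x hx) } }) (pos (just (edgeV p e))))
      (λ i → Sum.map₂ (λ { (B , b) → B , λ { r (x , hx , eq , _ , _) → subst (_≤ B) (eq i) (b x hx) } }) (pos (just (inV p i))))
      (λ i → Sum.map₂ (λ { (B , b) → B , λ { r (x , hx , _ , _ , eq) → subst (_≤ B) (eq i) (b x hx) } }) (pos (just (outV p i))))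
      where open Classify c (Part p)
    finish : (∀ {c} (p : comp c ∈ ξ) →
               Pumped c (s ∘ just ∘ inV p) (H ∘ just ∘ inV p) (s ∘ just ∘ outV p) (H ∘ just ∘ outV p)) ⊎
             (∃ λ c → Σ (comp c ∈ ξ) λ p → Reducible c (Part p)) → Inhabited ξ ⊎ Reduction
    finish (inj₂ (c , p , red)) = inj₂ (reduction p red)
    finish (inj₁ pumped) =
      let K , f = pumped-chain ξ just nothing s H Ss SH one nil pumped
          N , g = f K ≤-refl
          n , ch = g N ≤-refl
      in inj₁ (_ , n , ch)

  step-result : Dec (∃ Inhomogeneous) → (Inhabited ξ ⊎ ¬ Inhabited ξ) ⊎ Reduction
  step-result (no h)  = inj₁ (inj₂ λ { (m , n , r) → h (sol⁺ r , sol⁺-solves r) })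
  step-result (yes s) = Sum.map₁ inj₁ (progress s pos-or-bounded)

  outcome : (Inhabited ξ ⊎ ¬ Inhabited ξ) ⊎ Reduction
  outcome = step-result solvable?

inhabited? : (ξ : List (Item d)) → Dec (Inhabited ξ)
inhabited? {d} ξ₀ = go ξ₀ (◁-wellFounded ξ₀)
  where
  go : (ξ : List (Item d)) → Acc _◁_ ξ → Dec (Inhabited ξ)
  conclude : (ξ : List (Item d)) → Acc _◁_ ξ → (Inhabited ξ ⊎ ¬ Inhabited ξ) ⊎ Step.Reduction ξ → Dec (Inhabited ξ)
  go ξ a = conclude ξ a (Step.outcome ξ)
  conclude ξ a (inj₁ (inj₁ yes′)) = yes yes′
  conclude ξ a (inj₁ (inj₂ no′))  = no no′
  conclude ξ (acc smaller) (inj₂ (c , p , t , complete)) =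
    map′ (some-elim (λ { (new , _ , sound) (m , n , ch) → m , n , replace-sound p sound ch }) t) complete
      (some? (λ { (new , below , _) → go (replace p new) (smaller (replace-◁ p below)) }) t)

-- Persistence as a reachability question

module NetDecision (S : Net) (k : ℕ) where
  open Net S

  K : ℕ
  K = suc (suc k)

  RunN : Fin nP → List (Fin nT) → ℕ → ℕ → Set
  RunN i = Run (λ a → pre S a i) (λ a → post S a i)

  fires-run : ∀ w {M M′} → Fires S M w M′ → ∀ i → RunN i w (M i) (M′ i)
  fires-run []      ε-fire          i = refl
  fires-run (a ∷ w) (step en f) i = _ , (_ , sym (m∸n+n≡m (en i)) , refl) , fires-run w f i

  run-fires : ∀ w {M N : Fin nP → ℕ} → (∀ i → RunN i w (M i) (N i)) → ∃ λ M′ → Fires S M w M′ × (∀ i → M′ i ≡ N i)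
  run-fires []      {M} r = M , ε-fire , r
  run-fires (a ∷ w) {M} {N} r with run-fires w {fire S M a} {N} rest-run
    where
    fired : ∀ i → proj₁ (r i) ≡ fire S M a i
    fired i = let z , eq , eq′ = proj₁ (proj₂ (r i)) in
      trans eq′ (cong (_+ post S a i) (sym (trans (cong (_∸ pre S a i) eq) (m+n∸n≡m z (pre S a i)))))
    rest-run : ∀ i → RunN i w (fire S M a i) (N i)
    rest-run i = subst (λ x → RunN i w x (N i)) (fired i) (proj₂ (proj₂ (r i)))
  ... | M′ , f , same = M′ , step enabled f , same
    where
    enabled : Enabled S M a
    enabled i = let z , eq , _ = proj₁ (proj₂ (r i)) in subst (pre S a i ≤_) (sym eq) (m≤n+m (pre S a i) z)

  Runs : (Fin nP → ℕ) → List (Fin nT) → Set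
  Runs M w = ∀ i → ∃ λ y → RunN i w (M i) y

  runs? : ∀ M w → Dec (Runs M w)
  runs? M w = all? (λ i → run? w (M i))

  firable⇒runs : ∀ {M w} → Firable S M w → Runs M w
  firable⇒runs {w = w} (M′ , f) i = M′ i , fires-run w f i

  runs⇒firable : ∀ {M} w → Runs M w → Firable S M w
  runs⇒firable w r = let M′ , f , _ = run-fires w (proj₂ ∘ r) in M′ , f

  pre≤1 : ∀ a i → pre S a i ≤ 1
  pre≤1 a i with inF i a
  ... | true  = ≤-refl
  ... | false = z≤n

  -- A word of length at most K needs at most K tokens on each place.
  runs-truncated : ∀ w {M N : Fin nP → ℕ} → length w ≤ K → (∀ i → M i ⊓ K ≤ N i) → Runs M w → Runs N w
  runs-truncated w {M} {N} len le r i with M i ≤? K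
  ... | yes small = let y , run = r i in N i ∸ M i + y ,
          subst (λ x → RunN i w x (N i ∸ M i + y)) (m∸n+n≡m (subst (_≤ N i) (m≤n⇒m⊓n≡m small) (le i)))
                (run-shift w (N i ∸ M i) run)
  ... | no large = run-enough w (≤-trans (dot-cnt-≤ w (λ a → pre≤1 a i))
          (≤-trans (subst (_≤ K) (sym (*-identityʳ (length w))) len)
                   (subst (_≤ N i) (m≥n⇒m⊓n≡n (≰⇒≥ large)) (le i))))

  Recovers : (Fin nP → ℕ) → Fin nT → Fin nT → Set
  Recovers M a b = ∃ λ w → length w ≤ k × Runs M (a ∷ w ++ [ b ])

  recovers? : ∀ M a b → Dec (Recovers M a b)
  recovers? M a b = short-list? k (λ w → runs? M (a ∷ w ++ [ b ]))

  Violation : (Fin nP → ℕ) → Fin nT → Fin nT → Set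
  Violation M a b = ¬ (b ≡ a) × Runs M [ a ] × Runs M [ b ] × ¬ Recovers M a b

  violation? : ∀ M a b → Dec (Violation M a b)
  violation? M a b = ¬? (b ≟ a) ×-dec runs? M [ a ] ×-dec runs? M [ b ] ×-dec ¬? (recovers? M a b)

  -- A violation has a negative part, so truncation is used in both directions: enabledness passes
  -- from `M` to `N`, a recovering word from `N` back to `M`.
  violation-truncated : ∀ {M N a b} → (∀ i → M i ⊓ K ≡ N i ⊓ K) → Violation M a b → Violation N a b
  violation-truncated {M} {N} {a} {b} eq (b≢a , ra , rb , none) =
    b≢a , runs-truncated [ a ] (s≤s z≤n) M≤N ra , runs-truncated [ b ] (s≤s z≤n) M≤N rb ,
    λ { (w , le , r) → none (w , le , runs-truncated (a ∷ w ++ [ b ]) (word-short w le) N≤M r) }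
    where
    M≤N : ∀ i → M i ⊓ K ≤ N i
    M≤N i = subst (_≤ N i) (sym (eq i)) (m⊓n≤m (N i) K)
    N≤M : ∀ i → N i ⊓ K ≤ M i
    N≤M i = subst (_≤ M i) (eq i) (m⊓n≤m (M i) K)
    word-short : ∀ w → length w ≤ k → length (a ∷ w ++ [ b ]) ≤ K
    word-short w le = s≤s (subst (_≤ suc k) (sym (trans (length-++ w) (+-comm (length w) 1))) (s≤s le))

  net-graph : Graph nP
  net-graph = record
    { nE = nT ; src = λ _ → [] ; tgt = λ _ → [] ; need = pre S ; give = post S
    ; rigid = λ _ → false ; val = λ _ _ → 0 ; val-ok = λ _ _ () }

  -- A truncated value below `K` is the true number of tokens. The value `K` is only a lower bound,
  -- hence ω here and the test by `at-least`.
  exact : ℕ → Maybe ℕ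
  exact t with t <? K
  ... | yes _ = just t
  ... | no _  = nothing

  at-least : ℕ → ℕ
  at-least t with t <? K
  ... | yes _ = 0
  ... | no _  = K

  net-comp : (Fin nP → ℕ) → Comp nP
  net-comp τ = record
    { graph = net-graph ; qin = [] ; qout = [] ; cin = just ∘ M₀ ; cout = exact ∘ τ
    ; rin = λ _ () ; rout = λ _ () }

  -- The final link only tests that places truncated to K carry at least K tokens.
  query : (Fin nP → ℕ) → List (Item nP)
  query τ = comp (net-comp τ) ∷ link (at-least ∘ τ) (λ _ → 0) ∷ []

  Hit : (Fin nP → ℕ) → Set
  Hit τ = ∃ λ M → Reachable S M × (∀ i → M i ⊓ K ≡ τ i)

  free-path : ∀ w → Path {nT} (λ _ → []) (λ _ → []) [] w []
  free-path []      = refl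
  free-path (a ∷ w) = refl , free-path w

  truncation : ∀ {x t} → (∀ y → exact t ≡ just y → x ≡ y) → ∃ (λ z → x ≡ z + at-least t) → t ≤ K → x ⊓ K ≡ t
  truncation {x} {t} h (z , eq) t≤K with t <? K
  ... | yes lt = trans (cong (_⊓ K) (h t refl)) (m≤n⇒m⊓n≡m (<⇒≤ lt))
  ... | no ge  = trans (m≥n⇒m⊓n≡n (subst (K ≤_) (sym eq) (m≤n+m K z))) (≤-antisym (≮⇒≥ ge) t≤K)

  truncation⁻¹ : ∀ {x t} → x ⊓ K ≡ t → (∀ y → exact t ≡ just y → x ≡ y) × ∃ (λ z → x ≡ z + at-least t)
  truncation⁻¹ {x} {t} eq with t <? K
  ... | no ge  = (λ _ ()) , x ∸ K , sym (m∸n+n≡m (≤-trans (≮⇒≥ ge) (subst (_≤ x) eq (m⊓n≤m x K))))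
  ... | yes lt = (λ { y refl → x≡t }) , x , sym (+-identityʳ x)
    where
    x≡t : x ≡ t
    x≡t with x ≤? K
    ... | yes le = trans (sym (m≤n⇒m⊓n≡m le)) eq
    ... | no gt  = ⊥-elim (<-irrefl (trans (sym eq) (m≥n⇒m⊓n≡n (≰⇒≥ gt))) lt)

  query⇒hit : ∀ τ → (∀ i → τ i ≤ K) → Inhabited (query τ) → Hit τ
  query⇒hit τ τ≤K (m , _ , n , (w , _ , runs , mi , mo) , _ , fires , _)
    with run-fires w {M₀} {n} (λ i → subst (λ x → RunN i w x (n i)) (mi i _ refl) (runs i))
  ... | M , f , same = M , (w , f) , λ i → trans (cong (_⊓ K) (same i))
          (truncation (mo i) (proj₁ (fires i) , proj₁ (proj₂ (fires i))) (τ≤K i))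

  hit⇒query : ∀ τ → Hit τ → Inhabited (query τ)
  hit⇒query τ (M , (w , f) , eq) = M₀ , (λ i → proj₁ (proj₂ (truncation⁻¹ (eq i)))) , M ,
    (w , free-path w , fires-run w f , (λ { i _ refl → refl }) , λ i → proj₁ (truncation⁻¹ (eq i))) ,
    _ , (λ i → proj₁ (proj₂ (truncation⁻¹ (eq i))) , proj₂ (proj₂ (truncation⁻¹ (eq i))) , sym (+-identityʳ _)) , refl

  hit? : ∀ τ → (∀ i → τ i ≤ K) → Dec (Hit τ)
  hit? τ τ≤K = map′ (query⇒hit τ τ≤K) (hit⇒query τ) (inhabited? (query τ))

  profile : Fin (suc K ^ nP) → Fin nP → ℕ
  profile j i = toℕ (finToFun {n = nP} j i)

  profile≤K : ∀ j i → profile j i ≤ K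
  profile≤K j i = s≤s⁻¹ (toℕ<n (finToFun {n = nP} j i))

  profile-of : ∀ (M : Fin nP → ℕ) → ∃ λ j → ∀ i → M i ⊓ K ≡ profile j i
  profile-of M = funToFin truncated , λ i → sym (trans (cong toℕ (finToFun-funToFin truncated i)) (toℕ-fromℕ< _))
    where
    truncated : Fin nP → Fin (suc K)
    truncated i = fromℕ< (s≤s (m⊓n≤n (M i) K))

  -- The violation is tested at the truncated vector, which itself may be unreachable.
  ReachableViolation : Set
  ReachableViolation = ∃ λ j → Hit (profile j) × ∃ λ a → ∃ λ b → Violation (profile j) a b

  reachable-violation? : Dec ReachableViolation
  reachable-violation? = any? λ j → hit? (profile j) (profile≤K j) ×-dec any? λ a → any? λ b → violation? (profile j) a b

  idem : ∀ j {M : Fin nP → ℕ} → (∀ i → M i ⊓ K ≡ profile j i) → ∀ i → profile j i ⊓ K ≡ M i ⊓ K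
  idem j eq i = trans (m≤n⇒m⊓n≡m (profile≤K j i)) (sym (eq i))

  enabled⇒runs : ∀ {M a} → Enabled S M a → Runs M [ a ]
  enabled⇒runs {M} {a} en = firable⇒runs {w = [ a ]} (fire S M a , step en ε-fire)

  runs⇒enabled : ∀ {M a} → Runs M [ a ] → Enabled S M a
  runs⇒enabled {M} {a} r with runs⇒firable [ a ] r
  ... | _ , step en _ = en

  violation⇒¬persistent : ReachableViolation → ¬ ELkPersistent S k
  violation⇒¬persistent (j , (M , reach , eq) , a , b , viol) pers
    with violation-truncated {N = M} (idem j eq) viol
  ... | b≢a , ra , rb , none with pers M reach a (runs⇒enabled ra) b b≢a (runs⇒enabled rb)
  ...   | w , le , fir = none (w , le , firable⇒runs {w = a ∷ w ++ [ b ]} fir)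

  no-violation⇒persistent : ¬ ReachableViolation → ELkPersistent S k
  no-violation⇒persistent none M reach a ea b b≢a eb with recovers? M a b
  ... | yes (w , le , r) = w , le , runs⇒firable (a ∷ w ++ [ b ]) r
  ... | no h with profile-of M
  ...   | j , eq = ⊥-elim (none (j , (M , reach , eq) , a , b ,
            violation-truncated {M} (λ i → sym (idem j eq i)) (b≢a , enabled⇒runs ea , enabled⇒runs eb , h)))

  persistent? : Dec (ELkPersistent S k)
  persistent? = map′ no-violation⇒persistent (λ p v → violation⇒¬persistent v p) (¬? reachable-violation?)

theorem9 : (S : Net) (k : ℕ) → Dec (ELkPersistent S k)
theorem9 = NetDecision.persistent?
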